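{- Partially order the ring of symmetric functions by $f\le_h g$ iff $g-f$ is a nonnegative linear combination of the complete homogeneous basis $\{h_\lambda\}$. Then: (1) every $Q_{n,k,j}$ is an $h$-positive symmetric function; (2) for $n\ge1$ and $0\le j\le n$ such that the polynomial $\sum_{k=0}^{ln-1}Q_{n,k,j}t^k$ is nonzero, it is $t$-symmetric and $t$-unimodal with center of symmetry $\frac{l(n-j)}{2}$; (3) for $n\ge1$, with $Q_{n,k}=\sum_{j=0}^nQ_{n,k,j}$, the polynomial $\sum_{k=0}^{ln-1}Q_{n,k}t^k$ is $t$-symmetric and $t$-unimodal with center of symmetry $\frac{ln-1}{2}$.
   Context: Fix $l\ge1$. Let $\mathcal{B}$ be the totally ordered alphabet $1^0<1^1<\cdots<1^{l-1}<\overline{1^0}<2^0<\cdots<2^{l-1}<\overline{2^0}<3^0<\cdots$; $u^m$ is $m$-colored (unbarred), $\overline{u^0}$ is $0$-colored and barred; both have absolute value $u$ and weight $x_u$. A colored necklace is a primitive circular word over $\mathcal{B}$ (not a rotation class of a proper power $w'w'\cdots w'$) such that every barred letter is followed clockwise by a letter of lesser or equal absolute value, every $0$-colored unbarred letter is followed by a letter of greater or equal absolute value, and a length-one necklace is not a barred letter. A colored ornament is a finite multiset of colored necklaces, with length = number of letters, weight $\mathrm{wt}(R)$ = product of letter weights, and $\mathrm{col}_m(R)$ = number of $m$-colored letters. Define (Hyatt's colored-ornament interpretation, taken as definition) $Q_{n,k,j}=\sum_R\mathrm{wt}(R)$ over ornaments $R$ of length $n$ with $l\cdot(\#\text{barred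 letters})+\sum_{m=1}^{l-1}m\,\mathrm{col}_m(R)=k$ and exactly $j$ length-one necklaces consisting of a $0$-colored letter. A nonzero polynomial $A(t)=a_rt^r+\dots+a_st^s$ ($a_r,a_s\ne0$) with coefficients in a partially ordered ring is $t$-symmetric with center $\frac{r+s}{2}$ if $a_{r+i}=a_{s-i}$ for all $i$, and $t$-unimodal if $a_r\le a_{r+1}\le\cdots\le a_{\lfloor(r+s)/2\rfloor}=a_{\lfloor(r+s+1)/2\rfloor}\ge\cdots\ge a_s$. -}

module Defs where

open import Data.Nat using (ℕ; zero; suc; _+_; _*_; _∸_; _≤_; _<_; _≥_; _≡ᵇ_; _≤ᵇ_; _<ᵇ_; _/_)
open import Data.Bool using (Bool; true; false; _∧_; _∨_; not; if_then_else_)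
open import Data.List using (List; []; _∷_; _++_; map; concatMap; concat; replicate; take; drop; length; upTo; zip; zipWith; foldr)
open import Data.Nat.ListAction using (sum)
open import Data.List.Relation.Unary.All using (All)
open import Data.List.Relation.Unary.Linked using (Linked)
open import Data.Integer using (ℤ; +_; _-_) renaming (_+_ to _+ℤ_)
open import Data.Product using (Σ; ∃; ∃-syntax; _×_; _,_; proj₁; proj₂)
open import Relation.Binary.PropositionalEquality using (_≡_; _≢_)
open import Relation.Nullary using (¬_)

allB : {A : Set} → (A → Bool) → List A → Bool
allB p []       = true
allB p (x ∷ xs) = p x ∧ allB p xs

anyB : {A : Set} → (A → Bool) → List A → Bool
anyB p []       = false
anyB p (x ∷ xs) = p x ∨ anyB p xs

filterB : {A : Set} → (A → Bool) → List A → List A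
filterB p []       = []
filterB p (x ∷ xs) = if p x then x ∷ filterB p xs else filterB p xs

countB : {A : Set} → (A → Bool) → List A → ℕ
countB p xs = length (filterB p xs)

eqNL : List ℕ → List ℕ → Bool
eqNL []       []       = true
eqNL (x ∷ xs) (y ∷ ys) = (x ≡ᵇ y) ∧ eqNL xs ys
eqNL _        _        = false

-- The colored alphabet B.  Absolute values are 0-based here:
-- 'unb u m' is the letter (u+1)^m (m-colored, unbarred, weight x_{u+1}),
-- 'bar u' is the barred 0-colored letter overline{(u+1)^0}.

data Letter : Set where
  unb : ℕ → ℕ → Letter
  bar : ℕ → Letter

absL : Letter → ℕ
absL (unb u m) = u
absL (bar u)   = u

-- position in the total order of B:  u^0 < ... < u^{l-1} < bar u^0 < (u+1)^0 < ...
key : ℕ → Letter → ℕ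
key l (unb u m) = u * suc l + m
key l (bar u)   = u * suc l + l

eqL : Letter → Letter → Bool
eqL (unb u m) (unb v n) = (u ≡ᵇ v) ∧ (m ≡ᵇ n)
eqL (bar u)   (bar v)   = u ≡ᵇ v
eqL _         _         = false

eqW : List Letter → List Letter → Bool
eqW []       []       = true
eqW (a ∷ as) (b ∷ bs) = eqL a b ∧ eqW as bs
eqW _        _        = false

leqW : ℕ → List Letter → List Letter → Bool
leqW l []       _        = true
leqW l (a ∷ as) []       = false
leqW l (a ∷ as) (b ∷ bs) = (key l a <ᵇ key l b) ∨ ((key l a ≡ᵇ key l b) ∧ leqW l as bs)

rot : ℕ → List Letter → List Letter
rot i w = drop i w ++ take i w

-- Colored necklaces.  A necklace (rotation class) is represented by its
-- lexicographically least rotation.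

properPower : List Letter → Bool
properPower w =
  anyB (λ d → anyB (λ e → eqW w (concat (replicate e (take d w))))
                   (upTo (suc (length w))))
       (map suc (upTo (length w ∸ 1)))

-- condition on a letter a followed clockwise by b
okPair : Letter × Letter → Bool
okPair (bar u , b)          = absL b ≤ᵇ u
okPair (unb u zero , b)     = u ≤ᵇ absL b
okPair (unb u (suc m) , b)  = true

notBarSingle : List Letter → Bool
notBarSingle (bar u ∷ []) = false
notBarSingle _            = true

canonical : ℕ → List Letter → Bool
canonical l w = allB (λ i → leqW l w (rot i w)) (upTo (length w))

isNecklace : ℕ → List Letter → Bool
isNecklace l w =
  not (properPower w) ∧ allB okPair (zip w (rot 1 w)) ∧ notBarSingle w ∧ canonical l w

alphabet : ℕ → ℕ → List Letter
alphabet l N = concatMap (λ u → map (unb u) (upTo l) ++ (bar u ∷ [])) (upTo N)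

words : List Letter → ℕ → List (List Letter)
words A zero    = [] ∷ []
words A (suc m) = concatMap (λ a → map (a ∷_) (words A m)) A

necklaces : ℕ → ℕ → ℕ → List (List Letter)
necklaces l N n = concatMap (λ m → filterB (isNecklace l) (words (alphabet l N) (suc m))) (upTo n)

multisets : List (List Letter) → ℕ → List (List (List Letter))
multisets []       zero    = [] ∷ []
multisets []       (suc _) = []
multisets (w ∷ ws) n =
  concatMap (λ c → map (replicate c w ++_) (multisets ws (n ∸ c * length w)))
            (filterB (λ c → c * length w ≤ᵇ n) (upTo (suc n)))

kL : ℕ → Letter → ℕ
kL l (bar _)   = l
kL l (unb _ m) = m

kstat : ℕ → List (List Letter) → ℕ
kstat l R = sum (map (kL l) (concat R))

isZeroSingle : List Letter → Bool
isZeroSingle (unb _ zero ∷ []) = true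
isZeroSingle _                 = false

jstat : List (List Letter) → ℕ
jstat R = countB isZeroSingle R

content : ℕ → List (List Letter) → List ℕ
content N R = map (λ i → countB (λ a → absL a ≡ᵇ i) (concat R)) (upTo N)

-- Symmetric functions (with integer coefficients) are represented by
-- their monomial coefficients: f α = coefficient of x_1^{α_0} x_2^{α_1} ...

SymF : Set
SymF = List ℕ → ℤ

_≈F_ : SymF → SymF → Set
f ≈F g = ∀ α → f α ≡ g α

IsZeroF : SymF → Set
IsZeroF f = ∀ α → f α ≡ + 0

NonZeroF : SymF → Set
NonZeroF f = ∃[ α ] (f α ≢ + 0)

Qcount : ℕ → ℕ → ℕ → ℕ → List ℕ → ℕ
Qcount l n k j α =
  countB (λ R → eqNL (content (length α) R) α ∧ (kstat l R ≡ᵇ k) ∧ (jstat R ≡ᵇ j))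
         (multisets (necklaces l (length α) n) n)

Q : ℕ → ℕ → ℕ → ℕ → SymF
Q l n k j α = + Qcount l n k j α

sumℤ : List ℤ → ℤ
sumℤ = foldr _+ℤ_ (+ 0)

Qnk : ℕ → ℕ → ℕ → SymF
Qnk l n k α = sumℤ (map (λ j → Q l n k j α) (upTo (suc n)))

vecs : ℕ → ℕ → List (List ℕ)
vecs zero    zero    = [] ∷ []
vecs zero    (suc _) = []
vecs (suc N) d       = concatMap (λ a → map (a ∷_) (vecs N (d ∸ a))) (upTo (suc d))

leqPW : List ℕ → List ℕ → Bool
leqPW []       []       = true
leqPW (x ∷ xs) (y ∷ ys) = (x ≤ᵇ y) ∧ leqPW xs ys
leqPW _        _        = false

hcoef : List ℕ → List ℕ → ℕ
hcoef []       α = if allB (λ a → a ≡ᵇ 0) α then 1 else 0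
hcoef (p ∷ ps) α =
  sum (map (λ β → if leqPW β α then hcoef ps (zipWith _∸_ α β) else 0) (vecs (length α) p))

IsPartition : List ℕ → Set
IsPartition λs = All (λ p → 1 ≤ p) λs × Linked _≥_ λs

HPos : SymF → Set
HPos f = ∃[ L ] (All (λ cλ → IsPartition (proj₂ cλ)) L ×
                 (∀ α → f α ≡ + sum (map (λ cλ → proj₁ cλ * hcoef (proj₂ cλ) α) L)))

_≤h_ : SymF → SymF → Set
f ≤h g = HPos (λ α → g α - f α)

-- Polynomials Σ_{k=0}^{D} a_k t^k with symmetric-function coefficients

NonzeroPoly : (ℕ → SymF) → ℕ → Set
NonzeroPoly a D = ∃[ k ] (k ≤ D × NonZeroF (a k))

Lowest : (ℕ → SymF) → ℕ → ℕ → Set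
Lowest a D r = r ≤ D × NonZeroF (a r) × (∀ i → i < r → IsZeroF (a i))

Highest : (ℕ → SymF) → ℕ → ℕ → Set
Highest a D s = s ≤ D × NonZeroF (a s) × (∀ i → s < i → i ≤ D → IsZeroF (a i))

-- t-symmetric and t-unimodal (w.r.t. ≤h) with center c2/2
SymUnimodal : (ℕ → SymF) → ℕ → ℕ → Set
SymUnimodal a D c2 =
  ∀ r s → Lowest a D r → Highest a D s →
    (r + s ≡ c2)
  × (∀ i → i ≤ s ∸ r → a (r + i) ≈F a (s ∸ i))
  × (∀ i → r ≤ i → suc i ≤ (r + s) / 2 → a i ≤h a (suc i))
  × (a ((r + s) / 2) ≈F a ((r + s + 1) / 2))
  × (∀ i → (r + s + 1) / 2 ≤ i → suc i ≤ s → a (suc i) ≤h a i)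

{-# OPTIONS --safe #-}
-- Give u^m the weight x_u t^m and a barred u^0 the weight x_u t^l, and mark the 0-coloured singletons
-- by r.  The series O(z) of ornaments has logarithmic derivative Σ_w |w| Σ_m wt(w)^m z^{m|w|}, w running
-- over the necklaces.  As every circular word is a power of a unique primitive one, all of whose rotations
-- differ, this is, up to corrections for singletons, the series of closed walks of the transfer matrix
-- A_{uv} = x_u (T + t^l [u = v] + (t^l − 1) [v < u]) with T = 1 + t + … + t^{l-1}.  Being triangular
-- up to a matrix of rank one, A yields
--   O(z) = H(rz) F(z),   F(z) = (1 − t) / (H(t^l z) − t H(z)) = 1 / (1 − Σ_d (t + … + t^{ld-1}) h_d z^d),
-- H(z) = Σ_d h_d z^d.  So Σ_k Q_{n,k,j} t^k = h_j F_{n-j} is a sum of products of h's and of intervals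
-- t^s + … + t^{c-s}, and such a product of intervals is again a sum of intervals, whose centre is the sum
-- of the centres.  For the sum over j the centres agree after rewriting
-- Σ_j h_j F_{n-j} = Σ_{a≥1} (1 + t + … + t^{la-1}) h_a F_{n-a}.
module Submission where

open import Defs
open import Algebra.Bundles using (CommutativeRing)
open import Level using (0ℓ)
open import Data.Bool using (Bool; true; false; _∧_; not; if_then_else_)
open import Data.Bool.Properties using (∧-assoc; ∧-comm; ∧-idem; ∧-identityʳ; ∨-zeroʳ; T-≡; ¬-not)
open import Data.Empty using (⊥; ⊥-elim)
open import Data.Integer as ℤ using (ℤ; +_; -[1+_])
import Data.Integer.Properties as ℤ
open import Data.List using (List; []; _∷_; _++_; map; length; replicate; take; drop; upTo; applyUpTo; concat; concatMap; zip; zipWith)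
open import Data.List.Properties using (++-assoc; ++-identityʳ; ++-cancelˡ; take++drop≡id; length-++; length-take; length-drop; applyUpTo-∷ʳ)
open import Data.List.Membership.Propositional using (_∈_)
open import Data.List.Relation.Binary.Permutation.Propositional as ↭ using (_↭_; ↭-sym)
open import Data.List.Relation.Binary.Permutation.Propositional.Properties using (All-resp-↭)
open import Data.List.Relation.Unary.All as All using (All; []; _∷_)
import Data.List.Relation.Unary.All.Properties as All
open import Data.List.Relation.Unary.Any using (here; there)
import Data.List.Sort
open import Data.Maybe.Base using (Maybe; just; nothing)
open import Data.Nat as ℕ using (ℕ; zero; suc; _≤_; _<_; z≤n; s≤s; _≡ᵇ_; _≤ᵇ_; _<ᵇ_; _∸_; _⊓_; _/_)
import Data.Nat.DivMod as ℕ
import Data.Nat.Properties as ℕ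
open import Data.Nat.Divisibility using (_∣_; divides; ∣⇒≤)
open import Data.Nat.GCD using (gcd; gcd[m,n]∣m; gcd[m,n]∣n; gcd-GCD; module Bézout)
open import Data.Nat.ListAction using (sum)
open import Data.Nat.Tactic.RingSolver using (solve-∀)
open import Data.Product using (∃-syntax; ∃₂; _×_; _,_; proj₁; proj₂)
open import Data.Sum using (_⊎_; inj₁; inj₂)
open import Data.Unit using (⊤; tt)
open import Function using (_∘_; Equivalence)
open import Relation.Binary using (tri<; tri≈; tri>)
import Relation.Binary.Construct.Flip.EqAndOrd as Flip
open import Relation.Binary.PropositionalEquality as ≡ using (_≡_; _≢_)
open import Relation.Nullary using (¬_; yes; no)

-- Rings, finite sums and formal power series

-- A logarithmic derivative turns the product over necklaces into a sum over their powers, which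
-- closed walks can count. Going back to the series divides by n in degree n, whence the
-- torsion-free coefficient rings. No determinant is formed. Write A = T x 1ᵀ + L with L triangular.
-- The diagonal term consists of the powers of barred singletons; these are not necklaces, so it
-- cancels. The 0-coloured singletons are removed with weight 1 and restored with weight r, which
-- gives H(rz) / H(z). The variables t, r and x_u are adjoined one at a time as power series
-- variables, so that t - 1 can be cancelled and r separated by taking coefficients. The coefficient
-- at α is computed with `length α` variables, whereas one h-expansion must serve all α. Hence
-- expansions are lists fixed before the number of variables.

Ring₀ : Set₁
Ring₀ = CommutativeRing 0ℓ 0ℓ

module IntegerSolver (R : Ring₀) where
  open CommutativeRing R
  open import Algebra.Properties.Ring ring
    using (-‿involutive; -0#≈0#; -‿distribˡ-*; -‿distribʳ-*; -‿anti-homo-+)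
  open import Algebra.Properties.Semiring.Mult semiring
    using (×-homo-+; ×1-homo-*) renaming (_×_ to _·_)
  open import Algebra.Solver.Ring.AlmostCommutativeRing
  open import Relation.Binary.Reasoning.Setoid setoid

  nat : ℕ → Carrier
  nat n = n · 1#

  -- The clauses for 0 and 1 are separate so that the solver constants `con (+ 0)` and `con (+ 1)`
  -- evaluate to `0#` and `1#` themselves; `nat 1` is `1# + 0#`.
  int : ℤ → Carrier
  int (ℤ.+ 0)       = 0#
  int (ℤ.+ 1)       = 1#
  int (ℤ.+ suc n)   = nat (suc n)
  int -[1+ n ] = - nat (suc n)

  int-+ : ∀ n → int (ℤ.+ n) ≈ nat n
  int-+ 0 = refl
  int-+ 1 = sym (+-identityʳ 1#)
  int-+ (suc (suc n)) = refl

  cancel-1 : ∀ a b → (1# + a) + - (1# + b) ≈ a + - b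
  cancel-1 a b = begin
    (1# + a) + - (1# + b)  ≈⟨ +-cong (+-comm 1# a) (-‿anti-homo-+ 1# b) ⟩
    (a + 1#) + (- b + - 1#)  ≈⟨ +-assoc a 1# _ ⟩
    a + (1# + (- b + - 1#))  ≈⟨ +-congˡ (+-comm 1# _) ⟩
    a + ((- b + - 1#) + 1#)  ≈⟨ +-congˡ (+-assoc (- b) (- 1#) 1#) ⟩
    a + (- b + (- 1# + 1#))  ≈⟨ +-congˡ (+-congˡ (-‿inverseˡ 1#)) ⟩
    a + (- b + 0#)  ≈⟨ +-congˡ (+-identityʳ _) ⟩
    a + - b ∎

  int-⊖ : ∀ m n → int (m ℤ.⊖ n) ≈ nat m + - nat n
  int-⊖ zero zero = sym (trans (+-congˡ -0#≈0#) (+-identityʳ 0#))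
  int-⊖ zero (suc n) = sym (+-identityˡ _)
  int-⊖ (suc m) zero = trans (int-+ (suc m)) (sym (trans (+-congˡ -0#≈0#) (+-identityʳ _)))
  int-⊖ (suc m) (suc n) = begin
    int (suc m ℤ.⊖ suc n)  ≡⟨ ≡.cong int (ℤ.[1+m]⊖[1+n]≡m⊖n m n) ⟩
    int (m ℤ.⊖ n)  ≈⟨ int-⊖ m n ⟩
    nat m + - nat n  ≈⟨ cancel-1 (nat m) (nat n) ⟨
    nat (suc m) + - nat (suc n)  ∎

  int-neg : ∀ i → int (ℤ.- i) ≈ - int i
  int-neg (ℤ.+ 0) = sym -0#≈0#
  int-neg (ℤ.+ 1) = -‿cong (+-identityʳ 1#)
  int-neg (ℤ.+ suc (suc n)) = refl
  int-neg -[1+ n ] = trans (int-+ (suc n)) (sym (-‿involutive _))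

  int-add : ∀ i j → int (i ℤ.+ j) ≈ int i + int j
  int-add (ℤ.+ m) (ℤ.+ n) =
    trans (int-+ (m ℕ.+ n)) (trans (×-homo-+ 1# m n) (sym (+-cong (int-+ m) (int-+ n))))
  int-add (ℤ.+ m) -[1+ n ] = trans (int-⊖ m (suc n)) (+-congʳ (sym (int-+ m)))
  int-add -[1+ m ] (ℤ.+ n) =
    trans (int-⊖ n (suc m)) (trans (+-comm _ _) (+-congˡ (sym (int-+ n))))
  int-add -[1+ m ] -[1+ n ] = begin
    - nat (suc (suc (m ℕ.+ n)))  ≡⟨ ≡.cong (λ k → - nat (suc k)) (≡.sym (ℕ.+-suc m n)) ⟩
    - nat (suc m ℕ.+ suc n)  ≈⟨ -‿cong (×-homo-+ 1# (suc m) (suc n)) ⟩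
    - (nat (suc m) + nat (suc n)) ≈⟨ -‿anti-homo-+ _ _ ⟩
    - nat (suc n) + - nat (suc m) ≈⟨ +-comm _ _ ⟩
    - nat (suc m) + - nat (suc n) ∎

  int-mulℕ : ∀ m i → int (ℤ.+ m ℤ.* i) ≈ nat m * int i
  int-mulℕ m (ℤ.+ n) = begin
    int (ℤ.+ m ℤ.* ℤ.+ n)  ≡⟨ ≡.cong int (≡.sym (ℤ.pos-* m n)) ⟩
    int (ℤ.+ (m ℕ.* n))  ≈⟨ int-+ (m ℕ.* n) ⟩
    nat (m ℕ.* n)  ≈⟨ ×1-homo-* m n ⟩
    nat m * nat n  ≈⟨ *-congˡ (sym (int-+ n)) ⟩
    nat m * int (ℤ.+ n)     ∎
  int-mulℕ m -[1+ n ] = begin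
    int (ℤ.+ m ℤ.* ℤ.- ℤ.+ suc n)  ≡⟨ ≡.cong int (≡.sym (ℤ.neg-distribʳ-* (ℤ.+ m) (ℤ.+ suc n))) ⟩
    int (ℤ.- (ℤ.+ m ℤ.* ℤ.+ suc n)) ≈⟨ int-neg (ℤ.+ m ℤ.* ℤ.+ suc n) ⟩
    - int (ℤ.+ m ℤ.* ℤ.+ suc n)  ≡⟨ ≡.cong (λ k → - int k) (≡.sym (ℤ.pos-* m (suc n))) ⟩
    - int (ℤ.+ (m ℕ.* suc n))  ≈⟨ -‿cong (trans (int-+ (m ℕ.* suc n)) (×1-homo-* m (suc n))) ⟩
    - (nat m * nat (suc n))  ≈⟨ -‿distribʳ-* _ _ ⟩
    nat m * - nat (suc n)           ∎

  int-mul : ∀ i j → int (i ℤ.* j) ≈ int i * int j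
  int-mul (ℤ.+ m) j = trans (int-mulℕ m j) (*-congʳ (sym (int-+ m)))
  int-mul -[1+ m ] j = begin
    int (ℤ.- ℤ.+ suc m ℤ.* j)  ≡⟨ ≡.cong int (≡.sym (ℤ.neg-distribˡ-* (ℤ.+ suc m) j)) ⟩
    int (ℤ.- (ℤ.+ suc m ℤ.* j)) ≈⟨ int-neg (ℤ.+ suc m ℤ.* j) ⟩
    - int (ℤ.+ suc m ℤ.* j)  ≈⟨ -‿cong (int-mulℕ (suc m) j) ⟩
    - (nat (suc m) * int j)  ≈⟨ -‿distribˡ-* _ _ ⟩
    - nat (suc m) * int j       ∎

  homomorphism : ℤ.+-*-rawRing -Raw-AlmostCommutative⟶ fromCommutativeRing R
  homomorphism = record
    { ⟦_⟧ = int ; +-homo = int-add ; *-homo = int-mul ; -‿homo = int-neg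
    ; 0-homo = refl ; 1-homo = refl }

  dec : ∀ i j → Maybe (int i ≈ int j)
  dec i j with i ℤ.≟ j
  ... | yes ≡.refl = just refl
  ... | no _ = nothing

  open import Algebra.Solver.Ring ℤ.+-*-rawRing (fromCommutativeRing R) homomorphism dec public
    using (solve; _:=_; _:+_; _:*_; :-_; _:-_; con)

module FiniteSums (R : Ring₀) where
  open CommutativeRing R
  open import Relation.Binary.Reasoning.Setoid setoid
  open import Algebra.Properties.CommutativeSemigroup +-commutativeSemigroup using (interchange)

  infixr 6 _▸_
  -- The Iverson bracket: side conditions of sums become Boolean factors.
  _▸_ : Bool → Carrier → Carrier
  b ▸ x = if b then x else 0#

  ▸-cong : ∀ b {x y} → x ≈ y → b ▸ x ≈ b ▸ y
  ▸-cong true  p = p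
  ▸-cong false p = refl

  ▸-congᵇ : ∀ {b} {x y} → (b ≡ true → x ≈ y) → b ▸ x ≈ b ▸ y
  ▸-congᵇ {true}  p = p ≡.refl
  ▸-congᵇ {false} p = refl

  ▸-∧ : ∀ b c x → (b ∧ c) ▸ x ≈ b ▸ (c ▸ x)
  ▸-∧ true  c x = refl
  ▸-∧ false c x = refl

  ▸-0 : ∀ b → b ▸ 0# ≈ 0#
  ▸-0 true  = refl
  ▸-0 false = refl

  ▸-*ˡ : ∀ b c x → c * (b ▸ x) ≈ b ▸ (c * x)
  ▸-*ˡ true  c x = refl
  ▸-*ˡ false c x = zeroʳ c

  ▸-*ʳ : ∀ b c x → (b ▸ x) * c ≈ b ▸ (x * c)
  ▸-*ʳ true  c x = refl
  ▸-*ʳ false c x = zeroˡ c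

  ▸-+ : ∀ b x y → b ▸ (x + y) ≈ (b ▸ x) + (b ▸ y)
  ▸-+ true  x y = refl
  ▸-+ false x y = sym (+-identityʳ 0#)

  ▸-swap : ∀ b c x → b ▸ c ▸ x ≈ c ▸ b ▸ x
  ▸-swap true  c x = refl
  ▸-swap false c x = sym (▸-0 c)

  module _ {A : Set} where
    ∑ : List A → (A → Carrier) → Carrier
    ∑ []       f = 0#
    ∑ (x ∷ xs) f = f x + ∑ xs f

    ∑-cong : ∀ xs {f g : A → Carrier} → (∀ x → f x ≈ g x) → ∑ xs f ≈ ∑ xs g
    ∑-cong []       p = refl
    ∑-cong (x ∷ xs) p = +-cong (p x) (∑-cong xs p)

    ∑-0 : ∀ xs → ∑ xs (λ _ → 0#) ≈ 0#
    ∑-0 []       = refl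
    ∑-0 (x ∷ xs) = trans (+-identityˡ _) (∑-0 xs)

    ∑-++ : ∀ xs ys f → ∑ (xs ++ ys) f ≈ ∑ xs f + ∑ ys f
    ∑-++ []       ys f = sym (+-identityˡ _)
    ∑-++ (x ∷ xs) ys f = trans (+-congˡ (∑-++ xs ys f)) (sym (+-assoc _ _ _))

    ∑-+ : ∀ xs f g → ∑ xs (λ x → f x + g x) ≈ ∑ xs f + ∑ xs g
    ∑-+ []       f g = sym (+-identityʳ 0#)
    ∑-+ (x ∷ xs) f g = trans (+-congˡ (∑-+ xs f g)) (interchange _ _ _ _)

    ∑-*ˡ : ∀ xs c f → c * ∑ xs f ≈ ∑ xs (λ x → c * f x)
    ∑-*ˡ []       c f = zeroʳ c
    ∑-*ˡ (x ∷ xs) c f = trans (distribˡ _ _ _) (+-congˡ (∑-*ˡ xs c f))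

    ∑-▸ : ∀ xs b f → b ▸ ∑ xs f ≈ ∑ xs (λ x → b ▸ f x)
    ∑-▸ xs true  f = refl
    ∑-▸ xs false f = sym (∑-0 xs)

    ∑-filterB : ∀ (p : A → Bool) xs f → ∑ (filterB p xs) f ≈ ∑ xs (λ x → p x ▸ f x)
    ∑-filterB p []       f = refl
    ∑-filterB p (x ∷ xs) f with p x
    ... | true  = +-congˡ (∑-filterB p xs f)
    ... | false = trans (∑-filterB p xs f) (sym (+-identityˡ _))

  module _ {A B : Set} where
    ∑-map : ∀ (h : A → B) xs f → ∑ (map h xs) f ≈ ∑ xs (f ∘ h)
    ∑-map h []       f = refl
    ∑-map h (x ∷ xs) f = +-congˡ (∑-map h xs f)

    ∑-concatMap : ∀ (h : A → List B) xs f → ∑ (concatMap h xs) f ≈ ∑ xs (λ x → ∑ (h x) f)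
    ∑-concatMap h []       f = refl
    ∑-concatMap h (x ∷ xs) f = trans (∑-++ (h x) _ f) (+-congˡ (∑-concatMap h xs f))

    ∑-swap : ∀ (xs : List A) (ys : List B) (f : A → B → Carrier) →
             ∑ xs (λ x → ∑ ys (λ y → f x y)) ≈ ∑ ys (λ y → ∑ xs (λ x → f x y))
    ∑-swap []       ys f = sym (∑-0 ys)
    ∑-swap (x ∷ xs) ys f = trans (+-congˡ (∑-swap xs ys f)) (sym (∑-+ ys _ _))

  opaque
    -- Opaque: outside this block a sum unfolds only through `∑<-empty` and `∑<-suc`, so goals stay
    -- folded.
    ∑< : ℕ → (ℕ → Carrier) → Carrier
    ∑< zero    f = 0#
    ∑< (suc n) f = f 0 + ∑< n (f ∘ suc)

    ∑<-empty : ∀ f → ∑< 0 f ≈ 0#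
    ∑<-empty f = refl

    ∑<-suc : ∀ n f → ∑< (suc n) f ≈ f 0 + ∑< n (f ∘ suc)
    ∑<-suc n f = refl

    ∑<-cong : ∀ n {f g} → (∀ i → i ℕ.< n → f i ≈ g i) → ∑< n f ≈ ∑< n g
    ∑<-cong zero    p = refl
    ∑<-cong (suc n) p = +-cong (p 0 (ℕ.s≤s ℕ.z≤n)) (∑<-cong n (λ i i<n → p (suc i) (ℕ.s≤s i<n)))

    ∑<-0 : ∀ n → ∑< n (λ _ → 0#) ≈ 0#
    ∑<-0 zero    = refl
    ∑<-0 (suc n) = trans (+-identityˡ _) (∑<-0 n)

    ∑<-+ : ∀ n f g → ∑< n (λ x → f x + g x) ≈ ∑< n f + ∑< n g
    ∑<-+ zero    f g = sym (+-identityʳ 0#)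
    ∑<-+ (suc n) f g = trans (+-congˡ (∑<-+ n _ _)) (interchange _ _ _ _)

    ∑<-*ˡ : ∀ n c f → c * ∑< n f ≈ ∑< n (λ x → c * f x)
    ∑<-*ˡ zero    c f = zeroʳ c
    ∑<-*ˡ (suc n) c f = trans (distribˡ _ _ _) (+-congˡ (∑<-*ˡ n c _))

    ∑<-*ʳ : ∀ n c f → ∑< n f * c ≈ ∑< n (λ x → f x * c)
    ∑<-*ʳ zero    c f = zeroˡ c
    ∑<-*ʳ (suc n) c f = trans (distribʳ _ _ _) (+-congˡ (∑<-*ʳ n c _))

    ∑<-▸ : ∀ n b f → b ▸ ∑< n f ≈ ∑< n (λ x → b ▸ f x)
    ∑<-▸ n true  f = refl
    ∑<-▸ n false f = sym (∑<-0 n)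

    ∑<-last : ∀ n f → ∑< (suc n) f ≈ ∑< n f + f n
    ∑<-last zero    f = +-comm _ _
    ∑<-last (suc n) f = trans (+-congˡ (∑<-last n (f ∘ suc))) (sym (+-assoc _ _ _))

    ∑<-swap : ∀ m n (f : ℕ → ℕ → Carrier) → ∑< m (λ i → ∑< n (λ j → f i j)) ≈ ∑< n (λ j → ∑< m (λ i → f i j))
    ∑<-swap zero    n f = sym (∑<-0 n)
    ∑<-swap (suc m) n f = trans (+-congˡ (∑<-swap m n (f ∘ suc))) (sym (∑<-+ n _ _))

    ∑-∑<-swap : ∀ {A : Set} (xs : List A) n (f : A → ℕ → Carrier) →
                ∑ xs (λ x → ∑< n (f x)) ≈ ∑< n (λ j → ∑ xs (λ x → f x j))
    ∑-∑<-swap []       n f = sym (∑<-0 n)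
    ∑-∑<-swap (x ∷ xs) n f = trans (+-congˡ (∑-∑<-swap xs n f)) (sym (∑<-+ n _ _))

    ∑-applyUpTo : ∀ {A : Set} (h : ℕ → A) n f → ∑ (applyUpTo h n) f ≈ ∑< n (f ∘ h)
    ∑-applyUpTo h zero    f = refl
    ∑-applyUpTo h (suc n) f = +-congˡ (∑-applyUpTo (h ∘ suc) n f)

    ∑-upTo : ∀ n f → ∑ (upTo n) f ≈ ∑< n f
    ∑-upTo n f = ∑-applyUpTo (λ i → i) n f

    ∑<-zero : ∀ n {f} → (∀ i → i ℕ.< n → f i ≈ 0#) → ∑< n f ≈ 0#
    ∑<-zero n p = trans (∑<-cong n p) (∑<-0 n)

    ∑<-single′ : ∀ n k {f} → k ℕ.< n → (∀ i → i ℕ.< n → i ≡.≢ k → f i ≈ 0#) → ∑< n f ≈ f k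
    ∑<-single′ (suc n) zero    _ p = trans (+-congˡ (∑<-zero n (λ i i<n → p (suc i) (ℕ.s≤s i<n) λ ()))) (+-identityʳ _)
    ∑<-single′ (suc n) (suc k) (ℕ.s≤s k<n) p =
      trans (+-cong (p 0 (ℕ.s≤s ℕ.z≤n) λ ()) (∑<-single′ n k k<n (λ i i<n i≢k → p (suc i) (ℕ.s≤s i<n) (i≢k ∘ ℕ.suc-injective)))) (+-identityˡ _)

  ∑<-single : ∀ n k {f} → k ℕ.< n → (∀ i → i ≡.≢ k → f i ≈ 0#) → ∑< n f ≈ f k
  ∑<-single n k k<n p = ∑<-single′ n k k<n (λ i _ → p i)

module PowerSeries (R : Ring₀) where
  open CommutativeRing R
  open import Relation.Binary.Reasoning.Setoid setoid
  open import Algebra.Properties.CommutativeSemigroup +-commutativeSemigroup using (interchange; x∙yz≈y∙xz)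

  Series : Set
  Series = ℕ → Carrier

  infix 4 _≋_
  -- A record instead of a bare function type, so that unification recovers both series from an
  -- equation between them.
  record _≋_ (f g : Series) : Set where
    constructor coeffs
    field at : ∀ n → f n ≈ g n
  open _≋_ public

  infixl 6 _⊕_
  infixl 7 _⋆_
  -- The Cauchy product comes from f = f₀ + z f′, hence f g = f₀ g + z f′ g. In this form the ring
  -- laws follow by induction on the degree; `⋆-sum` recovers the convolution.
  _⊕_ _⋆_ : Series → Series → Series
  (f ⊕ g) n = f n + g n
  (f ⋆ g) zero    = f 0 * g 0
  (f ⋆ g) (suc n) = f 0 * g (suc n) + ((f ∘ suc) ⋆ g) n

  ⊝_ : Series → Series
  (⊝ f) n = - f n

  const : Carrier → Series
  const c zero    = c
  const c (suc n) = 0#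

  ⋆-cong′ : ∀ {f f′ g g′} → (∀ n → f n ≈ f′ n) → (∀ n → g n ≈ g′ n) → ∀ n → (f ⋆ g) n ≈ (f′ ⋆ g′) n
  ⋆-cong′ p q zero    = *-cong (p 0) (q 0)
  ⋆-cong′ p q (suc n) = +-cong (*-cong (p 0) (q (suc n))) (⋆-cong′ (p ∘ suc) q n)

  -- The defining recursion read from the right-hand factor; comparing the two yields commutativity.
  ⋆-last : ∀ f g n → (f ⋆ g) (suc n) ≈ f (suc n) * g 0 + (f ⋆ (g ∘ suc)) n
  ⋆-last f g zero    = +-comm _ _
  ⋆-last f g (suc n) = begin
    f 0 * g (suc (suc n)) + ((f ∘ suc) ⋆ g) (suc n)  ≈⟨ +-congˡ (⋆-last (f ∘ suc) g n) ⟩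
    f 0 * g (suc (suc n)) + (f (suc (suc n)) * g 0 + ((f ∘ suc) ⋆ (g ∘ suc)) n) ≈⟨ x∙yz≈y∙xz _ _ _ ⟩
    f (suc (suc n)) * g 0 + (f ⋆ (g ∘ suc)) (suc n) ∎

  ⋆-comm : ∀ f g n → (f ⋆ g) n ≈ (g ⋆ f) n
  ⋆-comm f g zero    = *-comm _ _
  ⋆-comm f g (suc n) = begin
    f 0 * g (suc n) + ((f ∘ suc) ⋆ g) n ≈⟨ +-cong (*-comm _ _) (⋆-comm (f ∘ suc) g n) ⟩
    g (suc n) * f 0 + (g ⋆ (f ∘ suc)) n ≈⟨ ⋆-last g f n ⟨
    (g ⋆ f) (suc n) ∎

  ⋆-distribʳ : ∀ h f g n → ((f ⊕ g) ⋆ h) n ≈ (f ⋆ h) n + (g ⋆ h) n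
  ⋆-distribʳ h f g zero    = distribʳ _ _ _
  ⋆-distribʳ h f g (suc n) =
    trans (+-cong (distribʳ _ _ _) (⋆-distribʳ h (f ∘ suc) (g ∘ suc) n)) (interchange _ _ _ _)

  ⋆-scale : ∀ c f g n → ((λ i → c * f i) ⋆ g) n ≈ c * (f ⋆ g) n
  ⋆-scale c f g zero    = *-assoc _ _ _
  ⋆-scale c f g (suc n) = trans (+-cong (*-assoc _ _ _) (⋆-scale c (f ∘ suc) g n)) (sym (distribˡ _ _ _))

  ⋆-assoc : ∀ f g h n → ((f ⋆ g) ⋆ h) n ≈ (f ⋆ (g ⋆ h)) n
  ⋆-assoc f g h zero    = *-assoc _ _ _
  ⋆-assoc f g h (suc n) = begin
    (f 0 * g 0) * h (suc n) + (((λ i → f 0 * g (suc i)) ⊕ ((f ∘ suc) ⋆ g)) ⋆ h) n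
      ≈⟨ +-cong (*-assoc _ _ _) (⋆-distribʳ h _ _ n) ⟩
    f 0 * (g 0 * h (suc n)) + (((λ i → f 0 * g (suc i)) ⋆ h) n + (((f ∘ suc) ⋆ g) ⋆ h) n)
      ≈⟨ +-congˡ (+-cong (⋆-scale (f 0) (g ∘ suc) h n) (⋆-assoc (f ∘ suc) g h n)) ⟩
    f 0 * (g 0 * h (suc n)) + (f 0 * ((g ∘ suc) ⋆ h) n + ((f ∘ suc) ⋆ (g ⋆ h)) n)
      ≈⟨ +-assoc _ _ _ ⟨
    (f 0 * (g 0 * h (suc n)) + f 0 * ((g ∘ suc) ⋆ h) n) + ((f ∘ suc) ⋆ (g ⋆ h)) n
      ≈⟨ +-congʳ (distribˡ _ _ _) ⟨
    (f ⋆ (g ⋆ h)) (suc n) ∎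

  0⋆ : ∀ {f} g → (∀ n → f n ≈ 0#) → ∀ n → (f ⋆ g) n ≈ 0#
  0⋆ g p zero    = trans (*-congʳ (p 0)) (zeroˡ _)
  0⋆ g p (suc n) = trans (+-cong (trans (*-congʳ (p 0)) (zeroˡ _)) (0⋆ g (p ∘ suc) n)) (+-identityʳ _)

  const-⋆ : ∀ c g n → (const c ⋆ g) n ≈ c * g n
  const-⋆ c g zero    = refl
  const-⋆ c g (suc n) = trans (+-congˡ (0⋆ g (λ _ → refl) n)) (+-identityʳ _)

  -- Being a commutative ring again, it can be iterated: the variables of the problem are adjoined
  -- one after another, with z outermost.
  ⟨_⟦z⟧⟩ : Ring₀
  ⟨_⟦z⟧⟩ = record
    { Carrier = Series ; _≈_ = _≋_ ; _+_ = _⊕_ ; _*_ = _⋆_ ; -_ = ⊝_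
    ; 0# = λ _ → 0# ; 1# = const 1#
    ; isCommutativeRing = record
      { isRing = record
        { +-isAbelianGroup = record
          { isGroup = record
            { isMonoid = record
              { isSemigroup = record
                { isMagma = record
                  { isEquivalence = record
                    { refl = coeffs λ _ → refl ; sym = λ p → coeffs λ n → sym (at p n)
                    ; trans = λ p q → coeffs λ n → trans (at p n) (at q n) }
                  ; ∙-cong = λ p q → coeffs λ n → +-cong (at p n) (at q n) }
                ; assoc = λ f g h → coeffs λ n → +-assoc _ _ _ }
              ; identity = (λ f → coeffs λ n → +-identityˡ _) , (λ f → coeffs λ n → +-identityʳ _) }
            ; inverse = (λ f → coeffs λ n → -‿inverseˡ _) , (λ f → coeffs λ n → -‿inverseʳ _)
            ; ⁻¹-cong = λ p → coeffs λ n → -‿cong (at p n) }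
          ; comm = λ f g → coeffs λ n → +-comm _ _ }
        ; *-cong = λ p q → coeffs (⋆-cong′ (at p) (at q))
        ; *-assoc = λ f g h → coeffs (⋆-assoc f g h)
        ; *-identity = (λ f → coeffs λ n → trans (const-⋆ 1# f n) (*-identityˡ _))
                     , (λ f → coeffs λ n → trans (⋆-comm f _ n) (trans (const-⋆ 1# f n) (*-identityˡ _)))
        ; distrib = (λ f g h → coeffs λ n → trans (⋆-comm f _ n)
                        (trans (⋆-distribʳ f g h n) (+-cong (⋆-comm g f n) (⋆-comm h f n))))
                  , (λ f g h → coeffs (⋆-distribʳ f g h)) }
      ; *-comm = λ f g → coeffs (⋆-comm f g) } }

-- Words, rotations and primitive roots

module Words where
  open import Data.Nat using (_+_; _*_)
  open import Data.Bool using (T)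
  open ≡ using (refl; sym; trans; cong; cong₂; subst; module ≡-Reasoning)

  ∧-true : ∀ {a b} → a ∧ b ≡ true → a ≡ true × b ≡ true
  ∧-true {true} p = refl , p

  ≡ᵇ-sound : ∀ {m n} → (m ≡ᵇ n) ≡ true → m ≡ n
  ≡ᵇ-sound {m} {n} p = ℕ.≡ᵇ⇒≡ m n (subst T (sym p) _)

  ≡ᵇ-refl : ∀ n → (n ≡ᵇ n) ≡ true
  ≡ᵇ-refl zero    = refl
  ≡ᵇ-refl (suc n) = ≡ᵇ-refl n

  ≡ᵇ-false : ∀ {m n} → m ≢ n → (m ≡ᵇ n) ≡ false
  ≡ᵇ-false m≢n = ¬-not (m≢n ∘ ≡ᵇ-sound)

  <ᵇ-sound : ∀ {m n} → (m <ᵇ n) ≡ true → m < n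
  <ᵇ-sound {m} {n} p = ℕ.<ᵇ⇒< m n (subst T (sym p) _)

  <ᵇ-complete : ∀ {m n} → m < n → (m <ᵇ n) ≡ true
  <ᵇ-complete m<n = Equivalence.to T-≡ (ℕ.<⇒<ᵇ m<n)

  ≤ᵇ-true : ∀ {m n} → m ≤ n → (m ≤ᵇ n) ≡ true
  ≤ᵇ-true m≤n = Equivalence.to T-≡ (ℕ.≤⇒≤ᵇ m≤n)

  ≤ᵇ-sound : ∀ {m n} → (m ≤ᵇ n) ≡ true → m ≤ n
  ≤ᵇ-sound {m} {n} p = ℕ.≤ᵇ⇒≤ m n (Equivalence.from T-≡ p)

  ≤ᵇ-false : ∀ {m n} → ¬ m ≤ n → (m ≤ᵇ n) ≡ false
  ≤ᵇ-false m≰n = ¬-not (m≰n ∘ ≤ᵇ-sound)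

  ≤ᵇ-suc : ∀ m n → (suc m ≤ᵇ suc n) ≡ (m ≤ᵇ n)
  ≤ᵇ-suc zero    n = refl
  ≤ᵇ-suc (suc m) n = refl

  allB-sound : ∀ {A : Set} (p : A → Bool) n h → allB p (applyUpTo h n) ≡ true → ∀ i → i < n → p (h i) ≡ true
  allB-sound p (suc n) h q zero    _         = proj₁ (∧-true q)
  allB-sound p (suc n) h q (suc i) (s≤s i<n) = allB-sound p n (h ∘ suc) (proj₂ (∧-true q)) i i<n

  allB-complete : ∀ {A : Set} (p : A → Bool) n h → (∀ i → i < n → p (h i) ≡ true) → allB p (applyUpTo h n) ≡ true
  allB-complete p zero    h q = refl
  allB-complete p (suc n) h q rewrite q 0 (s≤s z≤n) = allB-complete p n (h ∘ suc) (λ i i<n → q (suc i) (s≤s i<n))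

  anyB-sound : ∀ {A : Set} (p : A → Bool) n h → anyB p (applyUpTo h n) ≡ true → ∃[ i ] (i < n × p (h i) ≡ true)
  anyB-sound p (suc n) h q with p (h 0) in eq
  ... | true = 0 , s≤s z≤n , eq
  ... | false with anyB-sound p n (h ∘ suc) q
  ...   | i , i<n , r = suc i , s≤s i<n , r

  anyB-complete : ∀ {A : Set} (p : A → Bool) n h i → i < n → p (h i) ≡ true → anyB p (applyUpTo h n) ≡ true
  anyB-complete p (suc n) h zero    _         q rewrite q = refl
  anyB-complete p (suc n) h (suc i) (s≤s i<n) q
    rewrite anyB-complete p n (h ∘ suc) i i<n q = ∨-zeroʳ (p (h 0))

  map-applyUpTo : ∀ {A B : Set} (f : A → B) h n → map f (applyUpTo h n) ≡ applyUpTo (f ∘ h) n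
  map-applyUpTo f h zero    = refl
  map-applyUpTo f h (suc n) = cong (f (h 0) ∷_) (map-applyUpTo f (h ∘ suc) n)

  module _ {A : Set} where

    power : ℕ → List A → List A
    power m u = concat (replicate m u)

    rot₁ : List A → List A
    rot₁ []      = []
    rot₁ (a ∷ r) = r ++ a ∷ []

    -- Unlike `rot`, which stops rotating beyond the length of the word, this is an action of ℕ, so
    -- that periods can be added and multiplied. `rot-ρ` compares the two.
    ρ : ℕ → List A → List A
    ρ zero    w = w
    ρ (suc i) w = rot₁ (ρ i w)

    ρ-+ : ∀ i j w → ρ (i + j) w ≡ ρ i (ρ j w)
    ρ-+ zero    j w = refl
    ρ-+ (suc i) j w = cong rot₁ (ρ-+ i j w)

    ρ-comm : ∀ i j w → ρ i (ρ j w) ≡ ρ j (ρ i w)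
    ρ-comm i j w = trans (sym (ρ-+ i j w)) (trans (cong (λ k → ρ k w) (ℕ.+-comm i j)) (ρ-+ j i w))

    ρ-suc : ∀ i w → ρ (suc i) w ≡ ρ i (rot₁ w)
    ρ-suc i w = ρ-comm 1 i w

    ρ-++ : ∀ u s → ρ (length u) (u ++ s) ≡ s ++ u
    ρ-++ []      s = sym (++-identityʳ s)
    ρ-++ (a ∷ u) s = begin
      ρ (suc (length u)) (a ∷ u ++ s)  ≡⟨ ρ-suc (length u) _ ⟩
      ρ (length u) ((u ++ s) ++ a ∷ [])  ≡⟨ cong (ρ (length u)) (++-assoc u s _) ⟩
      ρ (length u) (u ++ (s ++ a ∷ []))  ≡⟨ ρ-++ u (s ++ a ∷ []) ⟩
      (s ++ a ∷ []) ++ u  ≡⟨ ++-assoc s _ u ⟩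
      s ++ a ∷ u ∎
      where open ≡-Reasoning

    length-rot₁ : ∀ w → length (rot₁ w) ≡ length w
    length-rot₁ []      = refl
    length-rot₁ (a ∷ r) = trans (length-++ r) (ℕ.+-comm (length r) 1)

    length-ρ : ∀ i w → length (ρ i w) ≡ length w
    length-ρ zero    w = refl
    length-ρ (suc i) w = trans (length-rot₁ (ρ i w)) (length-ρ i w)

    ρ-length : ∀ w → ρ (length w) w ≡ w
    ρ-length w = trans (cong (ρ (length w)) (sym (++-identityʳ w))) (ρ-++ w [])

    ρ-multiple : ∀ k n w → ρ n w ≡ w → ρ (k * n) w ≡ w
    ρ-multiple zero    n w p = refl
    ρ-multiple (suc k) n w p = trans (ρ-+ n (k * n) w) (trans (cong (ρ n) (ρ-multiple k n w p)) p)

    -- Bézout's identity without subtraction is g + y n = x m, or the same with m and n exchanged.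
    -- Rotating first by the multiple that does nothing turns a rotation by g into one by the other
    -- multiple.
    ρ-gcd : ∀ m n w → ρ m w ≡ w → ρ n w ≡ w → ρ (gcd m n) w ≡ w
    ρ-gcd m n w p q with Bézout.identity (gcd-GCD m n)
    ... | Bézout.+- x y eq = begin
      ρ (gcd m n) w  ≡⟨ cong (ρ (gcd m n)) (ρ-multiple y n w q) ⟨
      ρ (gcd m n) (ρ (y * n) w)  ≡⟨ ρ-+ (gcd m n) (y * n) w ⟨
      ρ (gcd m n + y * n) w  ≡⟨ cong (λ k → ρ k w) eq ⟩
      ρ (x * m) w  ≡⟨ ρ-multiple x m w p ⟩
      w ∎
      where open ≡-Reasoning
    ... | Bézout.-+ x y eq = begin
      ρ (gcd m n) w  ≡⟨ cong (ρ (gcd m n)) (ρ-multiple x m w p) ⟨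
      ρ (gcd m n) (ρ (x * m) w)  ≡⟨ ρ-+ (gcd m n) (x * m) w ⟨
      ρ (gcd m n + x * m) w  ≡⟨ cong (λ k → ρ k w) eq ⟩
      ρ (y * n) w  ≡⟨ ρ-multiple y n w q ⟩
      w ∎
      where open ≡-Reasoning

    length-power : ∀ m u → length (power m u) ≡ m * length u
    length-power zero    u = refl
    length-power (suc m) u = trans (length-++ u) (cong (λ n → length u + n) (length-power m u))

    power-[] : ∀ m → power m [] ≡ []
    power-[] zero    = refl
    power-[] (suc m) = power-[] m

    power-comm : ∀ m u → power m u ++ u ≡ u ++ power m u
    power-comm zero    u = sym (++-identityʳ u)
    power-comm (suc m) u = trans (++-assoc u _ u) (cong (u ++_) (power-comm m u))

    power-+ : ∀ m n u → power (m + n) u ≡ power m u ++ power n u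
    power-+ zero    n u = refl
    power-+ (suc m) n u = trans (cong (u ++_) (power-+ m n u)) (sym (++-assoc u _ _))

    power-* : ∀ m n u → power m (power n u) ≡ power (m * n) u
    power-* zero    n u = refl
    power-* (suc m) n u = trans (cong (power n u ++_) (power-* m n u)) (sym (power-+ n (m * n) u))

    ρ-power : ∀ m u → ρ (length u) (power m u) ≡ power m u
    ρ-power zero    u = go (length u)
      where go : ∀ k → ρ k [] ≡ []
            go zero    = refl
            go (suc k) = cong rot₁ (go k)
    ρ-power (suc m) u = trans (ρ-++ u (power m u)) (power-comm m u)

    rot₁-power : ∀ m u → power m (rot₁ u) ≡ rot₁ (power m u)
    rot₁-power zero    u       = refl
    rot₁-power (suc m) []      = rot₁-power m []
    rot₁-power (suc m) (a ∷ r) = begin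
      (r ++ a ∷ []) ++ power m (r ++ a ∷ []) ≡⟨ ++-assoc r _ _ ⟩
      r ++ a ∷ power m (r ++ a ∷ [])  ≡⟨ cong (r ++_) (slide m) ⟩
      r ++ (power m (a ∷ r) ++ a ∷ [])  ≡⟨ ++-assoc r _ _ ⟨
      (r ++ power m (a ∷ r)) ++ a ∷ [] ∎
      where
      open ≡-Reasoning
      slide : ∀ m → a ∷ power m (r ++ a ∷ []) ≡ power m (a ∷ r) ++ a ∷ []
      slide zero    = refl
      slide (suc m) = cong (a ∷_) (begin
        (r ++ a ∷ []) ++ power m (r ++ a ∷ []) ≡⟨ ++-assoc r _ _ ⟩
        r ++ a ∷ power m (r ++ a ∷ [])  ≡⟨ cong (r ++_) (slide m) ⟩
        r ++ (power m (a ∷ r) ++ a ∷ [])  ≡⟨ ++-assoc r _ _ ⟨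
        (r ++ power m (a ∷ r)) ++ a ∷ [] ∎)

    take-++-≤ : ∀ n (u s : List A) → n ≤ length u → take n (u ++ s) ≡ take n u
    take-++-≤ zero    u       s _       = refl
    take-++-≤ (suc n) (a ∷ u) s (s≤s p) = cong (a ∷_) (take-++-≤ n u s p)

    take-length-++ : ∀ (u s : List A) → take (length u) (u ++ s) ≡ u
    take-length-++ []      s = refl
    take-length-++ (a ∷ u) s = cong (a ∷_) (take-length-++ u s)

    length-take-≤ : ∀ n (u : List A) → n ≤ length u → length (take n u) ≡ n
    length-take-≤ n u p = trans (length-take n u) (ℕ.m≤n⇒m⊓n≡m p)

    -- As s u = u s and u is not longer than s, the word s starts with u. Cancelling this prefix
    -- leaves a shorter word that still commutes with u.
    commuting⇒power : ∀ k (s u : List A) → length s ≡ k * length u → s ++ u ≡ u ++ s → s ≡ power k u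
    commuting⇒power zero    []      u eq c = refl
    commuting⇒power (suc k) s       u eq c = trans s≡ (cong (u ++_) (commuting⇒power k s′ u len′ c′))
      where
      s′ = drop (length u) s
      u≤s : length u ≤ length s
      u≤s = subst (length u ≤_) (sym eq) (ℕ.m≤m+n _ _)
      u≡ : take (length u) s ≡ u
      u≡ = trans (sym (take-++-≤ (length u) s u u≤s)) (trans (cong (take (length u)) c) (take-length-++ u s))
      s≡ : s ≡ u ++ s′
      s≡ = trans (sym (take++drop≡id (length u) s)) (cong (_++ s′) u≡)
      len′ : length s′ ≡ k * length u
      len′ = ℕ.+-cancelˡ-≡ (length u) _ _ (trans (sym (length-++ u)) (trans (cong length (sym s≡)) eq))
      c′ : s′ ++ u ≡ u ++ s′
      c′ = ++-cancelˡ u _ _ (trans (sym (++-assoc u s′ u)) (trans (cong (_++ u) (sym s≡)) (trans c (cong (u ++_) s≡))))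

    rot-ρ : ∀ i w → i ≤ length w → drop i w ++ take i w ≡ ρ i w
    rot-ρ i w p = begin
      drop i w ++ take i w  ≡⟨ ρ-++ (take i w) (drop i w) ⟨
      ρ (length (take i w)) (take i w ++ drop i w)  ≡⟨ cong₂ ρ (length-take-≤ i w p) (take++drop≡id i w) ⟩
      ρ i w ∎
      where open ≡-Reasoning

    -- Split v = p s with p of length e. The period says s p = p s, so s is a power of p.
    period⇒power : ∀ m e (v : List A) → length v ≡ m * e → 1 ≤ m → ρ e v ≡ v → v ≡ power m (take e v)
    period⇒power (suc m) e v eq _ p = trans (sym (take++drop≡id e v)) (cong (take e v ++_)
        (commuting⇒power m (drop e v) (take e v) len (trans (rot-ρ e v e≤) (trans p (sym (take++drop≡id e v))))))
      where
      e≤ : e ≤ length v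
      e≤ = subst (e ≤_) (sym eq) (ℕ.m≤m+n e _)
      lt = length-take-≤ e v e≤
      len : length (drop e v) ≡ m * length (take e v)
      len rewrite lt = trans (length-drop e v) (trans (cong (_∸ e) eq) (ℕ.m+n∸m≡n e _))

    power⇒period : ∀ m e (v : List A) → e ≤ length v → v ≡ power m (take e v) → ρ e v ≡ v
    power⇒period m e v e≤ p = begin
      ρ e v  ≡⟨ cong (ρ e) p ⟩
      ρ e (power m (take e v))  ≡⟨ cong (λ k → ρ k (power m (take e v))) (length-take-≤ e v e≤) ⟨
      ρ (length (take e v)) (power m (take e v))  ≡⟨ ρ-power m (take e v) ⟩
      power m (take e v)  ≡⟨ p ⟨
      v ∎
      where open ≡-Reasoning

    take-power : ∀ k m (u : List A) → k ≤ m → take (k * length u) (power m u) ≡ power k u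
    take-power k m u k≤m = begin
      take (k * length u) (power m u)  ≡⟨ cong₂ (λ a b → take a (power b u)) (sym (length-power k u)) (sym (ℕ.m+[n∸m]≡n k≤m)) ⟩
      take (length (power k u)) (power (k + (m ∸ k)) u)  ≡⟨ cong (take _) (power-+ k (m ∸ k) u) ⟩
      take (length (power k u)) (power k u ++ power (m ∸ k) u)  ≡⟨ take-length-++ (power k u) _ ⟩
      power k u ∎
      where open ≡-Reasoning

    take-take-≤ : ∀ m n (u : List A) → m ≤ n → take m (take n u) ≡ take m u
    take-take-≤ zero    n       u       _       = refl
    take-take-≤ (suc m) (suc n) []      _       = refl
    take-take-≤ (suc m) (suc n) (a ∷ u) (s≤s p) = cong (a ∷_) (take-take-≤ m n u p)

  eqL-sound : ∀ {a b} → eqL a b ≡ true → a ≡ b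
  eqL-sound {unb u m} {unb v n} p = cong₂ unb (≡ᵇ-sound (proj₁ (∧-true p))) (≡ᵇ-sound (proj₂ (∧-true {u ≡ᵇ v} p)))
  eqL-sound {bar u}   {bar v}   p = cong bar (≡ᵇ-sound p)

  eqL-refl : ∀ a → eqL a a ≡ true
  eqL-refl (unb u m) rewrite ≡ᵇ-refl u = ≡ᵇ-refl m
  eqL-refl (bar u) = ≡ᵇ-refl u

  eqW-sound : ∀ {v w} → eqW v w ≡ true → v ≡ w
  eqW-sound {[]}    {[]}    p = refl
  eqW-sound {a ∷ v} {b ∷ w} p = cong₂ _∷_ (eqL-sound (proj₁ (∧-true p))) (eqW-sound (proj₂ (∧-true {eqL a b} p)))

  eqW-refl : ∀ w → eqW w w ≡ true
  eqW-refl []      = refl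
  eqW-refl (a ∷ w) rewrite eqL-refl a = eqW-refl w

  Word : Set
  Word = List Letter

  properPower-sound : ∀ w → properPower w ≡ true →
    ∃₂ λ d e → 1 ≤ d × d < length w × w ≡ power e (take d w)
  properPower-sound w p
    rewrite map-applyUpTo suc (λ i → i) (length w ∸ 1)
    with anyB-sound _ (length w ∸ 1) suc p
  ... | d , d< , q with anyB-sound _ (suc (length w)) (λ i → i) q
  ...   | e , _ , r = suc d , e , s≤s z≤n , lemma (length w) d<  , eqW-sound r
    where lemma : ∀ n → d < n ∸ 1 → suc d < n
          lemma (suc n) d<n = s≤s d<n

  properPower-complete : ∀ w d e → 1 ≤ d → d < length w → w ≡ power e (take d w) → properPower w ≡ true
  properPower-complete w (suc d) e _ d<w p
    rewrite map-applyUpTo suc (λ i → i) (length w ∸ 1) =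
    anyB-complete _ (length w ∸ 1) suc d (ℕ.∸-monoˡ-≤ 1 d<w)
      (anyB-complete _ (suc (length w)) (λ i → i) e (s≤s e≤)
        (subst (λ x → eqW w x ≡ true) p (eqW-refl w)))
    where
    -- `properPower` tries exponents up to the length of w only; since the base is nonempty, nothing
    -- is lost.
    e≤ : e ≤ length w
    e≤ = subst (e ≤_) (sym (trans (cong length p)
           (trans (length-power e (take (suc d) w)) (cong (e *_) (length-take-≤ (suc d) w (ℕ.<⇒≤ d<w))))))
           (ℕ.m≤m*n e (suc d))

  Primitive : Word → Set
  Primitive w = properPower w ≡ false

  m*n>0⇒m>0 : ∀ {m n k} → k ≡ m * n → 1 ≤ k → 1 ≤ m
  m*n>0⇒m>0 {zero}  eq p = subst (1 ≤_) eq p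
  m*n>0⇒m>0 {suc m} eq p = s≤s z≤n

  m*n>0⇒n>0 : ∀ {m n k} → k ≡ m * n → 1 ≤ k → 1 ≤ n
  m*n>0⇒n>0 {m} {n} eq p = m*n>0⇒m>0 {n} {m} (trans eq (ℕ.*-comm m n)) p

  -- A shorter g would exhibit w as a proper power of its prefix of length g.
  primitive-period : ∀ w g → Primitive w → g ∣ length w → 1 ≤ length w → ρ g w ≡ w → length w ≤ g
  primitive-period w g prim g∣w w>0 p with g ℕ.<? length w
  ... | no g≮w = ℕ.≮⇒≥ g≮w
  ... | yes g<w with g∣w
  ...   | divides q eq with trans (sym prim)
            (properPower-complete w g q (m*n>0⇒n>0 {q} eq w>0) g<w
              (period⇒power q g w eq (m*n>0⇒m>0 eq w>0) p))
  ...     | ()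

  properPower-period : ∀ w → properPower w ≡ true → ∃[ g ] (g ∣ length w × g < length w × ρ g w ≡ w)
  properPower-period w p with properPower-sound w p
  ... | d , e , d>0 , d<w , eq = d
    , divides e (trans (cong length eq) (trans (length-power e (take d w)) (cong (e *_) (length-take-≤ d w (ℕ.<⇒≤ d<w)))))
    , d<w , power⇒period e d w (ℕ.<⇒≤ d<w) eq

  ρ-undo : ∀ {A : Set} (w : List A) → ρ (length w ∸ 1) (rot₁ w) ≡ w
  ρ-undo []      = refl
  ρ-undo (a ∷ r) = trans (sym (ρ-suc (length r) (a ∷ r))) (ρ-length (a ∷ r))

  -- Being a proper power is having a short period that divides the length, and such periods pass
  -- between w and its rotation because rotations commute. `ρ-undo` supplies the way back.
  properPower-rot₁ : ∀ w → properPower (rot₁ w) ≡ properPower w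
  properPower-rot₁ w with properPower w in eq | properPower (rot₁ w) in eq′
  ... | true  | true  = refl
  ... | false | false = refl
  ... | true  | false with properPower-period w eq
  ...   | g , g∣w , g<w , p = ⊥-elim (ℕ.<⇒≱ g<w (subst (_≤ g) (length-rot₁ w)
            (primitive-period (rot₁ w) g eq′ (subst (g ∣_) (sym (length-rot₁ w)) g∣w)
              (subst (1 ≤_) (sym (length-rot₁ w)) (ℕ.≤-trans (s≤s z≤n) g<w))
              (trans (ρ-comm g 1 w) (cong rot₁ p)))))
  properPower-rot₁ w | false | true with properPower-period (rot₁ w) eq′
  ...   | g , g∣w , g<w , p = ⊥-elim (ℕ.<⇒≱ g<w (subst (_≤ g) (sym (length-rot₁ w))
            (primitive-period w g eq (subst (g ∣_) (length-rot₁ w) g∣w)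
              (subst (1 ≤_) (length-rot₁ w) (ℕ.≤-trans (s≤s z≤n) g<w))
              (begin
                ρ g w  ≡⟨ cong (ρ g) (ρ-undo w) ⟨
                ρ g (ρ (length w ∸ 1) (rot₁ w))  ≡⟨ ρ-comm g (length w ∸ 1) (rot₁ w) ⟩
                ρ (length w ∸ 1) (ρ g (rot₁ w))  ≡⟨ cong (ρ (length w ∸ 1)) p ⟩
                ρ (length w ∸ 1) (rot₁ w)  ≡⟨ ρ-undo w ⟩
                w ∎))))
    where open ≡-Reasoning

  -- The root is a prefix and is recorded by its length e, so that its uniqueness is an equation
  -- between numbers; m is the exponent.
  IsRoot : Word → ℕ → ℕ → Set
  IsRoot v e m = m * e ≡ length v × v ≡ power m (take e v) × Primitive (take e v)

  -- Descent: while the prefix is itself a proper power, it is replaced by its shorter base. The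
  -- fuel bounds the length of the prefix.
  root-exists : ∀ v → 1 ≤ length v → ∃₂ λ e m → IsRoot v e m
  root-exists v v>0 = go (length v) (length v) 1 ℕ.≤-refl (ℕ.*-identityˡ _)
      (trans (sym (trans (cong (λ n → take n v) refl) take-all)) (sym (++-identityʳ _)))
    where
    take-all : take (length v) v ≡ v
    take-all = trans (cong (take (length v)) (sym (++-identityʳ v))) (take-length-++ v [])
    go : ∀ fuel e m → e ≤ fuel → m * e ≡ length v → v ≡ power m (take e v) → ∃₂ λ e m → IsRoot v e m
    go fuel e m e≤ eq p with properPower (take e v) in prim
    ... | false = e , m , eq , p , prim
    ... | true with properPower-sound (take e v) prim | e≤ | m*n>0⇒m>0 {m} {e} (sym eq) v>0
    ...   | d , k , d>0 , d<u , q | e≤fuel | m>0 = recurse fuel e≤fuel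
      where
      e≤v : e ≤ length v
      e≤v = subst (e ≤_) eq (ℕ.m≤n*m e m {{ℕ.>-nonZero m>0}})
      |u| : length (take e v) ≡ e
      |u| = length-take-≤ e v e≤v
      d<e : d < e
      d<e = subst (d <_) |u| d<u
      u≡ : take e v ≡ power k (take d v)
      u≡ = trans q (cong (power k) (take-take-≤ d e v (ℕ.<⇒≤ d<e)))
      e≡ : k * d ≡ e
      e≡ = trans (sym (trans (cong length u≡) (trans (length-power k (take d v))
             (cong (k *_) (length-take-≤ d v (ℕ.≤-trans (ℕ.<⇒≤ d<e) e≤v)))))) |u|
      recurse : ∀ fuel → e ≤ fuel → ∃₂ λ e m → IsRoot v e m
      recurse zero    e≤ = ⊥-elim (ℕ.n≮0 (ℕ.<-≤-trans d<e e≤))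
      recurse (suc f) e≤ = go f d (m * k) (ℕ.≤-pred (ℕ.≤-trans d<e e≤))
        (trans (ℕ.*-assoc m k d) (trans (cong (m *_) e≡) eq))
        (trans p (trans (cong (power m) u≡) (power-* m k (take d v))))

  -- Both lengths are periods of v, hence so is their gcd g. As g divides e₁, it is also a period of
  -- the first root, whose primitivity forces e₁ ≤ g ≤ e₂.
  root-≤ : ∀ v e₁ m₁ e₂ m₂ → 1 ≤ length v → IsRoot v e₁ m₁ → IsRoot v e₂ m₂ → e₁ ≤ e₂
  root-≤ v e₁ m₁ e₂ m₂ v>0 (eq₁ , p₁ , prim₁) (eq₂ , p₂ , prim₂) = ℕ.≤-trans e₁≤g g≤e₂
    where
    e≤v : ∀ e m → m * e ≡ length v → e ≤ length v
    e≤v e m eq = subst (e ≤_) eq (ℕ.m≤n*m e m {{ℕ.>-nonZero (m*n>0⇒m>0 {m} {e} (sym eq) v>0)}})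
    g = gcd e₁ e₂
    ρg : ρ g v ≡ v
    ρg = ρ-gcd e₁ e₂ v (power⇒period m₁ e₁ v (e≤v e₁ m₁ eq₁) p₁) (power⇒period m₂ e₂ v (e≤v e₂ m₂ eq₂) p₂)
    u = take e₁ v
    |u| : length u ≡ e₁
    |u| = length-take-≤ e₁ v (e≤v e₁ m₁ eq₁)
    e₁>0 : 1 ≤ e₁
    e₁>0 = m*n>0⇒n>0 {m₁} (sym eq₁) v>0
    e₂>0 : 1 ≤ e₂
    e₂>0 = m*n>0⇒n>0 {m₂} (sym eq₂) v>0
    g≤e₂ : g ≤ e₂
    g≤e₂ = ∣⇒≤ {{ℕ.>-nonZero e₂>0}} (gcd[m,n]∣n e₁ e₂)
    e₁≤g : e₁ ≤ g
    e₁≤g with gcd[m,n]∣m e₁ e₂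
    ... | divides k e₁≡ = subst (_≤ g) |u| (primitive-period u g prim₁ (divides k (trans |u| e₁≡))
            (subst (1 ≤_) (sym |u|) e₁>0) ρgu)
      where
      k>0 = m*n>0⇒m>0 {k} e₁≡ e₁>0
      v≡ : v ≡ power (m₁ * k) (take g v)
      v≡ = period⇒power (m₁ * k) g v
             (trans (sym eq₁) (trans (cong (m₁ *_) e₁≡) (sym (ℕ.*-assoc m₁ k g))))
             (ℕ.*-mono-≤ (m*n>0⇒m>0 {m₁} (sym eq₁) v>0) k>0) ρg
      |g| : length (take g v) ≡ g
      |g| = length-take-≤ g v (ℕ.≤-trans (subst (g ≤_) (sym e₁≡) (ℕ.m≤n*m g k {{ℕ.>-nonZero k>0}})) (e≤v e₁ m₁ eq₁))
      u≡ : u ≡ power k (take g v)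
      u≡ = trans (cong₂ take (trans e₁≡ (cong (k *_) (sym |g|))) v≡)
             (take-power k (m₁ * k) (take g v) (ℕ.m≤n*m k m₁ {{ℕ.>-nonZero (m*n>0⇒m>0 {m₁} (sym eq₁) v>0)}}))
      ρgu : ρ g u ≡ u
      ρgu = begin
        ρ g u  ≡⟨ cong (ρ g) u≡ ⟩
        ρ g (power k (take g v))  ≡⟨ cong (λ n → ρ n (power k (take g v))) |g| ⟨
        ρ (length (take g v)) (power k (take g v))  ≡⟨ ρ-power k (take g v) ⟩
        power k (take g v)  ≡⟨ u≡ ⟨
        u ∎
        where open ≡-Reasoning

  root-unique : ∀ v e₁ m₁ e₂ m₂ → 1 ≤ length v → IsRoot v e₁ m₁ → IsRoot v e₂ m₂ → e₁ ≡ e₂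
  root-unique v e₁ m₁ e₂ m₂ v>0 r₁ r₂ = ℕ.≤-antisym (root-≤ v e₁ m₁ e₂ m₂ v>0 r₁ r₂) (root-≤ v e₂ m₂ e₁ m₁ v>0 r₂ r₁)

  -- The lexicographic order, least rotations and admissible circular words

  leqW-refl : ∀ l w → leqW l w w ≡ true
  leqW-refl l []      = refl
  leqW-refl l (a ∷ w) rewrite ≡ᵇ-refl (key l a) | leqW-refl l w = ∨-zeroʳ _

  leqW-cons : ∀ l a b {v w} → leqW l (a ∷ v) (b ∷ w) ≡ true →
              key l a < key l b ⊎ (key l a ≡ key l b × leqW l v w ≡ true)
  leqW-cons l a b p with key l a <ᵇ key l b in eq
  ... | true  = inj₁ (<ᵇ-sound eq)
  ... | false = inj₂ (≡ᵇ-sound (proj₁ (∧-true p)) , proj₂ (∧-true {key l a ≡ᵇ key l b} p))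

  leqW-< : ∀ l a b v w → key l a < key l b → leqW l (a ∷ v) (b ∷ w) ≡ true
  leqW-< l a b v w p rewrite <ᵇ-complete p = refl

  leqW-≡ : ∀ l a b v w → key l a ≡ key l b → leqW l v w ≡ true → leqW l (a ∷ v) (b ∷ w) ≡ true
  leqW-≡ l a b v w p q rewrite p | ≡ᵇ-refl (key l b) | q = ∨-zeroʳ _

  leqW-total : ∀ l v w → leqW l v w ≡ true ⊎ leqW l w v ≡ true
  leqW-total l []      w       = inj₁ refl
  leqW-total l (a ∷ v) []      = inj₂ refl
  leqW-total l (a ∷ v) (b ∷ w) with ℕ.<-cmp (key l a) (key l b)
  ... | tri< p _ _ = inj₁ (leqW-< l a b v w p)
  ... | tri> _ _ p = inj₂ (leqW-< l b a w v p)
  ... | tri≈ _ p _ with leqW-total l v w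
  ...   | inj₁ q = inj₁ (leqW-≡ l a b v w p q)
  ...   | inj₂ q = inj₂ (leqW-≡ l b a w v (sym p) q)

  leqW-trans : ∀ l u v w → leqW l u v ≡ true → leqW l v w ≡ true → leqW l u w ≡ true
  leqW-trans l []      v       w       p q = refl
  leqW-trans l (a ∷ u) (b ∷ v) (c ∷ w) p q with leqW-cons l a b {u} {v} p | leqW-cons l b c {v} {w} q
  ... | inj₁ x       | inj₁ y       = leqW-< l a c u w (ℕ.<-trans x y)
  ... | inj₁ x       | inj₂ (y , _) = leqW-< l a c u w (subst (key l a <_) y x)
  ... | inj₂ (x , _) | inj₁ y       = leqW-< l a c u w (subst (_< key l c) (sym x) y)
  ... | inj₂ (x , s) | inj₂ (y , t) = leqW-≡ l a c u w (trans x y) (leqW-trans l u v w s t)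

  -- `key l` is injective only on colours below l: it takes the same value at `unb u l` and `bar u`.
  -- Antisymmetry of `leqW` depends on this.
  ValidLetter : ℕ → Letter → Set
  ValidLetter l (unb u m) = m < l
  ValidLetter l (bar u)   = ⊤

  block-injective : ∀ l u v m n → m < suc l → n < suc l → u * suc l + m ≡ v * suc l + n → u ≡ v × m ≡ n
  block-injective l zero    zero    m n p q eq = refl , eq
  block-injective l zero    (suc v) m n p q eq =
    ⊥-elim (ℕ.<⇒≱ p (subst (suc l ≤_) (sym eq) (ℕ.≤-trans (ℕ.m≤m+n (suc l) (v * suc l)) (ℕ.m≤m+n _ n))))
  block-injective l (suc u) zero    m n p q eq =
    ⊥-elim (ℕ.<⇒≱ q (subst (suc l ≤_) eq (ℕ.≤-trans (ℕ.m≤m+n (suc l) (u * suc l)) (ℕ.m≤m+n _ m))))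
  block-injective l (suc u) (suc v) m n p q eq
    with block-injective l u v m n p q (ℕ.+-cancelˡ-≡ (suc l) _ _
           (trans (sym (ℕ.+-assoc (suc l) (u * suc l) m)) (trans eq (ℕ.+-assoc (suc l) (v * suc l) n))))
  ... | refl , m≡n = refl , m≡n

  key-injective : ∀ l {a b} → ValidLetter l a → ValidLetter l b → key l a ≡ key l b → a ≡ b
  key-injective l {unb u m} {unb v n} p q eq
    with block-injective l u v m n (ℕ.m<n⇒m<1+n p) (ℕ.m<n⇒m<1+n q) eq
  ... | refl , refl = refl
  key-injective l {unb u m} {bar v} p q eq
    with block-injective l u v m l (ℕ.m<n⇒m<1+n p) ℕ.≤-refl eq
  ... | _ , refl = ⊥-elim (ℕ.<-irrefl refl p)
  key-injective l {bar u} {unb v n} p q eq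
    with block-injective l u v l n ℕ.≤-refl (ℕ.m<n⇒m<1+n q) eq
  ... | _ , refl = ⊥-elim (ℕ.<-irrefl refl q)
  key-injective l {bar u} {bar v} p q eq
    with block-injective l u v l l ℕ.≤-refl ℕ.≤-refl eq
  ... | refl , _ = refl

  leqW-antisym : ∀ l {v w} → All (ValidLetter l) v → All (ValidLetter l) w →
                 leqW l v w ≡ true → leqW l w v ≡ true → v ≡ w
  leqW-antisym l {[]}    {[]}    _ _ p q = refl
  leqW-antisym l {a ∷ v} {b ∷ w} (x ∷ xs) (y ∷ ys) p q with leqW-cons l a b {v} {w} p | leqW-cons l b a {w} {v} q
  ... | inj₁ s       | inj₁ t       = ⊥-elim (ℕ.<-asym s t)
  ... | inj₁ s       | inj₂ (t , _) = ⊥-elim (ℕ.<-irrefl (sym t) s)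
  ... | inj₂ (s , _) | inj₁ t       = ⊥-elim (ℕ.<-irrefl (sym s) t)
  ... | inj₂ (s , p′) | inj₂ (_ , q′) = cong₂ _∷_ (key-injective l x y s) (leqW-antisym l xs ys p′ q′)

  least-exists : ∀ l (f : ℕ → Word) n → ∃[ i ] (i < suc n × (∀ j → j < suc n → leqW l (f i) (f j) ≡ true))
  least-exists l f zero = 0 , s≤s z≤n , λ { zero _ → leqW-refl l (f 0) ; (suc j) (s≤s ()) }
  least-exists l f (suc n) with least-exists l (f ∘ suc) n
  ... | i , i<n , p with leqW-total l (f 0) (f (suc i))
  ...   | inj₁ q = 0 , s≤s z≤n , λ { zero _ → leqW-refl l (f 0)
                                    ; (suc j) (s≤s j<n) → leqW-trans l (f 0) (f (suc i)) (f (suc j)) q (p j j<n) }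
  ...   | inj₂ q = suc i , s≤s i<n , λ { zero _ → q ; (suc j) (s≤s j<n) → p j j<n }

  All-rot₁ : ∀ {A : Set} {P : A → Set} {w} → All P w → All P (rot₁ w)
  All-rot₁ []       = []
  All-rot₁ (p ∷ ps) = All.++⁺ ps (p ∷ [])

  All-ρ : ∀ {A : Set} {P : A → Set} i {w} → All P w → All P (ρ i w)
  All-ρ zero    p = p
  All-ρ (suc i) p = All-rot₁ (All-ρ i p)

  canonical-sound : ∀ l w → canonical l w ≡ true → ∀ i → i < length w → leqW l w (ρ i w) ≡ true
  canonical-sound l w p i i<w = subst (λ x → leqW l w x ≡ true) (rot-ρ i w (ℕ.<⇒≤ i<w))
    (allB-sound _ (length w) (λ i → i) p i i<w)

  canonical-complete : ∀ l w → (∀ i → i < length w → leqW l w (ρ i w) ≡ true) → canonical l w ≡ true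
  canonical-complete l w p = allB-complete _ (length w) (λ i → i)
    λ i i<w → subst (λ x → leqW l w x ≡ true) (sym (rot-ρ i w (ℕ.<⇒≤ i<w))) (p i i<w)

  canonical-rotation-exists : ∀ l w → 1 ≤ length w → ∃[ i ] (i < length w × canonical l (ρ i w) ≡ true)
  canonical-rotation-exists l w w>0 with length w in eq
  ... | suc n with least-exists l (λ i → ρ i w) n
  ...   | i , i<n , least = i , i<n , canonical-complete l (ρ i w) smaller
    where
    smaller : ∀ k → k < length (ρ i w) → leqW l (ρ i w) (ρ k (ρ i w)) ≡ true
    -- Rotating the rotated word by k rotates w by k + i, which modulo the length is one of the
    -- rotations already compared.
    smaller k k<w with (k + i) ℕ.<? suc n
    ... | yes k+i<n = subst (λ x → leqW l (ρ i w) x ≡ true) (ρ-+ k i w) (least (k + i) k+i<n)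
    ... | no k+i≮n = subst (λ x → leqW l (ρ i w) x ≡ true) wrap (least (k + i ∸ suc n) bound)
      where
      n≤ = ℕ.≮⇒≥ k+i≮n
      k<n : k < suc n
      k<n = subst (k <_) (trans (length-ρ i w) eq) k<w
      bound : k + i ∸ suc n < suc n
      bound = ℕ.+-cancelʳ-< (suc n) (k + i ∸ suc n) (suc n)
                (subst (_< suc n + suc n) (sym (ℕ.m∸n+n≡m n≤)) (ℕ.+-mono-< k<n i<n))
      wrap : ρ (k + i ∸ suc n) w ≡ ρ k (ρ i w)
      wrap = begin
        ρ (k + i ∸ suc n) w  ≡⟨ cong (ρ (k + i ∸ suc n)) (trans (cong (λ x → ρ x w) (sym eq)) (ρ-length w)) ⟨
        ρ (k + i ∸ suc n) (ρ (suc n) w)  ≡⟨ ρ-+ (k + i ∸ suc n) (suc n) w ⟨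
        ρ (k + i ∸ suc n + suc n) w  ≡⟨ cong (λ x → ρ x w) (ℕ.m∸n+n≡m n≤) ⟩
        ρ (k + i) w  ≡⟨ ρ-+ k i w ⟩
        ρ k (ρ i w) ∎
        where open ≡-Reasoning

  -- Two canonical rotations lie below each other and are therefore equal. Then j - i is a period of
  -- w, and so is its gcd with the length, which is too short for a primitive word.
  canonical-rotation-≮ : ∀ l w i j → All (ValidLetter l) w → Primitive w → j < length w →
    canonical l (ρ i w) ≡ true → canonical l (ρ j w) ≡ true → ¬ i < j
  canonical-rotation-≮ l w i j valid prim j<n ci cj i<j = ℕ.<⇒≱ j∸i<n (ℕ.≤-trans n≤g g≤)
    where
    n = length w
    wraps : ρ n w ≡ w
    wraps = ρ-length w
    i<n = ℕ.<-trans i<j j<n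
    j∸i<n : j ∸ i < n
    j∸i<n = ℕ.≤-<-trans (ℕ.m∸n≤m j i) j<n
    j∸i>0 = ℕ.m<n⇒0<n∸m i<j
    forth : ρ (j ∸ i) (ρ i w) ≡ ρ j w
    forth = trans (sym (ρ-+ (j ∸ i) i w)) (cong (λ x → ρ x w) (ℕ.m∸n+n≡m (ℕ.<⇒≤ i<j)))
    back : ρ (n ∸ (j ∸ i)) (ρ j w) ≡ ρ i w
    back = begin
      ρ (n ∸ (j ∸ i)) (ρ j w)  ≡⟨ cong (ρ (n ∸ (j ∸ i))) forth ⟨
      ρ (n ∸ (j ∸ i)) (ρ (j ∸ i) (ρ i w))  ≡⟨ ρ-+ (n ∸ (j ∸ i)) (j ∸ i) (ρ i w) ⟨
      ρ (n ∸ (j ∸ i) + (j ∸ i)) (ρ i w)  ≡⟨ cong (λ x → ρ x (ρ i w)) (ℕ.m∸n+n≡m (ℕ.<⇒≤ j∸i<n)) ⟩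
      ρ n (ρ i w)  ≡⟨ ρ-comm n i w ⟩
      ρ i (ρ n w)  ≡⟨ cong (ρ i) wraps ⟩
      ρ i w ∎
      where open ≡-Reasoning
    same : ρ i w ≡ ρ j w
    same = leqW-antisym l (All-ρ i valid) (All-ρ j valid)
      (subst (λ x → leqW l (ρ i w) x ≡ true) forth
        (canonical-sound l (ρ i w) ci (j ∸ i) (subst (j ∸ i <_) (sym (length-ρ i w)) j∸i<n)))
      (subst (λ x → leqW l (ρ j w) x ≡ true) back
        (canonical-sound l (ρ j w) cj (n ∸ (j ∸ i)) (subst (n ∸ (j ∸ i) <_) (sym (length-ρ j w))
          (ℕ.∸-monoʳ-< j∸i>0 (ℕ.<⇒≤ j∸i<n)))))
    period : ρ (j ∸ i) w ≡ w
    period = begin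
      ρ (j ∸ i) w  ≡⟨ cong (ρ (j ∸ i)) unwind ⟨
      ρ (j ∸ i) (ρ (n ∸ i) (ρ i w))  ≡⟨ ρ-comm (j ∸ i) (n ∸ i) (ρ i w) ⟩
      ρ (n ∸ i) (ρ (j ∸ i) (ρ i w))  ≡⟨ cong (ρ (n ∸ i)) (trans forth (sym same)) ⟩
      ρ (n ∸ i) (ρ i w)  ≡⟨ unwind ⟩
      w ∎
      where
      open ≡-Reasoning
      unwind : ρ (n ∸ i) (ρ i w) ≡ w
      unwind = trans (sym (ρ-+ (n ∸ i) i w)) (trans (cong (λ x → ρ x w) (ℕ.m∸n+n≡m (ℕ.<⇒≤ i<n))) wraps)
    g = gcd (j ∸ i) n
    g≤ : g ≤ j ∸ i
    g≤ = ∣⇒≤ {{ℕ.>-nonZero j∸i>0}} (gcd[m,n]∣m (j ∸ i) n)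
    n≤g : n ≤ g
    n≤g = primitive-period w g prim (gcd[m,n]∣n (j ∸ i) n) (ℕ.≤-trans (s≤s z≤n) j<n) (ρ-gcd (j ∸ i) n w period wraps)

  canonical-rotation-unique : ∀ l w i j → All (ValidLetter l) w → Primitive w → i < length w → j < length w →
    canonical l (ρ i w) ≡ true → canonical l (ρ j w) ≡ true → i ≡ j
  canonical-rotation-unique l w i j valid prim i< j< ci cj with ℕ.<-cmp i j
  ... | tri< p _ _ = ⊥-elim (canonical-rotation-≮ l w i j valid prim j< ci cj p)
  ... | tri≈ _ p _ = p
  ... | tri> _ _ p = ⊥-elim (canonical-rotation-≮ l w j i valid prim i< cj ci p)

  -- Admissibility of a linear word. A circular word is tested by repeating its first letter at the
  -- end, which lets words be cut and glued at a shared letter.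
  chain : Word → Bool
  chain []          = true
  chain (a ∷ [])    = true
  chain (a ∷ b ∷ r) = okPair (a , b) ∧ chain (b ∷ r)

  cyclic : Word → Bool
  cyclic w = allB okPair (zip w (rot 1 w))

  cyclic-chain : ∀ a r → cyclic (a ∷ r) ≡ chain (a ∷ r ++ a ∷ [])
  cyclic-chain a r = go a r a
    where
    go : ∀ a r c → allB okPair (zip (a ∷ r) (r ++ c ∷ [])) ≡ chain (a ∷ r ++ c ∷ [])
    go a []      c = refl
    go a (b ∷ r) c = cong (okPair (a , b) ∧_) (go b r c)

  chain-++ : ∀ x c y → chain (x ++ c ∷ y) ≡ chain (x ++ c ∷ []) ∧ chain (c ∷ y)
  chain-++ []          c y = refl
  chain-++ (a ∷ [])    c y = cong (_∧ chain (c ∷ y)) (sym (∧-identityʳ _))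
  chain-++ (a ∷ b ∷ x) c y = trans (cong (okPair (a , b) ∧_) (chain-++ (b ∷ x) c y)) (sym (∧-assoc (okPair (a , b)) _ _))

  cyclic-rot₁ : ∀ w → cyclic (rot₁ w) ≡ cyclic w
  cyclic-rot₁ []          = refl
  cyclic-rot₁ (a ∷ [])    = refl
  cyclic-rot₁ (a ∷ b ∷ r) = begin
    cyclic (b ∷ (r ++ a ∷ []))  ≡⟨ cyclic-chain b (r ++ a ∷ []) ⟩
    chain (b ∷ (r ++ a ∷ []) ++ b ∷ [])  ≡⟨ cong chain (++-assoc (b ∷ r) (a ∷ []) (b ∷ [])) ⟩
    chain ((b ∷ r) ++ a ∷ b ∷ [])  ≡⟨ chain-++ (b ∷ r) a (b ∷ []) ⟩
    chain (b ∷ r ++ a ∷ []) ∧ chain (a ∷ b ∷ [])  ≡⟨ ∧-comm (chain (b ∷ r ++ a ∷ [])) _ ⟩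
    chain (a ∷ b ∷ []) ∧ chain (b ∷ r ++ a ∷ [])  ≡⟨ chain-++ (a ∷ []) b (r ++ a ∷ []) ⟨
    chain (a ∷ b ∷ r ++ a ∷ [])  ≡⟨ cyclic-chain a (b ∷ r) ⟨
    cyclic (a ∷ b ∷ r) ∎
    where open ≡-Reasoning

  -- Cutting at the first letter of every copy of w splits the closed chain of the power into equal
  -- closed chains of w, and conjunction is idempotent.
  cyclic-power : ∀ m w → cyclic (power (suc m) w) ≡ cyclic w
  cyclic-power m [] = cong cyclic (power-[] m)
  cyclic-power m (a ∷ r) = begin
    cyclic (power (suc m) (a ∷ r))  ≡⟨ cyclic-chain a (r ++ power m (a ∷ r)) ⟩
    chain (power (suc m) (a ∷ r) ++ a ∷ [])  ≡⟨ go m ⟩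
    chain (a ∷ r ++ a ∷ [])  ≡⟨ cyclic-chain a r ⟨
    cyclic (a ∷ r) ∎
    where
    open ≡-Reasoning
    split : ∀ m → chain (power (suc m) (a ∷ r) ++ a ∷ []) ≡ chain (a ∷ r ++ a ∷ []) ∧ chain (power m (a ∷ r) ++ a ∷ [])
    split zero = trans (cong (λ x → chain (x ++ a ∷ [])) (++-identityʳ (a ∷ r))) (sym (∧-identityʳ _))
    split (suc m) = trans (cong chain (++-assoc (a ∷ r) (power (suc m) (a ∷ r)) (a ∷ [])))
                      (chain-++ (a ∷ r) a ((r ++ power m (a ∷ r)) ++ a ∷ []))
    go : ∀ m → chain (power (suc m) (a ∷ r) ++ a ∷ []) ≡ chain (a ∷ r ++ a ∷ [])
    go zero    = trans (split zero) (∧-identityʳ _)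
    go (suc m) = trans (split (suc m)) (trans (cong (chain (a ∷ r ++ a ∷ []) ∧_) (go m)) (∧-idem _))

open Words

-- Sums over words

eqW-++ : ∀ u s t → eqW (u ++ s) (u ++ t) ≡ eqW s t
eqW-++ []      s t = ≡.refl
eqW-++ (a ∷ u) s t rewrite eqL-refl a = eqW-++ u s t

rootB : Word → ℕ → ℕ → Bool
rootB v e m = (m ℕ.* e ≡ᵇ length v) ∧ eqW v (power m (take e v)) ∧ not (properPower (take e v))

not-true : ∀ {b} → not b ≡ true → b ≡ false
not-true {false} _ = ≡.refl

rootB-sound : ∀ v e m → rootB v e m ≡ true → IsRoot v e m
rootB-sound v e m p with ∧-true {m ℕ.* e ≡ᵇ length v} p
... | q , r with ∧-true {eqW v (power m (take e v))} r
...   | s , t = ≡ᵇ-sound q , eqW-sound s , not-true t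

rootB-complete : ∀ v e m → IsRoot v e m → rootB v e m ≡ true
rootB-complete v e m (p , q , r) rewrite p | ≡ᵇ-refl (length v) | r
  | ≡.subst (λ x → eqW v x ≡ true) q (eqW-refl v) = ≡.refl

module WordSums (S : Ring₀) (A : List Letter) where
  open CommutativeRing S hiding (zero)
  open FiniteSums S
  open import Algebra.Properties.Semiring.Mult semiring using (×-congʳ) renaming (_×_ to _·_)
  open import Algebra.Properties.Semiring.Exp semiring using (_^_)
  open import Relation.Binary.Reasoning.Setoid setoid

  ∑-cong-∈ : ∀ {B : Set} (xs : List B) {f g : B → Carrier} → (∀ x → x ∈ xs → f x ≈ g x) → ∑ xs f ≈ ∑ xs g
  ∑-cong-∈ []       p = refl
  ∑-cong-∈ (x ∷ xs) p = +-cong (p x (here ≡.refl)) (∑-cong-∈ xs (λ y → p y ∘ there))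

  ∑-words-suc : ∀ n f → ∑ (words A (suc n)) f ≈ ∑ A (λ a → ∑ (words A n) (λ w → f (a ∷ w)))
  ∑-words-suc n f = trans (∑-concatMap _ A f) (∑-cong A (λ a → ∑-map (a ∷_) (words A n) f))

  ∑-words-cong : ∀ n {f g : Word → Carrier} →
    (∀ w → length w ≡ n → All (_∈ A) w → f w ≈ g w) → ∑ (words A n) f ≈ ∑ (words A n) g
  ∑-words-cong zero    p = +-congʳ (p [] ≡.refl [])
  ∑-words-cong (suc n) p = trans (∑-words-suc n _) (trans
    (∑-cong-∈ A (λ a a∈A → ∑-words-cong n (λ w len all → p (a ∷ w) (≡.cong suc len) (a∈A ∷ all))))
    (sym (∑-words-suc n _)))

  ∑-words-++ : ∀ m n f → ∑ (words A (m ℕ.+ n)) f ≈ ∑ (words A m) (λ u → ∑ (words A n) (λ s → f (u ++ s)))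
  ∑-words-++ zero    n f = sym (+-identityʳ _)
  ∑-words-++ (suc m) n f = begin
    ∑ (words A (suc m ℕ.+ n)) f  ≈⟨ ∑-words-suc (m ℕ.+ n) f ⟩
    ∑ A (λ a → ∑ (words A (m ℕ.+ n)) (λ w → f (a ∷ w)))  ≈⟨ ∑-cong A (λ a → ∑-words-++ m n _) ⟩
    ∑ A (λ a → ∑ (words A m) (λ u → ∑ (words A n) (λ s → f (a ∷ u ++ s))))  ≈⟨ ∑-words-suc m _ ⟨
    ∑ (words A (suc m)) (λ u → ∑ (words A n) (λ s → f (u ++ s)))                   ∎

  ∑-words-snoc : ∀ n f → ∑ (words A (suc n)) f ≈ ∑ A (λ a → ∑ (words A n) (λ w → f (w ++ a ∷ [])))
  ∑-words-snoc n f = begin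
    ∑ (words A (suc n)) f  ≡⟨ ≡.cong (λ k → ∑ (words A k) f) (ℕ.+-comm 1 n) ⟩
    ∑ (words A (n ℕ.+ 1)) f  ≈⟨ ∑-words-++ n 1 f ⟩
    ∑ (words A n) (λ w → ∑ (words A 1) (λ s → f (w ++ s)))  ≈⟨ ∑-cong (words A n) (λ w → ∑-words-suc 0 _) ⟩
    ∑ (words A n) (λ w → ∑ A (λ a → f (w ++ a ∷ []) + 0#))  ≈⟨ ∑-swap (words A n) A _ ⟩
    ∑ A (λ a → ∑ (words A n) (λ w → f (w ++ a ∷ []) + 0#))  ≈⟨ ∑-cong A (λ a → ∑-cong (words A n) (λ w → +-identityʳ _)) ⟩
    ∑ A (λ a → ∑ (words A n) (λ w → f (w ++ a ∷ [])))            ∎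

  -- Words can be enumerated by their first or by their last letter, and the rotation exchanges the
  -- two enumerations.
  ∑-words-rot₁ : ∀ n f → ∑ (words A n) (f ∘ rot₁) ≈ ∑ (words A n) f
  ∑-words-rot₁ zero    f = refl
  ∑-words-rot₁ (suc n) f = trans (∑-words-suc n _) (sym (∑-words-snoc n f))

  ∑-words-ρ : ∀ i n f → ∑ (words A n) (f ∘ ρ i) ≈ ∑ (words A n) f
  ∑-words-ρ zero    n f = refl
  ∑-words-ρ (suc i) n f = trans (∑-words-ρ i n (f ∘ rot₁)) (∑-words-rot₁ n f)

  module _ (∑-δ : ∀ a → a ∈ A → ∀ (f : Letter → Carrier) → ∑ A (λ b → eqL b a ▸ f b) ≈ f a) where

    ∑-words-δ : ∀ n s → length s ≡ n → All (_∈ A) s → ∀ (f : Word → Carrier) → ∑ (words A n) (λ w → eqW w s ▸ f w) ≈ f s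
    ∑-words-δ zero    []      _   _           f = +-identityʳ _
    ∑-words-δ (suc n) (a ∷ s) len (a∈A ∷ all) f = begin
      ∑ (words A (suc n)) (λ w → eqW w (a ∷ s) ▸ f w)  ≈⟨ ∑-words-suc n _ ⟩
      ∑ A (λ b → ∑ (words A n) (λ w → (eqL b a ∧ eqW w s) ▸ f (b ∷ w)))  ≈⟨ ∑-cong A (λ b → ∑-cong (words A n) (λ w → ▸-∧ (eqL b a) _ _)) ⟩
      ∑ A (λ b → ∑ (words A n) (λ w → eqL b a ▸ eqW w s ▸ f (b ∷ w)))  ≈⟨ ∑-cong A (λ b → ∑-▸ (words A n) (eqL b a) _) ⟨
      ∑ A (λ b → eqL b a ▸ ∑ (words A n) (λ w → eqW w s ▸ f (b ∷ w)))  ≈⟨ ∑-δ a a∈A _ ⟩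
      ∑ (words A n) (λ w → eqW w s ▸ f (a ∷ w))  ≈⟨ ∑-words-δ n s (ℕ.suc-injective len) all _ ⟩
      f (a ∷ s) ∎

    All-power : ∀ m {u : Word} → All (_∈ A) u → All (_∈ A) (power m u)
    All-power zero    p = []
    All-power (suc m) p = All.++⁺ p (All-power m p)

    -- Split v = u s with u of length e. The root condition then forces s to be the remaining power
    -- of u, so the sum over s collapses to one term.
    ∑-powers : ∀ e m d (f : Word → Carrier) → 1 ≤ d →
      (m ℕ.* e ≡ᵇ d) ▸ ∑ (words A e) (λ u → not (properPower u) ▸ f (power m u))
        ≈ ∑ (words A d) (λ v → rootB v e m ▸ f v)
    ∑-powers e m d f d>0 with m ℕ.* e ≡ᵇ d in eq
    ... | false = sym (trans (∑-words-cong d (λ v len _ → reflexive (≡.cong (λ b → (b ∧ eqW v (power m (take e v)) ∧ not (properPower (take e v))) ▸ f v)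
                    (≡.trans (≡.cong (m ℕ.* e ≡ᵇ_) len) eq)))) (∑-0 (words A d)))
    ... | true with m | ≡ᵇ-sound {m ℕ.* e} {d} eq
    ...   | zero  | ≡.refl = ⊥-elim (ℕ.n≮0 d>0)
    ...   | suc k | ≡.refl = sym (begin
      ∑ (words A (e ℕ.+ k ℕ.* e)) (λ v → rootB v e (suc k) ▸ f v)  ≈⟨ ∑-words-++ e (k ℕ.* e) _ ⟩
      ∑ (words A e) (λ u → ∑ (words A (k ℕ.* e)) (λ s → rootB (u ++ s) e (suc k) ▸ f (u ++ s)))
        ≈⟨ ∑-words-cong e (λ u len all → begin
             ∑ (words A (k ℕ.* e)) (λ s → rootB (u ++ s) e (suc k) ▸ f (u ++ s))
               ≈⟨ ∑-words-cong (k ℕ.* e) (λ s len′ _ → trans (reflexive (≡.cong (_▸ f (u ++ s)) (rootB-++ u s len len′)))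
                    (trans (▸-∧ (eqW s (power k u)) _ _) (▸-swap (eqW s (power k u)) (not (properPower u)) _))) ⟩
             ∑ (words A (k ℕ.* e)) (λ s → not (properPower u) ▸ eqW s (power k u) ▸ f (u ++ s))
               ≈⟨ ∑-▸ (words A (k ℕ.* e)) (not (properPower u)) _ ⟨
             not (properPower u) ▸ ∑ (words A (k ℕ.* e)) (λ s → eqW s (power k u) ▸ f (u ++ s))
               ≈⟨ ▸-cong (not (properPower u)) (∑-words-δ (k ℕ.* e) (power k u)
                    (≡.trans (length-power k u) (≡.cong (k ℕ.*_) len)) (All-power k all) _) ⟩
             not (properPower u) ▸ f (power (suc k) u) ∎) ⟩
      ∑ (words A e) (λ u → not (properPower u) ▸ f (power (suc k) u))                  ∎)
      where
      rootB-++ : ∀ u s → length u ≡ e → length s ≡ k ℕ.* e →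
                 rootB (u ++ s) e (suc k) ≡ eqW s (power k u) ∧ not (properPower u)
      rootB-++ u s ≡.refl len
        rewrite length-++ u {s} | len | ≡ᵇ-refl (length u ℕ.+ k ℕ.* length u)
              | take-length-++ u s | eqW-++ u s (power k u) = ≡.refl

    -- Existence of the root provides one term of the double sum, uniqueness kills the others. The
    -- length is shifted by one to exclude empty roots.
    ∑-roots : ∀ v (c : Carrier) → 1 ≤ length v →
      ∑< (length v) (λ e → ∑< (suc (length v)) (λ m → rootB v (suc e) m ▸ c)) ≈ c
    ∑-roots v c v>0 with root-exists v v>0
    ... | zero  , m , (p , _) = ⊥-elim (ℕ.n≮0 (≡.subst (1 ≤_) (≡.trans (≡.sym p) (ℕ.*-zeroʳ m)) v>0))
    ... | suc e , m , r@(p , _) = begin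
      ∑< n (λ e → ∑< (suc n) (λ m → rootB v (suc e) m ▸ c))
        ≈⟨ ∑<-single n e e<n (λ e′ e′≢e → ∑<-zero (suc n) (λ m′ _ → off λ q →
             e′≢e (ℕ.suc-injective (root-unique v (suc e′) m′ (suc e) m v>0 (rootB-sound v (suc e′) m′ q) r)))) ⟩
      ∑< (suc n) (λ m → rootB v (suc e) m ▸ c)
        ≈⟨ ∑<-single (suc n) m (s≤s m≤n) (λ m′ m′≢m → off λ q → m′≢m (ℕ.*-cancelʳ-≡ m′ m (suc e)
             (≡.trans (proj₁ (rootB-sound v (suc e) m′ q)) (≡.sym p)))) ⟩
      rootB v (suc e) m ▸ c
        ≡⟨ ≡.cong (_▸ c) (rootB-complete v (suc e) m r) ⟩
      c ∎
      where
      n = length v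
      m≤n : m ≤ n
      m≤n = ≡.subst (m ≤_) p (ℕ.m≤m*n m (suc e))
      e<n : e < n
      e<n = ≡.subst (suc e ≤_) p (ℕ.m≤n*m (suc e) m {{ℕ.>-nonZero (m*n>0⇒m>0 {m} {suc e} (≡.sym p) v>0)}})
      off : ∀ {b} → (b ≡ true → ⊥) → b ▸ c ≈ 0#
      off b≢true = reflexive (≡.cong (_▸ c) (¬-not b≢true))

    -- Every word is uniquely a power of a primitive word.
    ∑-words-by-root : ∀ d (f : Word → Carrier) → 1 ≤ d → ∑ (words A d) f ≈
      ∑< d (λ e → ∑< (suc d) (λ m → (m ℕ.* suc e ≡ᵇ d) ▸
        ∑ (words A (suc e)) (λ u → not (properPower u) ▸ f (power m u))))
    ∑-words-by-root d f d>0 = sym (begin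
      ∑< d (λ e → ∑< (suc d) (λ m → (m ℕ.* suc e ≡ᵇ d) ▸ ∑ (words A (suc e)) (λ u → not (properPower u) ▸ f (power m u))))
        ≈⟨ ∑<-cong d (λ e _ → ∑<-cong (suc d) (λ m _ → ∑-powers (suc e) m d f d>0)) ⟩
      ∑< d (λ e → ∑< (suc d) (λ m → ∑ (words A d) (λ v → rootB v (suc e) m ▸ f v)))
        ≈⟨ ∑<-cong d (λ e _ → ∑-∑<-swap (words A d) (suc d) (λ v m → rootB v (suc e) m ▸ f v)) ⟨
      ∑< d (λ e → ∑ (words A d) (λ v → ∑< (suc d) (λ m → rootB v (suc e) m ▸ f v)))
        ≈⟨ ∑-∑<-swap (words A d) d _ ⟨
      ∑ (words A d) (λ v → ∑< d (λ e → ∑< (suc d) (λ m → rootB v (suc e) m ▸ f v)))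
        ≈⟨ ∑-words-cong d (λ { v ≡.refl _ → ∑-roots v (f v) d>0 }) ⟩
      ∑ (words A d) f ∎)

  module _ (l : ℕ) (valid : ∀ a → a ∈ A → ValidLetter l a) where

    -- A primitive word of length n has exactly one canonical rotation among its n rotations.
    ∑-primitive-by-necklace : ∀ n (g : Word → Carrier) → 1 ≤ n → (∀ u → g (rot₁ u) ≈ g u) →
      ∑ (words A n) (λ u → not (properPower u) ▸ g u)
        ≈ n · ∑ (words A n) (λ u → not (properPower u) ▸ canonical l u ▸ g u)
    ∑-primitive-by-necklace n g n>0 g-rot₁ = begin
      ∑ (words A n) (λ u → not (properPower u) ▸ g u)
        ≈⟨ ∑-words-cong n (λ { u ≡.refl all → ▸-congᵇ (λ p → sym (unique u all n>0 (not-true p))) }) ⟩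
      ∑ (words A n) (λ u → not (properPower u) ▸ ∑< n (λ i → canonical l (ρ i u) ▸ g u))
        ≈⟨ ∑-cong (words A n) (λ u → trans (∑<-▸ n (not (properPower u)) _) (∑<-cong n (λ i _ →
             trans (reflexive (≡.cong (λ b → not b ▸ canonical l (ρ i u) ▸ g u) (≡.sym (pp-ρ i u))))
               (▸-cong (not (properPower (ρ i u))) (▸-cong (canonical l (ρ i u)) (sym (g-ρ i u))))))) ⟩
      ∑ (words A n) (λ u → ∑< n (λ i → h (ρ i u)))
        ≈⟨ ∑-∑<-swap (words A n) n _ ⟩
      ∑< n (λ i → ∑ (words A n) (h ∘ ρ i))
        ≈⟨ ∑<-cong n (λ i _ → ∑-words-ρ i n h) ⟩
      ∑< n (λ i → ∑ (words A n) h)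
        ≈⟨ ∑<-const n ⟩
      n · ∑ (words A n) h ∎
      where
      h : Word → Carrier
      h u = not (properPower u) ▸ canonical l u ▸ g u
      pp-ρ : ∀ i u → properPower (ρ i u) ≡ properPower u
      pp-ρ zero    u = ≡.refl
      pp-ρ (suc i) u = ≡.trans (properPower-rot₁ (ρ i u)) (pp-ρ i u)
      g-ρ : ∀ i u → g (ρ i u) ≈ g u
      g-ρ zero    u = refl
      g-ρ (suc i) u = trans (g-rot₁ (ρ i u)) (g-ρ i u)
      ∑<-const : ∀ n {c} → ∑< n (λ _ → c) ≈ n · c
      ∑<-const zero    = ∑<-empty _
      ∑<-const (suc n) = trans (∑<-suc n _) (+-congˡ (∑<-const n))
      unique : ∀ u → All (_∈ A) u → 1 ≤ length u → Primitive u →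
               ∑< (length u) (λ i → canonical l (ρ i u) ▸ g u) ≈ g u
      unique u all u>0 p with canonical-rotation-exists l u u>0
      ... | i , i<n , ci = trans
        (∑<-single′ (length u) i i<n (λ j j<n j≢i → reflexive (≡.cong (_▸ g u) (¬-not λ cj →
          j≢i (canonical-rotation-unique l u j i (All.map (valid _) all) p j<n i<n cj ci)))))
        (reflexive (≡.cong (_▸ g u) ci))

    module _ (∑-δ : ∀ a → a ∈ A → ∀ (f : Letter → Carrier) → ∑ A (λ b → eqL b a ▸ f b) ≈ f a)
             (wtL : Letter → Carrier) where

      wt : Word → Carrier
      wt []      = 1#
      wt (a ∷ w) = wtL a * wt w

      wt-++ : ∀ u v → wt (u ++ v) ≈ wt u * wt v
      wt-++ []      v = sym (*-identityˡ _)
      wt-++ (a ∷ u) v = trans (*-congˡ (wt-++ u v)) (sym (*-assoc _ _ _))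

      wt-rot₁ : ∀ u → wt (rot₁ u) ≈ wt u
      wt-rot₁ []      = refl
      wt-rot₁ (a ∷ r) = trans (wt-++ r (a ∷ [])) (trans (*-comm _ _) (*-congʳ (*-identityʳ _)))

      wt-power : ∀ m u → wt (power m u) ≈ wt u ^ m
      wt-power zero    u = refl
      wt-power (suc m) u = trans (wt-++ u (power m u)) (*-congˡ (wt-power m u))

      -- Admissibility of a power is that of its root, and weights of powers are powers of weights.
      -- Grouping words by root and roots by necklace therefore leaves a power sum over necklaces,
      -- in which the factor `suc e` counts rotations.
      ∑-cyclic-by-necklace : ∀ d → 1 ≤ d → ∑ (words A d) (λ v → cyclic v ▸ wt v) ≈
        ∑< d (λ e → ∑< (suc d) (λ m → (m ℕ.* suc e ≡ᵇ d) ▸ suc e · ∑ (words A (suc e))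
          (λ u → not (properPower u) ▸ canonical l u ▸ cyclic u ▸ wt u ^ m)))
      ∑-cyclic-by-necklace d d>0 = trans (∑-words-by-root ∑-δ d _ d>0)
        (∑<-cong d (λ e _ → ∑<-cong (suc d) (λ m _ → ▸-congᵇ {m ℕ.* suc e ≡ᵇ d} (λ eq → step e m (≡ᵇ-sound eq)))))
        where
        step : ∀ e m → m ℕ.* suc e ≡ d →
          ∑ (words A (suc e)) (λ u → not (properPower u) ▸ cyclic (power m u) ▸ wt (power m u)) ≈
          suc e · ∑ (words A (suc e)) (λ u → not (properPower u) ▸ canonical l u ▸ cyclic u ▸ wt u ^ m)
        step e zero    ≡.refl = ⊥-elim (ℕ.n≮0 d>0)
        step e (suc m) _ = trans
          (∑-primitive-by-necklace (suc e) (λ u → cyclic (power (suc m) u) ▸ wt (power (suc m) u)) (s≤s z≤n)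
            (λ u → trans (reflexive (≡.cong (λ x → cyclic x ▸ wt x) (rot₁-power (suc m) u)))
               (trans (reflexive (≡.cong (_▸ wt (rot₁ (power (suc m) u))) (cyclic-rot₁ (power (suc m) u))))
                 (▸-cong (cyclic (power (suc m) u)) (wt-rot₁ (power (suc m) u))))))
          (×-congʳ (suc e) (∑-cong (words A (suc e)) (λ u → ▸-cong (not (properPower u)) (▸-cong (canonical l u)
            (trans (reflexive (≡.cong (_▸ wt (power (suc m) u)) (cyclic-power m u)))
              (▸-cong (cyclic u) (wt-power (suc m) u)))))))

-- Logarithmic derivatives and multisets

module SeriesTools (S : Ring₀) where
  open CommutativeRing S hiding (zero)
  open FiniteSums S
  open PowerSeries S
  open import Algebra.Properties.Semiring.Mult semiring
    using (×-congʳ; ×-comm-*; ×-assoc-*) renaming (_×_ to _·_)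
  open import Algebra.Properties.Semiring.Exp semiring using (_^_)
  open import Algebra.Properties.CommutativeMonoid.Mult +-commutativeMonoid using (×-distrib-+)
  open import Algebra.Properties.CommutativeSemigroup +-commutativeSemigroup using (x∙yz≈y∙xz)
  open import Relation.Binary.Reasoning.Setoid setoid

  module Z = CommutativeRing ⟨_⟦z⟧⟩

  ·-0 : ∀ n → n · 0# ≈ 0#
  ·-0 zero    = refl
  ·-0 (suc n) = trans (+-identityˡ _) (·-0 n)

  ▸-· : ∀ b n x → n · (b ▸ x) ≈ b ▸ n · x
  ▸-· true  n x = refl
  ▸-· false n x = ·-0 n

  ∑<-· : ∀ k n f → n · ∑< k f ≈ ∑< k (λ i → n · f i)
  ∑<-· zero    n f = trans (×-congʳ n (∑<-empty _)) (trans (·-0 n) (sym (∑<-empty _)))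
  ∑<-· (suc k) n f = trans (×-congʳ n (∑<-suc k f))
    (trans (×-distrib-+ _ _ n) (trans (+-congˡ (∑<-· k n _)) (sym (∑<-suc k _))))

  ∑<-extend : ∀ m n {f} → m ≤ n → (∀ i → m ≤ i → f i ≈ 0#) → ∑< n f ≈ ∑< m f
  ∑<-extend zero    n       _         p = trans (∑<-zero n (λ i _ → p i z≤n)) (sym (∑<-empty _))
  ∑<-extend (suc m) (suc n) (s≤s m≤n) p = trans (∑<-suc n _)
    (trans (+-congˡ (∑<-extend m n m≤n (λ i → p (suc i) ∘ s≤s))) (sym (∑<-suc m _)))

  ⋆-sum : ∀ f g n → (f ⋆ g) n ≈ ∑< (suc n) (λ i → f i * g (n ∸ i))
  ⋆-sum f g zero    = sym (trans (∑<-suc 0 _) (trans (+-congˡ (∑<-empty _)) (+-identityʳ _)))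
  ⋆-sum f g (suc n) = trans (+-congˡ (⋆-sum (f ∘ suc) g n)) (sym (∑<-suc (suc n) _))

  ⋆-cong-≤ : ∀ n {f f′ g g′} → (∀ i → i ≤ n → f i ≈ f′ i) → (∀ i → i ≤ n → g i ≈ g′ i) → (f ⋆ g) n ≈ (f′ ⋆ g′) n
  ⋆-cong-≤ zero    p q = *-cong (p 0 z≤n) (q 0 z≤n)
  ⋆-cong-≤ (suc n) p q = +-cong (*-cong (p 0 z≤n) (q (suc n) ℕ.≤-refl))
    (⋆-cong-≤ n (λ i i≤n → p (suc i) (s≤s i≤n)) (λ i i≤n → q i (ℕ.m≤n⇒m≤1+n i≤n)))

  -- The Euler operator z d/dz, a derivation that preserves degrees.
  θ : Series → Series
  θ f n = n · f n

  θ-cong : ∀ {f g} → f ≋ g → θ f ≋ θ g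
  θ-cong p = coeffs λ n → ×-congʳ n (at p n)

  θ-+ : ∀ f g → θ (f ⊕ g) ≋ θ f ⊕ θ g
  θ-+ f g = coeffs λ n → ×-distrib-+ _ _ n

  θ-const : ∀ c → θ (const c) ≋ Z.0#
  θ-const c = coeffs λ { zero → refl ; (suc n) → ·-0 (suc n) }

  θ-⋆ : ∀ f g → θ (f ⋆ g) ≋ (θ f ⋆ g) ⊕ (f ⋆ θ g)
  θ-⋆ f g = coeffs (leibniz f g)
    where
    leibniz : ∀ f g n → n · (f ⋆ g) n ≈ (θ f ⋆ g) n + (f ⋆ θ g) n
    leibniz f g zero    = sym (trans (+-cong (zeroˡ _) (zeroʳ _)) (+-identityʳ 0#))
    leibniz f g (suc n) = begin
      suc n · (f 0 * g (suc n) + (f′ ⋆ g) n)  ≈⟨ ×-distrib-+ _ _ (suc n) ⟩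
      suc n · (f 0 * g (suc n)) + ((f′ ⋆ g) n + n · (f′ ⋆ g) n)  ≈⟨ +-cong (×-comm-* (suc n) _ _) (+-congˡ (sym (leibniz f′ g n))) ⟨
      f 0 * θ g (suc n) + ((f′ ⋆ g) n + ((θ f′ ⋆ g) n + (f′ ⋆ θ g) n))  ≈⟨ +-congˡ (sym (+-assoc _ _ _)) ⟩
      f 0 * θ g (suc n) + (((f′ ⋆ g) n + (θ f′ ⋆ g) n) + (f′ ⋆ θ g) n)  ≈⟨ x∙yz≈y∙xz _ _ _ ⟩
      ((f′ ⋆ g) n + (θ f′ ⋆ g) n) + (f ⋆ θ g) (suc n)  ≈⟨ +-congʳ (⋆-distribʳ g f′ (θ f′) n) ⟨
      ((θ f ∘ suc) ⋆ g) n + (f ⋆ θ g) (suc n)  ≈⟨ +-congʳ (trans (+-congʳ (zeroˡ _)) (+-identityˡ _)) ⟨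
      (θ f ⋆ g) (suc n) + (f ⋆ θ g) (suc n) ∎
      where f′ = f ∘ suc

  -- θ f / f = a without division.
  LogDer : Series → Series → Set
  LogDer a f = θ f ≋ a ⋆ f

  open IntegerSolver ⟨_⟦z⟧⟩ using (solve; _:=_; _:+_; _:*_; :-_; _:-_; con)

  logDer-⋆ : ∀ {a b f g} → LogDer a f → LogDer b g → LogDer (a ⊕ b) (f ⋆ g)
  logDer-⋆ {a} {b} {f} {g} p q = Z.trans (θ-⋆ f g) (Z.trans (Z.+-cong (Z.*-congʳ p) (Z.*-congˡ q))
    (solve 4 (λ a b f g → (a :* f) :* g :+ f :* (b :* g) := (a :+ b) :* (f :* g)) Z.refl a b f g))

  logDer-inverse : ∀ {a f g} → LogDer a f → f ⋆ g ≋ Z.1# → LogDer (⊝ a) g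
  logDer-inverse {a} {f} {g} p inv = begin′
    where
    θ0 : (θ f ⋆ g) ⊕ (f ⋆ θ g) ≋ Z.0#
    θ0 = Z.trans (Z.sym (θ-⋆ f g)) (Z.trans (θ-cong inv) (θ-const 1#))
    open import Relation.Binary.Reasoning.Setoid Z.setoid as ZR
    begin′ : θ g ≋ (⊝ a) ⋆ g
    begin′ = ZR.begin
      θ g  ZR.≈⟨ Z.*-identityˡ _ ⟨
      Z.1# ⋆ θ g  ZR.≈⟨ Z.*-congʳ inv ⟨
      (f ⋆ g) ⋆ θ g  ZR.≈⟨ solve 4 (λ a f g g′ → (f :* g) :* g′ :=
           g :* (((a :* f) :* g :+ f :* g′) :- (a :* (f :* g)))) Z.refl a f g (θ g) ⟩
      g ⋆ (((a ⋆ f) ⋆ g ⊕ f ⋆ θ g) ⊕ ⊝ (a ⋆ (f ⋆ g)))  ZR.≈⟨ Z.*-congˡ (Z.+-congʳ (Z.+-congʳ (Z.*-congʳ p))) ⟨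
      g ⋆ ((θ f ⋆ g ⊕ f ⋆ θ g) ⊕ ⊝ (a ⋆ (f ⋆ g)))  ZR.≈⟨ Z.*-congˡ (Z.+-cong θ0 (Z.-‿cong (Z.*-congˡ inv))) ⟩
      g ⋆ (Z.0# ⊕ ⊝ (a ⋆ Z.1#))  ZR.≈⟨ solve 2 (λ a g → g :* (con (+ 0) :- a :* con (+ 1)) := (:- a) :* g) Z.refl a g ⟩
      (⊝ a) ⋆ g ZR.∎

  -- Since θ (1 - f) = - θ f = - (θ f ⋆ g) ⋆ (1 - f), the logarithmic derivative of 1 - f is - θ f ⋆
  -- g, and its inverse g has the opposite one.
  logDer-1- : ∀ {f g} → (Z.1# ⊕ ⊝ f) ⋆ g ≋ Z.1# → LogDer (θ f ⋆ g) g
  logDer-1- {f} {g} inv = Z.trans (logDer-inverse {⊝ (θ f ⋆ g)} below inv)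
      (Z.*-congʳ (solve 1 (λ a → :- :- a := a) Z.refl (θ f ⋆ g)))
    where
    open import Relation.Binary.Reasoning.Setoid Z.setoid as ZR
    below : LogDer (⊝ (θ f ⋆ g)) (Z.1# ⊕ ⊝ f)
    below = ZR.begin
      θ (Z.1# ⊕ ⊝ f)  ZR.≈⟨ solve 2 (λ a b → a := (a :+ b) :- b) Z.refl (θ (Z.1# ⊕ ⊝ f)) (θ f) ⟩
      (θ (Z.1# ⊕ ⊝ f) ⊕ θ f) ⊕ ⊝ θ f  ZR.≈⟨ Z.+-congʳ (θ-+ _ _) ⟨
      θ ((Z.1# ⊕ ⊝ f) ⊕ f) ⊕ ⊝ θ f  ZR.≈⟨ Z.+-congʳ (θ-cong (solve 1 (λ f → (con (+ 1) :- f) :+ f := con (+ 1)) Z.refl f)) ⟩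
      θ Z.1# ⊕ ⊝ θ f  ZR.≈⟨ Z.+-cong (θ-const 1#) (Z.-‿cong (Z.trans (Z.sym (Z.*-identityʳ _)) (Z.*-congˡ (Z.sym inv)))) ⟩
      Z.0# ⊕ ⊝ (θ f ⋆ ((Z.1# ⊕ ⊝ f) ⋆ g)) ZR.≈⟨ solve 3 (λ a b g → con (+ 0) :- a :* (b :* g) := (:- (a :* g)) :* b) Z.refl (θ f) (Z.1# ⊕ ⊝ f) g ⟩
      (⊝ (θ f ⋆ g)) ⋆ (Z.1# ⊕ ⊝ f) ZR.∎

  TorsionFree : Set
  TorsionFree = ∀ n x y → suc n · x ≈ suc n · y → x ≈ y

  Cancellable : Carrier → Set
  Cancellable c = ∀ a b → c * a ≈ c * b → a ≈ b

  -- In degree n + 1 the equation expresses (n + 1) f_{n+1} through lower coefficients of f, because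
  -- a₀ = 0; torsion-freeness removes the factor n + 1. Agreement is asked only up to degree n,
  -- since the list of necklaces is truncated there.
  logDer-unique : TorsionFree → ∀ n {a a′ f f′} → LogDer a f → LogDer a′ f′ →
    a 0 ≈ 0# → (∀ i → i ≤ n → a i ≈ a′ i) → f 0 ≈ f′ 0 → ∀ i → i ≤ n → f i ≈ f′ i
  logDer-unique tf zero    p q a0 a≈ f0 zero z≤n = f0
  logDer-unique tf (suc n) {a} {a′} {f} {f′} p q a0 a≈ f0 i i≤1+n with i ℕ.≤? n
  ... | yes i≤n = logDer-unique tf n p q a0 (λ j j≤n → a≈ j (ℕ.m≤n⇒m≤1+n j≤n)) f0 i i≤n
  ... | no i≰n with ℕ.≤-antisym i≤1+n (ℕ.≰⇒> i≰n)
  ...   | ≡.refl = tf n _ _ (begin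
    suc n · f (suc n)  ≈⟨ at p (suc n) ⟩
    a 0 * f (suc n) + ((a ∘ suc) ⋆ f) n  ≈⟨ +-cong (vanish a0 _) (⋆-cong-≤ n (λ j j≤n → a≈ (suc j) (s≤s j≤n))
                                                        (logDer-unique tf n p q a0 (λ j j≤n → a≈ j (ℕ.m≤n⇒m≤1+n j≤n)) f0)) ⟩
    0# + ((a′ ∘ suc) ⋆ f′) n  ≈⟨ +-congʳ (vanish (trans (sym (a≈ 0 z≤n)) a0) _) ⟨
    a′ 0 * f′ (suc n) + ((a′ ∘ suc) ⋆ f′) n  ≈⟨ at q (suc n) ⟨
    suc n · f′ (suc n) ∎)
    where
    vanish : ∀ {x} → x ≈ 0# → ∀ y → x * y ≈ 0#
    vanish x≈0 y = trans (*-congʳ x≈0) (zeroˡ y)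

  monomial : Carrier → ℕ → Series
  monomial q e d = (d ≡ᵇ e) ▸ q

  -- For e ≥ 1 this is 1 / (1 - q z^e), the factor of the generating function that belongs to one
  -- necklace of length e and weight q.
  geometric : Carrier → ℕ → Series
  geometric q e d = ∑< (suc d) (λ m → (m ℕ.* e ≡ᵇ d) ▸ q ^ m)

  monomial-⋆ : ∀ q e g n → (monomial q e ⋆ g) n ≈ (e ≤ᵇ n) ▸ q * g (n ∸ e)
  monomial-⋆ q e g n = trans (⋆-sum _ g n) body
    where
    off : ∀ i → i ≢ e → monomial q e i * g (n ∸ i) ≈ 0#
    off i i≢e = trans (*-congʳ (reflexive (≡.cong (_▸ q) (≡ᵇ-false i≢e)))) (zeroˡ _)
    body : ∑< (suc n) (λ i → monomial q e i * g (n ∸ i)) ≈ (e ≤ᵇ n) ▸ q * g (n ∸ e)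
    body with e ℕ.≤? n
    ... | yes e≤n = trans (∑<-single (suc n) e (s≤s e≤n) off) (trans
          (*-congʳ (reflexive (≡.cong (_▸ q) (≡ᵇ-refl e))))
          (reflexive (≡.cong (_▸ q * g (n ∸ e)) (≡.sym (≤ᵇ-true e≤n)))))
    ... | no e≰n = trans (∑<-zero (suc n) (λ { i (s≤s i≤n) → off i λ { ≡.refl → e≰n i≤n } }))
          (reflexive (≡.cong (_▸ q * g (n ∸ e)) (≡.sym (≤ᵇ-false e≰n))))

  geometric-⋆ : ∀ q e g n → 1 ≤ e →
    (geometric q e ⋆ g) n ≈ ∑< (suc n) (λ m → (m ℕ.* e ≤ᵇ n) ▸ q ^ m * g (n ∸ m ℕ.* e))
  geometric-⋆ q e g n e>0 = begin
    (geometric q e ⋆ g) n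
      ≈⟨ ⋆-sum _ g n ⟩
    ∑< (suc n) (λ i → geometric q e i * g (n ∸ i))
      ≈⟨ ∑<-cong (suc n) (λ i i<n → *-congʳ (sym (∑<-extend (suc i) (suc n) i<n (λ m i<m →
           reflexive (≡.cong (_▸ q ^ m) (≡ᵇ-false (ℕ.>⇒≢ (ℕ.≤-trans i<m (ℕ.m≤m*n m e {{ℕ.>-nonZero e>0}}))))))))) ⟩
    ∑< (suc n) (λ i → ∑< (suc n) (λ m → (m ℕ.* e ≡ᵇ i) ▸ q ^ m) * g (n ∸ i))
      ≈⟨ ∑<-cong (suc n) (λ i _ → trans (∑<-*ʳ (suc n) _ _) (∑<-cong (suc n) (λ m _ →
           *-congʳ (reflexive (≡.cong (_▸ q ^ m) (≡ᵇ-sym (m ℕ.* e) i)))))) ⟩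
    ∑< (suc n) (λ i → ∑< (suc n) (λ m → monomial (q ^ m) (m ℕ.* e) i * g (n ∸ i)))
      ≈⟨ ∑<-swap (suc n) (suc n) _ ⟩
    ∑< (suc n) (λ m → ∑< (suc n) (λ i → monomial (q ^ m) (m ℕ.* e) i * g (n ∸ i)))
      ≈⟨ ∑<-cong (suc n) (λ m _ → trans (sym (⋆-sum (monomial (q ^ m) (m ℕ.* e)) g n)) (monomial-⋆ (q ^ m) (m ℕ.* e) g n)) ⟩
    ∑< (suc n) (λ m → (m ℕ.* e ≤ᵇ n) ▸ q ^ m * g (n ∸ m ℕ.* e)) ∎
    where
    ≡ᵇ-sym : ∀ m n → (m ≡ᵇ n) ≡ (n ≡ᵇ m)
    ≡ᵇ-sym zero    zero    = ≡.refl
    ≡ᵇ-sym zero    (suc n) = ≡.refl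
    ≡ᵇ-sym (suc m) zero    = ≡.refl
    ≡ᵇ-sym (suc m) (suc n) = ≡ᵇ-sym m n

  geometric-unfold : ∀ q e → 1 ≤ e → geometric q e ≋ Z.1# ⊕ (monomial q e ⋆ geometric q e)
  geometric-unfold q e e>0 = coeffs λ d → begin
    geometric q e d  ≈⟨ ∑<-suc d _ ⟩
    ((0 ≡ᵇ d) ▸ 1#) + ∑< d (λ m → (suc m ℕ.* e ≡ᵇ d) ▸ q ^ suc m)  ≈⟨ +-cong (unit d) (shifted d) ⟩
    const 1# d + ((e ≤ᵇ d) ▸ q * geometric q e (d ∸ e))  ≈⟨ +-congˡ (monomial-⋆ q e (geometric q e) d) ⟨
    const 1# d + (monomial q e ⋆ geometric q e) d ∎
    where
    unit : ∀ d → (0 ≡ᵇ d) ▸ 1# ≈ const 1# d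
    unit zero    = refl
    unit (suc d) = refl
    shifted : ∀ d → ∑< d (λ m → (suc m ℕ.* e ≡ᵇ d) ▸ q ^ suc m) ≈ (e ≤ᵇ d) ▸ q * geometric q e (d ∸ e)
    shifted d with e ℕ.≤? d
    ... | no e≰d = trans (∑<-zero d (λ m _ → reflexive (≡.cong (_▸ q ^ suc m)
            (≡ᵇ-false {suc m ℕ.* e} {d} λ { ≡.refl → e≰d (ℕ.m≤m+n e (m ℕ.* e)) }))))
          (reflexive (≡.cong (_▸ q * geometric q e (d ∸ e)) (≡.sym (≤ᵇ-false e≰d))))
    ... | yes e≤d = trans (begin
        ∑< d (λ m → (suc m ℕ.* e ≡ᵇ d) ▸ q ^ suc m)
          ≡⟨ ≡.cong (λ k → ∑< d (λ m → (suc m ℕ.* e ≡ᵇ k) ▸ q ^ suc m)) (≡.sym (ℕ.m+[n∸m]≡n e≤d)) ⟩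
        ∑< d (λ m → (e ℕ.+ m ℕ.* e ≡ᵇ e ℕ.+ (d ∸ e)) ▸ q ^ suc m)
          ≈⟨ ∑<-cong d (λ m _ → reflexive (≡.cong (_▸ q ^ suc m) (cancel e (m ℕ.* e) (d ∸ e)))) ⟩
        ∑< d (λ m → (m ℕ.* e ≡ᵇ d ∸ e) ▸ q * q ^ m)
          ≈⟨ ∑<-extend (suc (d ∸ e)) d (d∸e< d e≤d) (λ m d∸e<m → reflexive (≡.cong (_▸ q * q ^ m)
               (≡ᵇ-false (ℕ.>⇒≢ (ℕ.≤-trans d∸e<m (ℕ.m≤m*n m e {{ℕ.>-nonZero e>0}})))))) ⟩
        ∑< (suc (d ∸ e)) (λ m → (m ℕ.* e ≡ᵇ d ∸ e) ▸ q * q ^ m)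
          ≈⟨ ∑<-cong (suc (d ∸ e)) (λ m _ → ▸-*ˡ (m ℕ.* e ≡ᵇ d ∸ e) q (q ^ m)) ⟨
        ∑< (suc (d ∸ e)) (λ m → q * ((m ℕ.* e ≡ᵇ d ∸ e) ▸ q ^ m))
          ≈⟨ ∑<-*ˡ (suc (d ∸ e)) q _ ⟨
        q * geometric q e (d ∸ e) ∎)
      (reflexive (≡.cong (_▸ q * geometric q e (d ∸ e)) (≡.sym (≤ᵇ-true e≤d))))
      where
      cancel : ∀ e m n → (e ℕ.+ m ≡ᵇ e ℕ.+ n) ≡ (m ≡ᵇ n)
      cancel zero    m n = ≡.refl
      cancel (suc e) m n = cancel e m n
      d∸e< : ∀ d → e ≤ d → suc (d ∸ e) ≤ d
      d∸e< d e≤d = ℕ.≤-trans (ℕ.+-monoˡ-≤ (d ∸ e) e>0) (ℕ.≤-reflexive (ℕ.m+[n∸m]≡n e≤d))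

  geometric-inverse : ∀ q e → 1 ≤ e → (Z.1# ⊕ ⊝ monomial q e) ⋆ geometric q e ≋ Z.1#
  geometric-inverse q e e>0 = Z.trans
    (solve 2 (λ m g → (con (+ 1) :- m) :* g := g :- m :* g) Z.refl (monomial q e) (geometric q e))
    (Z.trans (Z.+-congʳ (geometric-unfold q e e>0))
      (solve 1 (λ x → (con (+ 1) :+ x) :- x := con (+ 1)) Z.refl (monomial q e ⋆ geometric q e)))

  logDer-geometric : ∀ q e → 1 ≤ e → LogDer (λ d → e · (geometric q e ⊕ ⊝ Z.1#) d) (geometric q e)
  logDer-geometric q e e>0 = Z.trans (logDer-1- (geometric-inverse q e e>0)) (Z.*-congʳ (coeffs λ d → begin
      (θ m ⋆ g) d  ≈⟨ at (Z.*-congʳ θm) d ⟩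
      ((e̅ ⋆ m) ⋆ g) d  ≈⟨ at (Z.*-assoc e̅ m g) d ⟩
      (e̅ ⋆ (m ⋆ g)) d  ≈⟨ at (Z.*-congˡ m⋆g) d ⟩
      (e̅ ⋆ (g ⊕ ⊝ Z.1#)) d  ≈⟨ scale (g ⊕ ⊝ Z.1#) d ⟩
      e · (g ⊕ ⊝ Z.1#) d ∎))
    where
    m = monomial q e
    g = geometric q e
    e̅ = const (e · 1#)
    scale : ∀ f d → (e̅ ⋆ f) d ≈ e · f d
    scale f d = trans (const-⋆ _ f d) (trans (×-assoc-* e 1# (f d)) (×-congʳ e (*-identityˡ _)))
    m⋆g : m ⋆ g ≋ g ⊕ ⊝ Z.1#
    m⋆g = Z.trans (solve 1 (λ a → a := (con (+ 1) :+ a) :- con (+ 1)) Z.refl (m ⋆ g)) (Z.+-congʳ (Z.sym (geometric-unfold q e e>0)))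
    θm : θ m ≋ e̅ ⋆ m
    θm = coeffs λ d → trans (go d) (sym (scale m d))
      where
      go : ∀ d → d · m d ≈ e · m d
      go d with d ≡ᵇ e in eq
      ... | true  rewrite ≡ᵇ-sound {d} {e} eq = refl
      ... | false = trans (·-0 d) (sym (·-0 e))

  geometric-1 : ∀ q d → geometric q 1 d ≈ q ^ d
  geometric-1 q d = trans (∑<-single (suc d) d ℕ.≤-refl (λ m m≢d → reflexive (≡.cong (_▸ q ^ m)
      (≡ᵇ-false λ eq → m≢d (≡.trans (≡.sym (ℕ.*-identityʳ m)) eq)))))
    (reflexive (≡.cong (_▸ q ^ d) (≡.trans (≡.cong (_≡ᵇ d) (ℕ.*-identityʳ d)) (≡ᵇ-refl d))))

  module FZ = FiniteSums ⟨_⟦z⟧⟩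

  ∑<-at : ∀ k (f : ℕ → Series) n → FZ.∑< k f n ≈ ∑< k (λ i → f i n)
  ∑<-at zero    f n = trans (at (FZ.∑<-empty f) n) (sym (∑<-empty _))
  ∑<-at (suc k) f n = trans (at (FZ.∑<-suc k f) n) (trans (+-congˡ (∑<-at k (f ∘ suc) n)) (sym (∑<-suc k _)))

  module Multisets (W : Word → Carrier) where

    weight : List Word → Carrier
    weight []      = 1#
    weight (w ∷ R) = W w * weight R

    weight-replicate : ∀ c w R → weight (replicate c w ++ R) ≈ W w ^ c * weight R
    weight-replicate zero    w R = sym (*-identityˡ _)
    weight-replicate (suc c) w R = trans (*-congˡ (weight-replicate c w R)) (sym (*-assoc _ _ _))

    multisetSeries : List Word → Series
    multisetSeries ws n = ∑ (multisets ws n) weight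

    -- One factor of an Euler product: the multiplicity c chosen for w contributes the term W(w)^c
    -- z^{c |w|}.
    multisetSeries-∷ : ∀ w ws → 1 ≤ length w →
      multisetSeries (w ∷ ws) ≋ geometric (W w) (length w) ⋆ multisetSeries ws
    multisetSeries-∷ w ws w>0 = coeffs λ n → begin
      multisetSeries (w ∷ ws) n
        ≈⟨ ∑-concatMap (λ c → map (replicate c w ++_) (multisets ws (n ∸ c ℕ.* length w))) (filterB (λ c → c ℕ.* length w ≤ᵇ n) (upTo (suc n))) weight ⟩
      ∑ (filterB (λ c → c ℕ.* length w ≤ᵇ n) (upTo (suc n)))
        (λ c → ∑ (map (replicate c w ++_) (multisets ws (n ∸ c ℕ.* length w))) weight)
        ≈⟨ ∑-filterB (λ c → c ℕ.* length w ≤ᵇ n) (upTo (suc n)) (λ c → ∑ (map (replicate c w ++_) (multisets ws (n ∸ c ℕ.* length w))) weight) ⟩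
      ∑ (upTo (suc n)) (λ c → (c ℕ.* length w ≤ᵇ n) ▸ ∑ (map (replicate c w ++_) (multisets ws (n ∸ c ℕ.* length w))) weight)
        ≈⟨ ∑-upTo (suc n) (λ c → (c ℕ.* length w ≤ᵇ n) ▸ ∑ (map (replicate c w ++_) (multisets ws (n ∸ c ℕ.* length w))) weight) ⟩
      ∑< (suc n) (λ c → (c ℕ.* length w ≤ᵇ n) ▸ ∑ (map (replicate c w ++_) (multisets ws (n ∸ c ℕ.* length w))) weight)
        ≈⟨ ∑<-cong (suc n) (λ c _ → ▸-cong (c ℕ.* length w ≤ᵇ n) (begin
             ∑ (map (replicate c w ++_) (multisets ws (n ∸ c ℕ.* length w))) weight
               ≈⟨ ∑-map (replicate c w ++_) (multisets ws (n ∸ c ℕ.* length w)) weight ⟩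
             ∑ (multisets ws (n ∸ c ℕ.* length w)) (λ R → weight (replicate c w ++ R))
               ≈⟨ ∑-cong (multisets ws (n ∸ c ℕ.* length w)) (weight-replicate c w) ⟩
             ∑ (multisets ws (n ∸ c ℕ.* length w)) (λ R → W w ^ c * weight R)
               ≈⟨ ∑-*ˡ (multisets ws (n ∸ c ℕ.* length w)) _ _ ⟨
             W w ^ c * multisetSeries ws (n ∸ c ℕ.* length w) ∎)) ⟩
      ∑< (suc n) (λ c → (c ℕ.* length w ≤ᵇ n) ▸ W w ^ c * multisetSeries ws (n ∸ c ℕ.* length w))
        ≈⟨ geometric-⋆ (W w) (length w) (multisetSeries ws) n w>0 ⟨
      (geometric (W w) (length w) ⋆ multisetSeries ws) n ∎

    -- The coefficients of Σ_w |w| Σ_{m≥1} W(w)^m z^{m|w|}. Degree 0 is set apart because the inner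
    -- sum starts at m = 0, which would contribute there.
    powerSums : List Word → Series
    powerSums ws zero    = 0#
    powerSums ws (suc d) = ∑ ws (λ w → ∑< (suc (suc d)) (λ m → (m ℕ.* length w ≡ᵇ suc d) ▸ length w · W w ^ m))

    logDer-multisetSeries : ∀ ws → All (λ w → 1 ≤ length w) ws → LogDer (powerSums ws) (multisetSeries ws)
    logDer-multisetSeries [] [] = coeffs λ
      { zero → sym (zeroˡ _)
      ; (suc n) → trans (·-0 (suc n)) (sym (0⋆ {powerSums []} (multisetSeries []) (λ { zero → refl ; (suc i) → refl }) (suc n))) }
    logDer-multisetSeries (w ∷ ws) (w>0 ∷ ws>0) = Z.trans (θ-cong (multisetSeries-∷ w ws w>0))
      (Z.trans (logDer-⋆ (logDer-geometric (W w) (length w) w>0) (logDer-multisetSeries ws ws>0))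
        (Z.*-cong split (Z.sym (multisetSeries-∷ w ws w>0))))
      where
      split : (λ d → length w · (geometric (W w) (length w) ⊕ ⊝ Z.1#) d) ⊕ powerSums ws ≋ powerSums (w ∷ ws)
      split = coeffs λ
        { zero → trans (+-identityʳ _) (trans (×-congʳ (length w)
            (trans (+-congʳ (trans (∑<-suc 0 _) (trans (+-congˡ (∑<-empty _)) (+-identityʳ _)))) (-‿inverseʳ 1#))) (·-0 (length w)))
        ; (suc d) → +-congʳ (trans (×-congʳ (length w) (trans (+-congˡ -0#≈0#) (+-identityʳ _)))
            (trans (∑<-· (suc (suc d)) (length w) (λ m → (m ℕ.* length w ≡ᵇ suc d) ▸ W w ^ m))
              (∑<-cong (suc (suc d)) (λ m _ → ▸-· (m ℕ.* length w ≡ᵇ suc d) (length w) (W w ^ m))))) }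
        where open import Algebra.Properties.Ring ring using (-0#≈0#)

-- Ornaments and circular words

alphabet-letters : ∀ l N → All (λ a → absL a < N × ValidLetter l a) (alphabet l N)
alphabet-letters l N = All.concat⁺ (All.map⁺ (All.map
  (λ {u} u<N → All.++⁺ (All.map⁺ (All.map (u<N ,_) (All.all-upTo l))) ((u<N , tt) ∷ []))
  (All.all-upTo N)))

words-length : ∀ A n → All (λ w → length w ≡ n) (words A n)
words-length A zero    = ≡.refl ∷ []
words-length A (suc n) = All.concat⁺ (All.map⁺ (All.universal (λ a → All.map⁺ (All.map (≡.cong suc) (words-length A n))) A))

filterB-All : ∀ {A : Set} {P : A → Set} (p : A → Bool) {xs} → All P xs → All P (filterB p xs)
filterB-All p []               = []
filterB-All p {x ∷ xs} (q ∷ qs) with p x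
... | true  = q ∷ filterB-All p qs
... | false = filterB-All p qs

necklaces-nonempty : ∀ l N n → All (λ w → 1 ≤ length w) (necklaces l N n)
necklaces-nonempty l N n = All.concat⁺ (All.map⁺ (All.universal
  (λ m → filterB-All (isNecklace l) (All.map (λ eq → ≡.subst (1 ≤_) (≡.sym eq) (s≤s z≤n)) (words-length (alphabet l N) (suc m)))) (upTo n)))

module Ornaments (S : Ring₀) (N l′ : ℕ) (x : ℕ → CommutativeRing.Carrier S) (t r : CommutativeRing.Carrier S) where
  open CommutativeRing S hiding (zero)
  open FiniteSums S
  open PowerSeries S
  open SeriesTools S
  open import Algebra.Properties.Semiring.Mult semiring
    using (×-congʳ) renaming (_×_ to _·_)
  open import Algebra.Properties.Semiring.Exp semiring using (_^_; ^-congˡ)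
  open import Relation.Binary.Reasoning.Setoid setoid

  l : ℕ
  l = suc l′

  A : List Letter
  A = alphabet l N

  wtL : Letter → Carrier
  wtL (unb u m) = x u * t ^ m
  wtL (bar u)   = x u * t ^ l

  ∑-letters : ℕ → (Letter → Carrier) → Carrier
  ∑-letters u f = ∑< l (λ m → f (unb u m)) + f (bar u)

  ∑-letters-cong : ∀ u {f g : Letter → Carrier} → (∀ a → absL a ≡ u → f a ≈ g a) → ∑-letters u f ≈ ∑-letters u g
  ∑-letters-cong u p = +-cong (∑<-cong l (λ m _ → p (unb u m) ≡.refl)) (p (bar u) ≡.refl)

  ∑-alphabet : ∀ f → ∑ A f ≈ ∑< N (λ u → ∑-letters u f)
  ∑-alphabet f = begin
    ∑ A f
      ≈⟨ ∑-concatMap (λ u → map (unb u) (upTo l) ++ bar u ∷ []) (upTo N) f ⟩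
    ∑ (upTo N) (λ u → ∑ (map (unb u) (upTo l) ++ bar u ∷ []) f)
      ≈⟨ ∑-upTo N _ ⟩
    ∑< N (λ u → ∑ (map (unb u) (upTo l) ++ bar u ∷ []) f)
      ≈⟨ ∑<-cong N (λ u _ → trans (∑-++ (map (unb u) (upTo l)) (bar u ∷ []) f)
           (+-cong (trans (∑-map (unb u) (upTo l) f) (∑-upTo l (f ∘ unb u))) (+-identityʳ _))) ⟩
    ∑< N (λ u → ∑-letters u f) ∎

  ∈A : ∀ a → a ∈ A → absL a < N × ValidLetter l a
  ∈A a = All.lookup (alphabet-letters l N)

  -- The alphabet lists each of its letters once, expressed in the form in which sums over words
  -- consume it.
  ∑-δ : ∀ a → a ∈ A → ∀ (f : Letter → Carrier) → ∑ A (λ b → eqL b a ▸ f b) ≈ f a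
  ∑-δ a a∈A f = trans (∑-alphabet _) (go a (proj₁ (∈A a a∈A)) (proj₂ (∈A a a∈A)))
    where
    off : ∀ {b} → b ≢ a → ∀ y → eqL b a ▸ y ≈ 0#
    off {b} b≢a y = reflexive (≡.cong (_▸ y) (¬-not (b≢a ∘ eqL-sound {b} {a})))
    go : ∀ a → absL a < N → ValidLetter l a → ∑< N (λ u → ∑-letters u (λ b → eqL b a ▸ f b)) ≈ f a
    go (unb u m) u<N m<l = begin
      ∑< N (λ v → ∑-letters v (λ b → eqL b (unb u m) ▸ f b))
        ≈⟨ ∑<-single N u u<N (λ v v≢u → trans (+-cong (∑<-zero l (λ n _ →
             reflexive (≡.cong (λ b → (b ∧ (n ≡ᵇ m)) ▸ f (unb v n)) (≡ᵇ-false v≢u)))) refl) (+-identityʳ _)) ⟩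
      ∑< l (λ n → ((u ≡ᵇ u) ∧ (n ≡ᵇ m)) ▸ f (unb u n)) + 0#
        ≈⟨ trans (+-identityʳ _) (∑<-cong l (λ n _ → reflexive (≡.cong (λ b → (b ∧ (n ≡ᵇ m)) ▸ f (unb u n)) (≡ᵇ-refl u)))) ⟩
      ∑< l (λ n → (n ≡ᵇ m) ▸ f (unb u n))
        ≈⟨ ∑<-single l m m<l (λ n n≢m → reflexive (≡.cong (_▸ f (unb u n)) (≡ᵇ-false n≢m))) ⟩
      (m ≡ᵇ m) ▸ f (unb u m)
        ≡⟨ ≡.cong (_▸ f (unb u m)) (≡ᵇ-refl m) ⟩
      f (unb u m) ∎
    go (bar u) u<N _ = begin
      ∑< N (λ v → ∑-letters v (λ b → eqL b (bar u) ▸ f b))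
        ≈⟨ ∑<-cong N (λ v _ → trans (+-congʳ (∑<-0 l)) (+-identityˡ _)) ⟩
      ∑< N (λ v → (v ≡ᵇ u) ▸ f (bar v))
        ≈⟨ ∑<-single N u u<N (λ v v≢u → reflexive (≡.cong (_▸ f (bar v)) (≡ᵇ-false v≢u))) ⟩
      (u ≡ᵇ u) ▸ f (bar u)
        ≡⟨ ≡.cong (_▸ f (bar u)) (≡ᵇ-refl u) ⟩
      f (bar u) ∎

  open WordSums S A

  wtW : Word → Carrier
  wtW = wt l (λ a a∈A → proj₂ (∈A a a∈A)) ∑-δ wtL

  W : Word → Carrier
  W w = if isZeroSingle w then r * wtW w else wtW w

  open Multisets W

  closed : Series
  closed zero    = 0#
  closed (suc d) = ∑ (words A (suc d)) (λ v → cyclic v ▸ wtW v)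

  -- The power sums of the c x_u, which form the logarithmic derivative of H(cz).
  P : Carrier → Series
  P c zero    = 0#
  P c (suc d) = ∑< N (λ u → (c * x u) ^ suc d)

  -- What the m-th powers of necklaces of length e + 1 contribute to `closed` and to `powerSums`.
  -- Only for e = 0 do the two differ: there barred letters are forbidden and 0-coloured ones carry
  -- r.
  closedTerm necklaceTerm : ℕ → ℕ → Carrier
  closedTerm   e m = suc e · ∑ (words A (suc e)) (λ u → not (properPower u) ▸ canonical l u ▸ cyclic u ▸ wtW u ^ m)
  necklaceTerm e m = suc e · ∑ (words A (suc e)) (λ u → isNecklace l u ▸ W u ^ m)

  closed-terms : ∀ d → closed (suc d) ≈ ∑< (suc d) (λ e → ∑< (suc (suc d)) (λ m → (m ℕ.* suc e ≡ᵇ suc d) ▸ closedTerm e m))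
  closed-terms d = ∑-cyclic-by-necklace l (λ a a∈A → proj₂ (∈A a a∈A)) ∑-δ wtL (suc d) (s≤s z≤n)

  powerSums-terms : ∀ n d → suc d ≤ n → powerSums (necklaces l N n) (suc d) ≈
    ∑< (suc d) (λ e → ∑< (suc (suc d)) (λ m → (m ℕ.* suc e ≡ᵇ suc d) ▸ necklaceTerm e m))
  powerSums-terms n d d<n = begin
    powerSums (necklaces l N n) (suc d)
      ≈⟨ ∑-concatMap (λ e → filterB (isNecklace l) (words A (suc e))) (upTo n) term ⟩
    ∑ (upTo n) (λ e → ∑ (filterB (isNecklace l) (words A (suc e))) term)
      ≈⟨ ∑-upTo n _ ⟩
    ∑< n (λ e → ∑ (filterB (isNecklace l) (words A (suc e))) term)
      ≈⟨ ∑<-cong n (λ e _ → byLength e) ⟩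
    ∑< n (λ e → ∑< (suc (suc d)) (λ m → (m ℕ.* suc e ≡ᵇ suc d) ▸ necklaceTerm e m))
      -- Necklaces longer than d + 1 have no power of length d + 1, so every truncation n > d gives
      -- the same coefficient.
      ≈⟨ ∑<-extend (suc d) n d<n (λ e d<e → ∑<-zero (suc (suc d)) (λ m _ →
           reflexive (≡.cong (_▸ necklaceTerm e m) (¬-not λ p → tooLong m e d<e (≡ᵇ-sound p))))) ⟩
    ∑< (suc d) (λ e → ∑< (suc (suc d)) (λ m → (m ℕ.* suc e ≡ᵇ suc d) ▸ necklaceTerm e m)) ∎
    where
    term : Word → Carrier
    term w = ∑< (suc (suc d)) (λ m → (m ℕ.* length w ≡ᵇ suc d) ▸ length w · W w ^ m)
    tooLong : ∀ m e → suc d ≤ e → m ℕ.* suc e ≢ suc d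
    tooLong (suc m) e d<e eq = ℕ.<⇒≱ (s≤s d<e) (≡.subst (suc e ≤_) eq (ℕ.m≤m+n (suc e) (m ℕ.* suc e)))
    byLength : ∀ e → ∑ (filterB (isNecklace l) (words A (suc e))) term ≈
               ∑< (suc (suc d)) (λ m → (m ℕ.* suc e ≡ᵇ suc d) ▸ necklaceTerm e m)
    byLength e = begin
      ∑ (filterB (isNecklace l) (words A (suc e))) term
        ≈⟨ ∑-filterB (isNecklace l) (words A (suc e)) term ⟩
      ∑ (words A (suc e)) (λ w → isNecklace l w ▸ term w)
        ≈⟨ ∑-words-cong (suc e) (λ w len _ → begin
             isNecklace l w ▸ term w
               ≡⟨ ≡.cong (λ k → isNecklace l w ▸ ∑< (suc (suc d)) (λ m → (m ℕ.* k ≡ᵇ suc d) ▸ k · W w ^ m)) len ⟩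
             isNecklace l w ▸ ∑< (suc (suc d)) (λ m → (m ℕ.* suc e ≡ᵇ suc d) ▸ suc e · W w ^ m)
               ≈⟨ ∑<-▸ (suc (suc d)) (isNecklace l w) _ ⟩
             ∑< (suc (suc d)) (λ m → isNecklace l w ▸ (m ℕ.* suc e ≡ᵇ suc d) ▸ suc e · W w ^ m)
               ≈⟨ ∑<-cong (suc (suc d)) (λ m _ → trans (▸-swap (isNecklace l w) (m ℕ.* suc e ≡ᵇ suc d) _)
                    (▸-cong (m ℕ.* suc e ≡ᵇ suc d) (sym (▸-· (isNecklace l w) (suc e) (W w ^ m))))) ⟩
             ∑< (suc (suc d)) (λ m → (m ℕ.* suc e ≡ᵇ suc d) ▸ suc e · (isNecklace l w ▸ W w ^ m)) ∎) ⟩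
      ∑ (words A (suc e)) (λ w → ∑< (suc (suc d)) (λ m → (m ℕ.* suc e ≡ᵇ suc d) ▸ suc e · (isNecklace l w ▸ W w ^ m)))
        ≈⟨ ∑-∑<-swap (words A (suc e)) (suc (suc d)) (λ w m → (m ℕ.* suc e ≡ᵇ suc d) ▸ suc e · (isNecklace l w ▸ W w ^ m)) ⟩
      ∑< (suc (suc d)) (λ m → ∑ (words A (suc e)) (λ w → (m ℕ.* suc e ≡ᵇ suc d) ▸ suc e · (isNecklace l w ▸ W w ^ m)))
        ≈⟨ ∑<-cong (suc (suc d)) (λ m _ → trans (sym (∑-▸ (words A (suc e)) (m ℕ.* suc e ≡ᵇ suc d) _))
             (▸-cong (m ℕ.* suc e ≡ᵇ suc d) (∑-· (words A (suc e)) (suc e) _))) ⟩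
      ∑< (suc (suc d)) (λ m → (m ℕ.* suc e ≡ᵇ suc d) ▸ necklaceTerm e m) ∎
      where
      open import Algebra.Properties.CommutativeMonoid.Mult +-commutativeMonoid using (×-distrib-+)
      ∑-· : ∀ {B : Set} (xs : List B) n f → ∑ xs (λ y → n · f y) ≈ n · ∑ xs f
      ∑-· []       n f = sym (·-0 n)
      ∑-· (y ∷ xs) n f = trans (+-congˡ (∑-· xs n f)) (sym (×-distrib-+ _ _ n))

  long-term : ∀ e m → closedTerm (suc e) m ≈ necklaceTerm (suc e) m
  long-term e m = ×-congʳ (suc (suc e)) (∑-words-cong (suc (suc e)) (λ { (a ∷ b ∷ w) _ _ → go a b w }))
    where
    go : ∀ a b w → let u = a ∷ b ∷ w in
      not (properPower u) ▸ canonical l u ▸ cyclic u ▸ wtW u ^ m ≈ isNecklace l u ▸ W u ^ m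
    go a b w = begin
      not (properPower u) ▸ canonical l u ▸ cyclic u ▸ wtW u ^ m  ≈⟨ ▸-cong (not (properPower u)) (▸-swap (canonical l u) (cyclic u) _) ⟩
      not (properPower u) ▸ cyclic u ▸ canonical l u ▸ wtW u ^ m  ≈⟨ ▸-cong (not (properPower u)) (▸-∧ (cyclic u) (canonical l u) _) ⟨
      not (properPower u) ▸ (cyclic u ∧ canonical l u) ▸ wtW u ^ m  ≈⟨ ▸-∧ (not (properPower u)) _ _ ⟨
      (not (properPower u) ∧ cyclic u ∧ canonical l u) ▸ wtW u ^ m  ≡⟨ ≡.cong₂ (λ b y → (not (properPower u) ∧ cyclic u ∧ b ∧ canonical l u) ▸ y ^ m)
                                                                          (≡.sym (notBar a)) (≡.sym (zeroSingle a)) ⟩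
      isNecklace l u ▸ W u ^ m ∎
      where
      u = a ∷ b ∷ w
      notBar : ∀ a → notBarSingle (a ∷ b ∷ w) ≡ true
      notBar (unb _ _) = ≡.refl
      notBar (bar _)   = ≡.refl
      zeroSingle : ∀ a → W (a ∷ b ∷ w) ≡ wtW (a ∷ b ∷ w)
      zeroSingle (unb _ zero)    = ≡.refl
      zeroSingle (unb _ (suc _)) = ≡.refl
      zeroSingle (bar _)         = ≡.refl

  okPair-self : ∀ a → okPair (a , a) ≡ true
  okPair-self (unb u zero)    = ≤ᵇ-true (ℕ.≤-refl {u})
  okPair-self (unb u (suc m)) = ≡.refl
  okPair-self (bar u)         = ≤ᵇ-true (ℕ.≤-refl {u})

  closed-single : ∀ a m → not (properPower (a ∷ [])) ▸ canonical l (a ∷ []) ▸ cyclic (a ∷ []) ▸ wtW (a ∷ []) ^ m ≈ wtL a ^ m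
  closed-single a m rewrite leqW-refl l (a ∷ []) | okPair-self a = ^-congˡ m (*-identityʳ _)

  isNecklace-single : ∀ a → isNecklace l (a ∷ []) ≡ notBarSingle (a ∷ [])
  isNecklace-single a rewrite leqW-refl l (a ∷ []) | okPair-self a = ∧-identityʳ _

  ∑-words-1 : ∀ f → ∑ (words A 1) f ≈ ∑ A (λ a → f (a ∷ []))
  ∑-words-1 f = trans (∑-words-suc 0 f) (∑-cong A (λ a → +-identityʳ _))

  -- The barred and the 0-coloured singletons are the only circular words on which the two counts differ.
  short-term : ∀ m → necklaceTerm 0 m + (∑< N (λ u → (t ^ l * x u) ^ m) + ∑< N (λ u → (1# * x u) ^ m))
                   ≈ closedTerm 0 m + ∑< N (λ u → (r * x u) ^ m)
  short-term m = begin
    necklaceTerm 0 m + (∑< N (λ u → (t ^ l * x u) ^ m) + ∑< N (λ u → (1# * x u) ^ m))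
      ≈⟨ +-congʳ (trans (+-identityʳ _) (trans (∑-words-1 _) (∑-alphabet _))) ⟩
    ∑< N (λ u → ∑-letters u (λ a → isNecklace l (a ∷ []) ▸ W (a ∷ []) ^ m)) + (∑< N (λ u → (t ^ l * x u) ^ m) + ∑< N (λ u → (1# * x u) ^ m))
      ≈⟨ +-congˡ (∑<-+ N _ _) ⟨
    ∑< N (λ u → ∑-letters u (λ a → isNecklace l (a ∷ []) ▸ W (a ∷ []) ^ m)) + ∑< N (λ u → (t ^ l * x u) ^ m + (1# * x u) ^ m)
      ≈⟨ ∑<-+ N _ _ ⟨
    ∑< N (λ u → ∑-letters u (λ a → isNecklace l (a ∷ []) ▸ W (a ∷ []) ^ m) + ((t ^ l * x u) ^ m + (1# * x u) ^ m))
      ≈⟨ ∑<-cong N (λ u _ → letters u) ⟩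
    ∑< N (λ u → ∑-letters u (λ a → wtL a ^ m) + (r * x u) ^ m)
      ≈⟨ ∑<-+ N _ _ ⟩
    ∑< N (λ u → ∑-letters u (λ a → wtL a ^ m)) + ∑< N (λ u → (r * x u) ^ m)
      ≈⟨ +-congʳ (trans (+-identityʳ _) (trans (∑-words-1 _) (trans (∑-cong A (λ a → closed-single a m)) (∑-alphabet _)))) ⟨
    closedTerm 0 m + ∑< N (λ u → (r * x u) ^ m) ∎
    where
    single : ∀ a → isNecklace l (a ∷ []) ▸ W (a ∷ []) ^ m ≈ notBarSingle (a ∷ []) ▸ W (a ∷ []) ^ m
    single a = reflexive (≡.cong (_▸ W (a ∷ []) ^ m) (isNecklace-single a))
    letters : ∀ u → ∑-letters u (λ a → isNecklace l (a ∷ []) ▸ W (a ∷ []) ^ m) + ((t ^ l * x u) ^ m + (1# * x u) ^ m)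
                  ≈ ∑-letters u (λ a → wtL a ^ m) + (r * x u) ^ m
    letters u = begin
      ∑-letters u (λ a → isNecklace l (a ∷ []) ▸ W (a ∷ []) ^ m) + ((t ^ l * x u) ^ m + (1# * x u) ^ m)
        ≈⟨ +-congʳ (∑-letters-cong u (λ a _ → single a)) ⟩
      (∑< l (λ n → W (unb u n ∷ []) ^ m) + 0#) + ((t ^ l * x u) ^ m + (1# * x u) ^ m)
        ≈⟨ +-cong (trans (+-identityʳ _) (∑<-suc l′ _)) (+-cong (^-congˡ m (*-comm _ _)) (^-congˡ m (trans (*-identityˡ _) (sym (*-identityʳ _))))) ⟩
      (((r * (x u * 1# * 1#)) ^ m) + rest) + ((x u * t ^ l) ^ m + (x u * 1#) ^ m)
        ≈⟨ +-congʳ (+-cong (^-congˡ m (*-congˡ (trans (*-identityʳ _) (*-identityʳ _)))) (∑<-cong l′ (λ n _ → ^-congˡ m (*-identityʳ _)))) ⟩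
      ((r * x u) ^ m + rest′) + ((x u * t ^ l) ^ m + (x u * 1#) ^ m)
        ≈⟨ solve 4 (λ a b c d → (a :+ b) :+ (c :+ d) := ((d :+ b) :+ c) :+ a) refl _ _ _ _ ⟩
      (((x u * 1#) ^ m + rest′) + (x u * t ^ l) ^ m) + (r * x u) ^ m
        ≈⟨ +-congʳ (+-congʳ (∑<-suc l′ (λ n → wtL (unb u n) ^ m))) ⟨
      ∑-letters u (λ a → wtL a ^ m) + (r * x u) ^ m ∎
      where
      open IntegerSolver S using (solve; _:=_; _:+_)
      rest rest′ : Carrier
      rest  = ∑< l′ (λ n → (x u * t ^ suc n * 1#) ^ m)
      rest′ = ∑< l′ (λ n → (x u * t ^ suc n) ^ m)

  -- Corrections are added on both sides to avoid subtraction. On the left stand the barred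
  -- singletons and the 0-coloured ones with weight 1, both counted by `closed`; on the right stand
  -- the 0-coloured ones with weight r.
  powerSums-closed : ∀ n d → d ≤ n →
    powerSums (necklaces l N n) d + (P (t ^ l) d + P 1# d) ≈ closed d + P r d
  powerSums-closed n zero    d≤n = refl′
    where
    refl′ : 0# + (0# + 0#) ≈ 0# + 0#
    refl′ = +-congˡ (+-identityʳ _)
  powerSums-closed n (suc d) d<n = begin
    powerSums (necklaces l N n) (suc d) + (P (t ^ l) (suc d) + P 1# (suc d))
      ≈⟨ +-congʳ (trans (powerSums-terms n d d<n) (trans (∑<-suc d _) (+-congʳ (diagonal (necklaceTerm 0))))) ⟩
    (necklaceTerm 0 (suc d) + ∑< d (λ e → ∑< (suc (suc d)) (λ m → (m ℕ.* suc (suc e) ≡ᵇ suc d) ▸ necklaceTerm (suc e) m)))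
      + (P (t ^ l) (suc d) + P 1# (suc d))
      ≈⟨ solve 3 (λ a b c → (a :+ b) :+ c := (a :+ c) :+ b) refl _ _ _ ⟩
    (necklaceTerm 0 (suc d) + (P (t ^ l) (suc d) + P 1# (suc d)))
      + ∑< d (λ e → ∑< (suc (suc d)) (λ m → (m ℕ.* suc (suc e) ≡ᵇ suc d) ▸ necklaceTerm (suc e) m))
      ≈⟨ +-cong (short-term (suc d)) (∑<-cong d (λ e _ → ∑<-cong (suc (suc d)) (λ m _ →
           ▸-cong (m ℕ.* suc (suc e) ≡ᵇ suc d) (sym (long-term e m))))) ⟩
    (closedTerm 0 (suc d) + P r (suc d))
      + ∑< d (λ e → ∑< (suc (suc d)) (λ m → (m ℕ.* suc (suc e) ≡ᵇ suc d) ▸ closedTerm (suc e) m))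
      ≈⟨ solve 3 (λ a b c → (a :+ c) :+ b := (a :+ b) :+ c) refl _ _ _ ⟩
    (closedTerm 0 (suc d) + ∑< d (λ e → ∑< (suc (suc d)) (λ m → (m ℕ.* suc (suc e) ≡ᵇ suc d) ▸ closedTerm (suc e) m))) + P r (suc d)
      ≈⟨ +-congʳ (trans (closed-terms d) (trans (∑<-suc d _) (+-congʳ (diagonal (closedTerm 0))))) ⟨
    closed (suc d) + P r (suc d) ∎
    where
    open IntegerSolver S using (solve; _:=_; _:+_)
    diagonal : ∀ (f : ℕ → Carrier) → ∑< (suc (suc d)) (λ m → (m ℕ.* 1 ≡ᵇ suc d) ▸ f m) ≈ f (suc d)
    diagonal f = trans (∑<-single (suc (suc d)) (suc d) ℕ.≤-refl (λ m m≢ → reflexive (≡.cong (_▸ f m)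
        (≡ᵇ-false λ eq → m≢ (≡.trans (≡.sym (ℕ.*-identityʳ m)) eq)))))
      (reflexive (≡.cong (_▸ f (suc d)) (≡.trans (≡.cong (_≡ᵇ suc d) (ℕ.*-identityʳ (suc d))) (≡ᵇ-refl (suc d)))))

-- The transfer matrix

module Walks (S : Ring₀) (N l′ : ℕ) (x : ℕ → CommutativeRing.Carrier S) (t r : CommutativeRing.Carrier S) where
  open CommutativeRing S hiding (zero)
  open FiniteSums S
  open PowerSeries S
  open SeriesTools S
  open Ornaments S N l′ x t r
  open WordSums S A
  open import Algebra.Properties.Semiring.Exp semiring using (_^_)

  -- `okPair` looks only at the absolute value of its second letter, for which `bar u` is a
  -- representative.
  okA : Letter → ℕ → Bool
  okA a u = okPair (a , bar u)

  okPair-okA : ∀ a b → okPair (a , b) ≡ okA a (absL b)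
  okPair-okA (unb u zero)    b = ≡.refl
  okPair-okA (unb u (suc m)) b = ≡.refl
  okPair-okA (bar u)         b = ≡.refl

  -- M n u v sums over the admissible words of length n that start at absolute value u
  -- and may be followed by v.
  M : ℕ → ℕ → ℕ → Carrier
  M zero    u v = (u ≡ᵇ v) ▸ 1#
  M (suc n) u v = ∑-letters u (λ a → wtL a * ∑< N (λ u′ → okA a u′ ▸ M n u′ v))

  module _ where
    open import Relation.Binary.Reasoning.Setoid setoid
    open IntegerSolver S using (solve; _:=_; _:+_; _:*_; :-_; _:-_; con)

    ∑-chains : ∀ n a c → absL c < N →
      ∑ (words A n) (λ s → chain (a ∷ s ++ c ∷ []) ▸ wtW (a ∷ s)) ≈ wtL a * ∑< N (λ u → okA a u ▸ M n u (absL c))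
    ∑-chains zero a c c<N = begin
      ((okPair (a , c) ∧ true) ▸ wtL a * 1#) + 0#  ≈⟨ +-identityʳ _ ⟩
      (okPair (a , c) ∧ true) ▸ wtL a * 1#  ≡⟨ ≡.cong (_▸ wtL a * 1#) (≡.trans (∧-identityʳ _) (okPair-okA a c)) ⟩
      okA a (absL c) ▸ wtL a * 1#  ≈⟨ ▸-*ˡ (okA a (absL c)) (wtL a) 1# ⟨
      wtL a * (okA a (absL c) ▸ 1#)  ≈⟨ *-congˡ (▸-cong (okA a (absL c)) (reflexive (≡.cong (_▸ 1#) (≡ᵇ-refl (absL c))))) ⟨
      wtL a * (okA a (absL c) ▸ M 0 (absL c) (absL c))  ≈⟨ *-congˡ (∑<-single N (absL c) c<N (λ u u≢c → trans (▸-cong (okA a u)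
                                                                (reflexive (≡.cong (_▸ 1#) (≡ᵇ-false u≢c)))) (▸-0 (okA a u)))) ⟨
      wtL a * ∑< N (λ u → okA a u ▸ M 0 u (absL c))        ∎
    ∑-chains (suc n) a c c<N = begin
      ∑ (words A (suc n)) (λ s → chain (a ∷ s ++ c ∷ []) ▸ wtW (a ∷ s))
        ≈⟨ ∑-words-suc n _ ⟩
      ∑ A (λ b → ∑ (words A n) (λ s → (okPair (a , b) ∧ chain (b ∷ s ++ c ∷ [])) ▸ wtL a * wtW (b ∷ s)))
        ≈⟨ ∑-cong A (λ b → begin
             ∑ (words A n) (λ s → (okPair (a , b) ∧ chain (b ∷ s ++ c ∷ [])) ▸ wtL a * wtW (b ∷ s))
               ≈⟨ ∑-cong (words A n) (λ s → trans (▸-∧ (okPair (a , b)) _ _) (trans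
                    (▸-cong (okPair (a , b)) (sym (▸-*ˡ (chain (b ∷ s ++ c ∷ [])) _ _))) (sym (▸-*ˡ (okPair (a , b)) _ _)))) ⟩
             ∑ (words A n) (λ s → wtL a * (okPair (a , b) ▸ chain (b ∷ s ++ c ∷ []) ▸ wtW (b ∷ s)))
               ≈⟨ ∑-*ˡ (words A n) (wtL a) _ ⟨
             wtL a * ∑ (words A n) (λ s → okPair (a , b) ▸ chain (b ∷ s ++ c ∷ []) ▸ wtW (b ∷ s))
               ≈⟨ *-congˡ (∑-▸ (words A n) (okPair (a , b)) _) ⟨
             wtL a * (okPair (a , b) ▸ ∑ (words A n) (λ s → chain (b ∷ s ++ c ∷ []) ▸ wtW (b ∷ s)))
               ≈⟨ *-congˡ (▸-cong (okPair (a , b)) (∑-chains n b c c<N)) ⟩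
             wtL a * (okPair (a , b) ▸ step b)
               ≡⟨ ≡.cong (λ z → wtL a * (z ▸ step b)) (okPair-okA a b) ⟩
             wtL a * (okA a (absL b) ▸ step b) ∎) ⟩
      ∑ A (λ b → wtL a * (okA a (absL b) ▸ step b))
        ≈⟨ ∑-*ˡ A (wtL a) _ ⟨
      wtL a * ∑ A (λ b → okA a (absL b) ▸ step b)
        ≈⟨ *-congˡ (∑-alphabet _) ⟩
      wtL a * ∑< N (λ u → ∑-letters u (λ b → okA a (absL b) ▸ step b))
        ≈⟨ *-congˡ (∑<-cong N (λ u _ → trans (+-congʳ (sym (∑<-▸ l (okA a u) _))) (sym (▸-+ (okA a u) _ _)))) ⟩
      wtL a * ∑< N (λ u → okA a u ▸ M (suc n) u (absL c)) ∎
      where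
      step : Letter → Carrier
      step b = wtL b * ∑< N (λ u → okA b u ▸ M n u (absL c))

    closed-trace : ∀ n → closed (suc n) ≈ ∑< N (λ u → M (suc n) u u)
    closed-trace n = begin
      ∑ (words A (suc n)) (λ v → cyclic v ▸ wtW v)
        ≈⟨ ∑-words-suc n _ ⟩
      ∑ A (λ a → ∑ (words A n) (λ s → cyclic (a ∷ s) ▸ wtW (a ∷ s)))
        ≈⟨ ∑-cong-∈ A (λ a a∈A → trans (∑-cong (words A n) (λ s → reflexive (≡.cong (_▸ wtW (a ∷ s)) (cyclic-chain a s))))
             (∑-chains n a a (proj₁ (∈A a a∈A)))) ⟩
      ∑ A (λ a → wtL a * ∑< N (λ u → okA a u ▸ M n u (absL a)))
        ≈⟨ ∑-alphabet _ ⟩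
      ∑< N (λ u → M (suc n) u u) ∎

    ∑<-≤ : ∀ n u f → u < n → ∑< n (λ i → (i ≤ᵇ u) ▸ f i) ≈ ∑< u f + f u
    ∑<-≤ n u f u<n = trans (∑<-extend (suc u) n u<n (λ i u<i → reflexive (≡.cong (_▸ f i)
        (≤ᵇ-false (ℕ.<⇒≱ u<i)))))
      (trans (∑<-cong (suc u) (λ { i (s≤s i≤u) → reflexive (≡.cong (_▸ f i) (≤ᵇ-true i≤u)) }))
        (∑<-last u f))

    ∑<-≥ : ∀ n u f → u ≤ n → ∑< n (λ i → (u ≤ᵇ i) ▸ f i) + ∑< u f ≈ ∑< n f
    ∑<-≥ n       zero    f _         = trans (+-congˡ (∑<-empty f)) (+-identityʳ _)
    ∑<-≥ (suc n) (suc u) f (s≤s u≤n) = begin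
      ∑< (suc n) (λ i → (suc u ≤ᵇ i) ▸ f i) + ∑< (suc u) f
        ≈⟨ +-cong (trans (∑<-suc n _) (+-identityˡ _)) (∑<-suc u f) ⟩
      ∑< n (λ i → (suc u ≤ᵇ suc i) ▸ f (suc i)) + (f 0 + ∑< u (f ∘ suc))
        ≈⟨ +-congʳ (∑<-cong n (λ i _ → reflexive (≡.cong (_▸ f (suc i)) (≤ᵇ-suc u i)))) ⟩
      ∑< n (λ i → (u ≤ᵇ i) ▸ f (suc i)) + (f 0 + ∑< u (f ∘ suc))
        ≈⟨ solve 3 (λ a b c → a :+ (b :+ c) := b :+ (a :+ c)) refl _ _ _ ⟩
      f 0 + (∑< n (λ i → (u ≤ᵇ i) ▸ f (suc i)) + ∑< u (f ∘ suc))
        ≈⟨ +-congˡ (∑<-≥ n u (f ∘ suc) u≤n) ⟩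
      f 0 + ∑< n (f ∘ suc)
        ≈⟨ ∑<-suc n f ⟨
      ∑< (suc n) f ∎

    T : Carrier
    T = ∑< l (λ m → t ^ m)

    -- At absolute value u the 0-coloured letter admits successors v ≥ u, the other unbarred letters
    -- all v, and the barred one v ≤ u. Writing v ≥ u as the complement of v < u leaves a constant
    -- row with factor T and a triangular remainder.
    M-suc : ∀ n u v → u < N → M (suc n) u v ≈
      x u * (T * ∑< N (λ i → M n i v) + (t ^ l * M n u v + (t ^ l - 1#) * ∑< u (λ i → M n i v)))
    M-suc n u v u<N = begin
      ∑< l (λ m → x u * t ^ m * ∑< N (λ i → okA (unb u m) i ▸ f i)) + x u * t ^ l * ∑< N (λ i → (i ≤ᵇ u) ▸ f i)
        ≈⟨ +-cong (∑<-suc l′ _) (*-congˡ (∑<-≤ N u f u<N)) ⟩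
      (x u * 1# * up + ∑< l′ (λ m → x u * t ^ suc m * σ)) + x u * t ^ l * (∑< u f + f u)
        ≈⟨ +-congʳ (+-cong (*-congˡ up≈) tails) ⟩
      (x u * 1# * (σ - ∑< u f) + x u * (∑< l′ (λ m → t ^ suc m) * σ)) + x u * t ^ l * (∑< u f + f u)
        ≈⟨ solve 6 (λ x s p T τ m → (x :* con (+ 1) :* (s :- p) :+ x :* (T :* s)) :+ x :* τ :* (p :+ m)
              := x :* ((con (+ 1) :+ T) :* s :+ (τ :* m :+ (τ :- con (+ 1)) :* p))) refl
             (x u) σ (∑< u f) (∑< l′ (λ m → t ^ suc m)) (t ^ l) (f u) ⟩
      x u * ((1# + ∑< l′ (λ m → t ^ suc m)) * σ + (t ^ l * f u + (t ^ l - 1#) * ∑< u f))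
        ≈⟨ *-congˡ (+-congʳ (*-congʳ (∑<-suc l′ (λ m → t ^ m)))) ⟨
      x u * (T * σ + (t ^ l * f u + (t ^ l - 1#) * ∑< u f)) ∎
      where
      f : ℕ → Carrier
      f i = M n i v
      σ = ∑< N f
      up : Carrier
      up = ∑< N (λ i → (u ≤ᵇ i) ▸ f i)
      up≈ : up ≈ σ - ∑< u f
      up≈ = trans (solve 2 (λ a b → a := (a :+ b) :- b) refl up (∑< u f)) (+-congʳ (∑<-≥ N u f (ℕ.<⇒≤ u<N)))
      tails : ∑< l′ (λ m → x u * t ^ suc m * σ) ≈ x u * (∑< l′ (λ m → t ^ suc m) * σ)
      tails = trans (∑<-cong l′ (λ m _ → *-assoc _ _ _)) (trans (sym (∑<-*ˡ l′ (x u) _)) (*-congˡ (sym (∑<-*ʳ l′ σ _))))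

  X : ℕ → Series
  X u = monomial (x u) 1

  τ τ-1 T̂ : Series
  τ   = const (t ^ l)
  τ-1 = const (t ^ l - 1#)
  T̂   = const T

  X-⋆-zero : ∀ u f → (X u ⋆ f) 0 ≈ 0#
  X-⋆-zero u f = monomial-⋆ (x u) 1 f 0

  X-⋆-suc : ∀ u f n → (X u ⋆ f) (suc n) ≈ x u * f n
  X-⋆-suc u f n = monomial-⋆ (x u) 1 f (suc n)

  -- The triangular part of the transfer matrix without its factor x_u, acting on a vector of
  -- series.
  Λ : (ℕ → Series) → ℕ → Series
  Λ f u = (τ ⋆ f u) ⊕ (τ-1 ⋆ FZ.∑< u f)

  Λ-at : ∀ f u n → Λ f u n ≈ t ^ l * f u n + (t ^ l - 1#) * ∑< u (λ v → f v n)
  Λ-at f u n = +-cong (const-⋆ _ (f u) n) (trans (const-⋆ _ (FZ.∑< u f) n) (*-congˡ (∑<-at u f n)))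

  Solves : (ℕ → Series) → (ℕ → Series) → ℕ → Set
  Solves c f u = f u ≋ c u ⊕ (X u ⋆ Λ f u)

  solves-suc : ∀ c f u → Solves c f u → ∀ n →
    f u (suc n) ≈ c u (suc n) + x u * (t ^ l * f u n + (t ^ l - 1#) * ∑< u (λ v → f v n))
  solves-suc c f u p n = trans (at p (suc n)) (+-congˡ (trans (X-⋆-suc u (Λ f u) n) (*-congˡ (Λ-at f u n))))

  -- The factor `X u` raises the degree, so each coefficient is determined by those of the previous
  -- degree in rows up to u.
  solves-unique : ∀ k c {f g} → (∀ u → u < k → Solves c f u) → (∀ u → u < k → Solves c g u) →
    ∀ u → u < k → f u ≋ g u
  solves-unique k c {f} {g} p q u u<k = coeffs λ n → go n u u<k
    where
    go : ∀ n u → u < k → f u n ≈ g u n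
    go zero    u u<k = trans (at (p u u<k) 0) (trans (+-congˡ (trans (X-⋆-zero u (Λ f u)) (sym (X-⋆-zero u (Λ g u))))) (sym (at (q u u<k) 0)))
    go (suc n) u u<k = trans (solves-suc c f u (p u u<k) n) (trans
      (+-congˡ (*-congˡ (+-cong (*-congˡ (go n u u<k)) (*-congˡ (∑<-cong u (λ v v<u → go n v (ℕ.<-trans v<u u<k)))))))
      (sym (solves-suc c g u (q u u<k) n)))

  solveAt : (ℕ → Series) → ℕ → ℕ → Carrier
  solveAt c zero    u = c u 0
  solveAt c (suc n) u = c u (suc n) + x u * (t ^ l * solveAt c n u + (t ^ l - 1#) * ∑< u (solveAt c n))

  solution : (ℕ → Series) → ℕ → Series
  solution c u n = solveAt c n u

  solution-solves : ∀ c u → Solves c (solution c) u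
  solution-solves c u = coeffs λ
    { zero    → sym (trans (+-congˡ (X-⋆-zero u (Λ (solution c) u))) (+-identityʳ _))
    ; (suc n) → +-congˡ (sym (trans (X-⋆-suc u (Λ (solution c) u) n) (*-congˡ (Λ-at (solution c) u n)))) }

  module _ where
    open import Relation.Binary.Reasoning.Setoid Z.setoid
    open IntegerSolver ⟨_⟦z⟧⟩ using (solve; _:=_; _:+_; _:*_; :-_; _:-_; con)

    Λ-+ : ∀ f g u → Λ (λ v → f v ⊕ g v) u ≋ Λ f u ⊕ Λ g u
    Λ-+ f g u = Z.trans (Z.+-congˡ (Z.*-congˡ (FZ.∑<-+ u f g)))
      (solve 6 (λ τ τ′ a b c d → τ :* (a :+ b) :+ τ′ :* (c :+ d) := (τ :* a :+ τ′ :* c) :+ (τ :* b :+ τ′ :* d))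
        Z.refl τ τ-1 (f u) (g u) (FZ.∑< u f) (FZ.∑< u g))

    Λ-*ˡ : ∀ c f u → Λ (λ v → c ⋆ f v) u ≋ c ⋆ Λ f u
    Λ-*ˡ c f u = Z.trans (Z.+-congˡ (Z.*-congˡ (Z.sym (FZ.∑<-*ˡ u c f))))
      (solve 5 (λ τ τ′ c a b → τ :* (c :* a) :+ τ′ :* (c :* b) := c :* (τ :* a :+ τ′ :* b))
        Z.refl τ τ-1 c (f u) (FZ.∑< u f))

    Λ-∑ : ∀ k (f : ℕ → ℕ → Series) u → Λ (λ v → FZ.∑< k (λ i → f i v)) u ≋ FZ.∑< k (λ i → Λ (f i) u)
    Λ-∑ k f u = Z.trans (Z.+-cong (FZ.∑<-*ˡ k τ _) (Z.trans (Z.*-congˡ (FZ.∑<-swap u k (λ v i → f i v))) (FZ.∑<-*ˡ k τ-1 _)))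
      (Z.sym (FZ.∑<-+ k _ _))

    θ-∑ : ∀ k f → θ (FZ.∑< k f) ≋ FZ.∑< k (λ i → θ (f i))
    θ-∑ zero    f = Z.trans (θ-cong (FZ.∑<-empty f)) (Z.trans (coeffs ·-0) (Z.sym (FZ.∑<-empty _)))
    θ-∑ (suc k) f = Z.trans (θ-cong (FZ.∑<-suc k f)) (Z.trans (θ-+ _ _) (Z.trans (Z.+-congˡ (θ-∑ k _)) (Z.sym (FZ.∑<-suc k _))))

    θ-const-⋆ : ∀ c f → θ (const c ⋆ f) ≋ const c ⋆ θ f
    θ-const-⋆ c f = Z.trans (θ-⋆ (const c) f) (Z.trans (Z.+-congʳ (Z.trans (Z.*-congʳ (θ-const c)) (Z.zeroˡ f))) (Z.+-identityˡ _))

    θ-Λ : ∀ f u → θ (Λ f u) ≋ Λ (λ v → θ (f v)) u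
    θ-Λ f u = Z.trans (θ-+ _ _) (Z.+-cong (θ-const-⋆ _ (f u))
      (Z.trans (θ-const-⋆ _ (FZ.∑< u f)) (Z.*-congˡ (θ-∑ u f))))

    θ-X : ∀ u → θ (X u) ≋ X u
    θ-X u = coeffs λ { 0 → refl ; 1 → +-identityʳ _ ; (suc (suc n)) → ·-0 (suc (suc n)) }

    -- y spans the rank-one part of the transfer matrix, g v is column v of the triangular resolvent.
    y : ℕ → Series
    y = solution X

    δ : ℕ → ℕ → Series
    δ v u = const ((u ≡ᵇ v) ▸ 1#)

    g : ℕ → ℕ → Series
    g v = solution (δ v)

    walks : ℕ → ℕ → Series
    walks v u n = M n u v

    σ γ : ℕ → Series
    σ v = FZ.∑< N (walks v)
    γ v = FZ.∑< N (g v)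

    Y K : Series
    Y = FZ.∑< N y
    K = T̂ ⋆ Y

    -- The rank-one part of the transfer matrix sees the walks only through their sum `σ v`. Moved
    -- into the inhomogeneous term, it leaves a triangular system.
    walks-solves : ∀ v u → u < N → Solves (λ u → δ v u ⊕ (X u ⋆ (T̂ ⋆ σ v))) (walks v) u
    walks-solves v u u<N = coeffs λ
      { zero → sym (trans (+-cong (trans (+-congˡ (X-⋆-zero u (T̂ ⋆ σ v))) (+-identityʳ _)) (X-⋆-zero u (Λ (walks v) u))) (+-identityʳ _))
      ; (suc n) → trans (M-suc n u v u<N) (trans (distribˡ _ _ _) (sym (+-cong
          (trans (+-identityˡ _) (trans (X-⋆-suc u (T̂ ⋆ σ v) n) (*-congˡ (trans (const-⋆ T (σ v) n) (*-congˡ (∑<-at N (walks v) n))))))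
          (trans (X-⋆-suc u (Λ (walks v) u) n) (*-congˡ (Λ-at (walks v) u n)))))) }

    -- Superposition: the series T σ does not depend on u, so it multiplies the solution `y` for the
    -- right-hand side `X`.
    walks≋ : ∀ v u → u < N → walks v u ≋ g v u ⊕ ((T̂ ⋆ σ v) ⋆ y u)
    walks≋ v = solves-unique N _ (walks-solves v) (λ u _ → begin
      g v u ⊕ (s ⋆ y u)
        ≈⟨ Z.+-cong (solution-solves (δ v) u) (Z.*-congˡ (solution-solves X u)) ⟩
      (δ v u ⊕ (X u ⋆ Λ (g v) u)) ⊕ (s ⋆ (X u ⊕ (X u ⋆ Λ y u)))
        ≈⟨ solve 5 (λ d x a s b → (d :+ x :* a) :+ s :* (x :+ x :* b) := (d :+ x :* s) :+ x :* (a :+ s :* b))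
             Z.refl (δ v u) (X u) (Λ (g v) u) s (Λ y u) ⟩
      (δ v u ⊕ (X u ⋆ s)) ⊕ (X u ⋆ (Λ (g v) u ⊕ (s ⋆ Λ y u)))
        ≈⟨ Z.+-congˡ (Z.*-congˡ (Z.trans (Λ-+ (g v) (λ u → s ⋆ y u) u) (Z.+-congˡ (Λ-*ˡ s y u)))) ⟨
      (δ v u ⊕ (X u ⋆ s)) ⊕ (X u ⋆ Λ (λ u → g v u ⊕ (s ⋆ y u)) u) ∎)
      where s = T̂ ⋆ σ v

    -- Summing `walks≋` over u closes the system to σ = γ + K σ. This is the Sherman-Morrison
    -- formula without division.
    [1-K]σ : ∀ v → (Z.1# ⊕ ⊝ K) ⋆ σ v ≋ γ v
    [1-K]σ v = begin
      (Z.1# ⊕ ⊝ K) ⋆ σ v  ≈⟨ solve 2 (λ k s → (con (+ 1) :- k) :* s := s :- k :* s) Z.refl K (σ v) ⟩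
      σ v ⊕ ⊝ (K ⋆ σ v)  ≈⟨ Z.+-congʳ σ≋ ⟩
      (γ v ⊕ ((T̂ ⋆ σ v) ⋆ Y)) ⊕ ⊝ (K ⋆ σ v)  ≈⟨ solve 4 (λ c t s y → (c :+ (t :* s) :* y) :- (t :* y) :* s := c) Z.refl (γ v) T̂ (σ v) Y ⟩
      γ v ∎
      where
      σ≋ : σ v ≋ γ v ⊕ ((T̂ ⋆ σ v) ⋆ Y)
      σ≋ = Z.trans (FZ.∑<-cong N (walks≋ v)) (Z.trans (FZ.∑<-+ N _ _) (Z.+-congˡ (Z.sym (FZ.∑<-*ˡ N _ y))))

    -- Applying θ to y = zx + zLy gives θy = y + zLθy, so θy is the triangular resolvent applied to
    -- y. Both sides solve this system.
    θy : ∀ u → u < N → θ (y u) ≋ FZ.∑< N (λ v → y v ⋆ g v u)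
    θy = solves-unique N y
      (λ u _ → begin
        θ (y u)  ≈⟨ θ-cong (solution-solves X u) ⟩
        θ (X u ⊕ (X u ⋆ Λ y u))  ≈⟨ Z.trans (θ-+ _ _) (Z.+-congˡ (θ-⋆ (X u) (Λ y u))) ⟩
        θ (X u) ⊕ ((θ (X u) ⋆ Λ y u) ⊕ (X u ⋆ θ (Λ y u)))  ≈⟨ Z.+-cong (θ-X u) (Z.+-cong (Z.*-congʳ (θ-X u)) (Z.*-congˡ (θ-Λ y u))) ⟩
        X u ⊕ ((X u ⋆ Λ y u) ⊕ (X u ⋆ Λ (λ v → θ (y v)) u))  ≈⟨ Z.+-assoc _ _ _ ⟨
        (X u ⊕ (X u ⋆ Λ y u)) ⊕ (X u ⋆ Λ (λ v → θ (y v)) u)  ≈⟨ Z.+-congʳ (solution-solves X u) ⟨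
        y u ⊕ (X u ⋆ Λ (λ v → θ (y v)) u) ∎)
      (λ u u<N → begin
        FZ.∑< N (λ v → y v ⋆ g v u)
          ≈⟨ FZ.∑<-cong N (λ v _ → Z.trans (Z.*-congˡ (solution-solves (δ v) u))
               (solve 4 (λ y d x a → y :* (d :+ x :* a) := y :* d :+ x :* (y :* a)) Z.refl (y v) (δ v u) (X u) (Λ (g v) u))) ⟩
        FZ.∑< N (λ v → (y v ⋆ δ v u) ⊕ (X u ⋆ (y v ⋆ Λ (g v) u)))
          ≈⟨ Z.trans (FZ.∑<-+ N _ _) (Z.+-cong (pick u u<N) (Z.sym (FZ.∑<-*ˡ N (X u) _))) ⟩
        y u ⊕ (X u ⋆ FZ.∑< N (λ v → y v ⋆ Λ (g v) u))
          ≈⟨ Z.+-congˡ (Z.*-congˡ (Z.trans (Λ-∑ N (λ v w → y v ⋆ g v w) u) (FZ.∑<-cong N (λ v _ → Λ-*ˡ (y v) (g v) u)))) ⟨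
        y u ⊕ (X u ⋆ Λ (λ w → FZ.∑< N (λ v → y v ⋆ g v w)) u) ∎)
      where
      pick : ∀ u → u < N → FZ.∑< N (λ v → y v ⋆ δ v u) ≋ y u
      pick u u<N = Z.trans (FZ.∑<-single N u u<N (λ v v≢u → Z.trans (Z.*-congˡ (coeffs λ
            { zero → reflexive (≡.cong (_▸ 1#) (≡ᵇ-false (v≢u ∘ ≡.sym))) ; (suc n) → refl })) (Z.zeroʳ _)))
          (Z.trans (Z.*-congˡ (coeffs λ { zero → reflexive (≡.cong (_▸ 1#) (≡ᵇ-refl u)) ; (suc n) → refl })) (Z.*-identityʳ _))

    -- The sum on the right is the one that the rank-one part contributes to the trace. This
    -- identity makes the trace a logarithmic derivative.
    θK : θ K ≋ T̂ ⋆ FZ.∑< N (λ v → y v ⋆ γ v)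
    θK = Z.trans (θ-const-⋆ T Y) (Z.*-congˡ (Z.trans (θ-∑ N y) (Z.trans (FZ.∑<-cong N θy)
      (Z.trans (FZ.∑<-swap N N (λ u v → y v ⋆ g v u)) (FZ.∑<-cong N (λ v _ → Z.sym (FZ.∑<-*ˡ N (y v) (g v))))))))

    g-below : ∀ v n u → u < v → g v u n ≈ 0#
    g-below v zero    u u<v = reflexive (≡.cong (_▸ 1#) (≡ᵇ-false (ℕ.<⇒≢ u<v)))
    g-below v (suc n) u u<v = trans (+-identityˡ _) (trans (*-congˡ (trans (+-cong
      (trans (*-congˡ (g-below v n u u<v)) (zeroʳ _))
      (trans (*-congˡ (∑<-zero u (λ w w<u → g-below v n w (ℕ.<-trans w<u u<v)))) (zeroʳ _))) (+-identityʳ _))) (zeroʳ _))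

    -- Entries of column v in rows above v vanish by `g-below`. The diagonal entry then satisfies
    -- the scalar equation g = 1 + t^l x_v z g.
    g-diagonal : ∀ v → g v v ≋ geometric (t ^ l * x v) 1
    g-diagonal v = begin
      g v v  ≈⟨ Z.*-identityˡ _ ⟨
      Z.1# ⋆ g v v  ≈⟨ Z.*-congʳ inv ⟨
      ((Z.1# ⊕ ⊝ m) ⋆ G) ⋆ g v v  ≈⟨ solve 3 (λ m G g → ((con (+ 1) :- m) :* G) :* g := G :* (g :- m :* g)) Z.refl m G (g v v) ⟩
      G ⋆ (g v v ⊕ ⊝ (m ⋆ g v v))  ≈⟨ Z.*-congˡ (Z.+-congʳ gvv) ⟩
      G ⋆ ((Z.1# ⊕ (m ⋆ g v v)) ⊕ ⊝ (m ⋆ g v v))  ≈⟨ solve 2 (λ G a → G :* ((con (+ 1) :+ a) :- a) := G) Z.refl G (m ⋆ g v v) ⟩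
      G ∎
      where
      m = monomial (t ^ l * x v) 1
      G = geometric (t ^ l * x v) 1
      inv = geometric-inverse (t ^ l * x v) 1 (s≤s z≤n)
      gvv : g v v ≋ Z.1# ⊕ (m ⋆ g v v)
      gvv = coeffs λ
        { zero → trans (reflexive (≡.cong (_▸ 1#) (≡ᵇ-refl v))) (sym (trans (+-congˡ (monomial-⋆ (t ^ l * x v) 1 (g v v) 0)) (+-identityʳ _)))
        ; (suc n) → +-congˡ (trans (*-congˡ (trans (+-congˡ (trans (*-congˡ (∑<-zero v (g-below v n))) (zeroʳ _))) (+-identityʳ _)))
            (trans (trans (sym (*-assoc _ _ _)) (*-congʳ (*-comm _ _))) (sym (monomial-⋆ (t ^ l * x v) 1 (g v v) (suc n))))) }

    module Closed (W : Series) (W-inverse : (Z.1# ⊕ ⊝ K) ⋆ W ≋ Z.1#) where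

      -- The logarithmic form of det (1 - zA) = det (1 - zL) (1 - K): the first factor contributes
      -- the diagonal of L, the second θK / (1 - K).
      trace : FZ.∑< N (λ v → walks v v) ≋ FZ.∑< N (λ v → geometric (t ^ l * x v) 1) ⊕ (θ K ⋆ W)
      trace = begin
        FZ.∑< N (λ v → walks v v)
          ≈⟨ FZ.∑<-cong N (λ v v<N → Z.trans (walks≋ v v v<N) (Z.+-cong (g-diagonal v)
               (solve 3 (λ t s y → (t :* s) :* y := t :* (y :* s)) Z.refl T̂ (σ v) (y v)))) ⟩
        FZ.∑< N (λ v → geometric (t ^ l * x v) 1 ⊕ (T̂ ⋆ (y v ⋆ σ v)))
          ≈⟨ Z.trans (FZ.∑<-+ N _ _) (Z.+-congˡ (Z.sym (FZ.∑<-*ˡ N T̂ _))) ⟩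
        FZ.∑< N (λ v → geometric (t ^ l * x v) 1) ⊕ (T̂ ⋆ FZ.∑< N (λ v → y v ⋆ σ v))
          ≈⟨ Z.+-congˡ (Z.*-congˡ (FZ.∑<-cong N (λ v _ → σ≋ v))) ⟩
        FZ.∑< N (λ v → geometric (t ^ l * x v) 1) ⊕ (T̂ ⋆ FZ.∑< N (λ v → (y v ⋆ γ v) ⋆ W))
          ≈⟨ Z.+-congˡ (Z.trans (Z.*-congˡ (Z.sym (FZ.∑<-*ʳ N W _))) (Z.sym (Z.*-assoc _ _ _))) ⟩
        FZ.∑< N (λ v → geometric (t ^ l * x v) 1) ⊕ ((T̂ ⋆ FZ.∑< N (λ v → y v ⋆ γ v)) ⋆ W)
          ≈⟨ Z.+-congˡ (Z.*-congʳ θK) ⟨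
        FZ.∑< N (λ v → geometric (t ^ l * x v) 1) ⊕ (θ K ⋆ W) ∎
        where
        σ≋ : ∀ v → y v ⋆ σ v ≋ (y v ⋆ γ v) ⋆ W
        σ≋ v = begin
          y v ⋆ σ v  ≈⟨ Z.*-congˡ (Z.trans (Z.sym (Z.*-identityˡ _)) (Z.*-congʳ (Z.sym W-inverse))) ⟩
          y v ⋆ (((Z.1# ⊕ ⊝ K) ⋆ W) ⋆ σ v)  ≈⟨ solve 4 (λ y a w s → y :* ((a :* w) :* s) := (y :* (a :* s)) :* w) Z.refl (y v) (Z.1# ⊕ ⊝ K) W (σ v) ⟩
          (y v ⋆ ((Z.1# ⊕ ⊝ K) ⋆ σ v)) ⋆ W  ≈⟨ Z.*-congʳ (Z.*-congˡ ([1-K]σ v)) ⟩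
          (y v ⋆ γ v) ⋆ W ∎

      T·Y-zero : (θ K ⋆ W) 0 ≈ 0#
      T·Y-zero = zeroˡ _

      -- In degree 0 the trace counts N empty walks, which neither `closed` nor `P` contains; the
      -- comparison with `trace` starts in degree 1.
      closed≋ : closed ≋ P (t ^ l) ⊕ (θ K ⋆ W)
      closed≋ = coeffs λ
        { zero → sym (trans (+-identityˡ _) T·Y-zero)
        ; (suc n) → trans (closed-trace n) (trans (sym (∑<-at N (λ v → walks v v) (suc n)))
            (trans (at trace (suc n)) (+-congʳ (trans (∑<-at N (λ v → geometric (t ^ l * x v) 1) (suc n)) (∑<-cong N (λ v _ → geometric-1 (t ^ l * x v) (suc n))))))) }

    -- The product of the 1 - c x_u z for u < k. For a constant c it is inverse to the series of
    -- complete homogeneous functions of the c x_u.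
    E : Series → ℕ → Series
    E c zero    = Z.1#
    E c (suc k) = E c k ⋆ (Z.1# ⊕ ⊝ (c ⋆ X k))

    τ-1≋ : τ-1 ≋ τ ⊕ ⊝ Z.1#
    τ-1≋ = coeffs λ { zero → refl ; (suc n) → sym (trans (+-identityˡ _) -0#≈0#) }
      where open import Algebra.Properties.Ring ring using (-0#≈0#)

    -- With s the sum of the y_u for u < k, the equation for y_k reads (1 - τ x_k z) y_k = x_k z (1
    -- + (τ - 1) s). Adding y_k to s thus multiplies 1 + (τ - 1) s by (1 - x_k z) / (1 - τ x_k z),
    -- and the product telescopes.
    E-Y : ∀ k → E τ k ⋆ (Z.1# ⊕ (τ-1 ⋆ FZ.∑< k y)) ≋ E Z.1# k
    E-Y zero = Z.trans (Z.*-congˡ (Z.+-congˡ (Z.*-congˡ (FZ.∑<-empty y))))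
      (solve 1 (λ t → con (+ 1) :* (con (+ 1) :+ t :* con (+ 0)) := con (+ 1)) Z.refl τ-1)
    E-Y (suc k) = begin
      (e ⋆ (Z.1# ⊕ ⊝ (τ ⋆ X k))) ⋆ (Z.1# ⊕ (τ-1 ⋆ FZ.∑< (suc k) y))
        ≈⟨ Z.*-congˡ (Z.+-congˡ (Z.*-congˡ (FZ.∑<-last k y))) ⟩
      (e ⋆ (Z.1# ⊕ ⊝ (τ ⋆ X k))) ⋆ (Z.1# ⊕ (τ-1 ⋆ (s ⊕ y k)))
        ≈⟨ solve 6 (λ e τ x τ′ s y → (e :* (con (+ 1) :- τ :* x)) :* (con (+ 1) :+ τ′ :* (s :+ y))
             := e :* ((con (+ 1) :- τ :* x) :* (con (+ 1) :+ τ′ :* s) :+ τ′ :* (y :- x :* (τ :* y)))) Z.refl e τ (X k) τ-1 s (y k) ⟩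
      e ⋆ (((Z.1# ⊕ ⊝ (τ ⋆ X k)) ⋆ (Z.1# ⊕ (τ-1 ⋆ s))) ⊕ (τ-1 ⋆ (y k ⊕ ⊝ (X k ⋆ (τ ⋆ y k)))))
        ≈⟨ Z.*-congˡ (Z.+-congˡ (Z.*-congˡ (Z.+-congʳ (solution-solves X k)))) ⟩
      e ⋆ (((Z.1# ⊕ ⊝ (τ ⋆ X k)) ⋆ (Z.1# ⊕ (τ-1 ⋆ s))) ⊕ (τ-1 ⋆ ((X k ⊕ (X k ⋆ ((τ ⋆ y k) ⊕ (τ-1 ⋆ s)))) ⊕ ⊝ (X k ⋆ (τ ⋆ y k)))))
        ≈⟨ solve 6 (λ e τ x τ′ s y →
             e :* ((con (+ 1) :- τ :* x) :* (con (+ 1) :+ τ′ :* s) :+ τ′ :* ((x :+ x :* (τ :* y :+ τ′ :* s)) :- x :* (τ :* y)))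
             := (e :* (con (+ 1) :+ τ′ :* s)) :* (con (+ 1) :- (τ :- τ′) :* x)) Z.refl e τ (X k) τ-1 s (y k) ⟩
      (e ⋆ (Z.1# ⊕ (τ-1 ⋆ s))) ⋆ (Z.1# ⊕ ⊝ ((τ ⊕ ⊝ τ-1) ⋆ X k))
        ≈⟨ Z.*-cong (E-Y k) (Z.+-congˡ (Z.-‿cong (Z.*-congʳ (Z.trans (Z.+-congˡ (Z.-‿cong τ-1≋))
             (solve 1 (λ τ → τ :- (τ :- con (+ 1)) := con (+ 1)) Z.refl τ))))) ⟩
      E Z.1# (suc k) ∎
      where
      e = E τ k
      s = FZ.∑< k y

-- The generating function of ornaments

module Generating (S : Ring₀) (N l′ : ℕ) (x : ℕ → CommutativeRing.Carrier S) (t r : CommutativeRing.Carrier S)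
  (torsionFree : SeriesTools.TorsionFree S)
  (cancel : SeriesTools.Cancellable S (CommutativeRing._-_ S t (CommutativeRing.1# S))) where
  open CommutativeRing S hiding (zero)
  open FiniteSums S
  open PowerSeries S
  open SeriesTools S
  open Ornaments S N l′ x t r hiding (W)
  open Walks S N l′ x t r
  open import Algebra.Properties.Semiring.Exp semiring using (_^_; ^-congˡ; ^-homo-*; ^-assocʳ)
  open import Algebra.Properties.CommutativeSemiring.Exp commutativeSemiring using (^-distrib-*)
  open Multisets (Ornaments.W S N l′ x t r)

  dot : Series → List Carrier → Carrier
  dot k []       = 0#
  dot k (a ∷ as) = k 0 * a + dot (k ∘ suc) as

  -- The first n + 1 coefficients of 1 / (1 − K), last one first.
  inversePrefix : ℕ → List Carrier
  inverseAt : ℕ → Carrier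
  inversePrefix zero    = 1# ∷ []
  inversePrefix (suc n) = inverseAt (suc n) ∷ inversePrefix n
  inverseAt zero        = 1#
  inverseAt (suc n)     = dot (K ∘ suc) (inversePrefix n)

  W : Series
  W = inverseAt

  dot-⋆ : ∀ k n → dot k (inversePrefix n) ≈ (k ⋆ W) n
  dot-⋆ k zero    = +-identityʳ _
  dot-⋆ k (suc n) = +-congˡ (dot-⋆ (k ∘ suc) n)

  sums-zero : ∀ k (f : ℕ → Series) → (∀ i → f i 0 ≈ 0#) → FZ.∑< k f 0 ≈ 0#
  sums-zero k f p = trans (∑<-at k f 0) (∑<-zero k (λ i _ → p i))

  K-zero : K 0 ≈ 0#
  K-zero = trans (*-congˡ (sums-zero N y (λ _ → refl))) (zeroʳ _)

  module _ where
    open import Relation.Binary.Reasoning.Setoid Z.setoid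
    open IntegerSolver ⟨_⟦z⟧⟩ using (solve; _:=_; _:+_; _:*_; :-_; _:-_; con)

    W-unfold : W ≋ Z.1# ⊕ (K ⋆ W)
    W-unfold = coeffs λ
      { zero → sym (trans (+-congˡ (trans (*-congʳ K-zero) (zeroˡ _))) (+-identityʳ _))
      ; (suc n) → sym (trans (+-identityˡ _) (trans (+-congʳ (trans (*-congʳ K-zero) (zeroˡ _)))
          (trans (+-identityˡ _) (sym (dot-⋆ (K ∘ suc) n))))) }

    W-inverse : (Z.1# ⊕ ⊝ K) ⋆ W ≋ Z.1#
    W-inverse = Z.trans (solve 2 (λ k w → (con (+ 1) :- k) :* w := w :- k :* w) Z.refl K W)
      (Z.trans (Z.+-congʳ W-unfold) (solve 1 (λ a → (con (+ 1) :+ a) :- a := con (+ 1)) Z.refl (K ⋆ W)))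

    open Closed W W-inverse

    logDer-W : LogDer (θ K ⋆ W) W
    logDer-W = logDer-1- W-inverse

    -- Σ_d h_d(c x₀, …, c x_{k-1}) z^d
    H : Carrier → ℕ → Series
    H c zero    = Z.1#
    H c (suc k) = H c k ⋆ geometric (c * x k) 1

    E-H : ∀ c k → E (const c) k ⋆ H c k ≋ Z.1#
    E-H c zero    = Z.*-identityˡ _
    E-H c (suc k) = begin
      (E (const c) k ⋆ (Z.1# ⊕ ⊝ (const c ⋆ X k))) ⋆ (H c k ⋆ geometric (c * x k) 1)
        ≈⟨ solve 4 (λ a b c d → (a :* b) :* (c :* d) := (a :* c) :* (b :* d)) Z.refl _ _ _ _ ⟩
      (E (const c) k ⋆ H c k) ⋆ ((Z.1# ⊕ ⊝ (const c ⋆ X k)) ⋆ geometric (c * x k) 1)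
        ≈⟨ Z.*-cong (E-H c k) (Z.trans (Z.*-congʳ (Z.+-congˡ (Z.-‿cong (coeffs λ d →
             trans (const-⋆ c (X k) d) (▸-*ˡ (d ≡ᵇ 1) c (x k)))))) (geometric-inverse (c * x k) 1 (s≤s z≤n))) ⟩
      Z.1# ⋆ Z.1#
        ≈⟨ Z.*-identityˡ _ ⟩
      Z.1# ∎

    Pₖ : Carrier → ℕ → Series
    Pₖ c k zero    = 0#
    Pₖ c k (suc d) = ∑< k (λ u → (c * x u) ^ suc d)

    logDer-H : ∀ c k → LogDer (Pₖ c k) (H c k)
    logDer-H c zero    = Z.trans (θ-const 1#) (Z.sym (Z.trans (Z.*-congʳ P₀) (Z.zeroˡ _)))
      where
      P₀ : Pₖ c 0 ≋ Z.0#
      P₀ = coeffs λ { zero → refl ; (suc d) → ∑<-empty _ }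
    logDer-H c (suc k) = Z.trans (logDer-⋆ (logDer-H c k) (logDer-geometric (c * x k) 1 (s≤s z≤n)))
      (Z.*-congʳ (coeffs λ
        { zero → trans (+-identityˡ _) (trans (+-identityʳ _) (trans (+-congʳ (geometric-1 (c * x k) 0)) (-‿inverseʳ 1#)))
        ; (suc d) → trans (+-congˡ (trans (+-identityʳ _) (trans (+-congˡ -0#≈0#) (trans (+-identityʳ _) (geometric-1 (c * x k) (suc d))))))
            (sym (∑<-last k _)) }))
      where open import Algebra.Properties.Ring ring using (-0#≈0#)

    logDer-P : ∀ c → LogDer (P c) (H c N)
    logDer-P c = Z.trans (logDer-H c N) (Z.*-congʳ (coeffs λ { zero → refl ; (suc d) → refl }))

    -- `W` is 1 / (1 - K) and the second factor is 1 / H(z), which removes the 0-coloured singletons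
    -- of weight 1.
    F : Series
    F = W ⋆ E Z.1# N

    logDer-F⋆H : LogDer (((θ K ⋆ W) ⊕ ⊝ P 1#) ⊕ P r) (F ⋆ H r N)
    logDer-F⋆H = logDer-⋆ (logDer-⋆ logDer-W (logDer-inverse (logDer-P 1#) (Z.trans (Z.*-comm _ _) (E-H 1# N)))) (logDer-P r)

    E-zero : ∀ k → E Z.1# k 0 ≈ 1#
    E-zero zero    = refl
    E-zero (suc k) = trans (*-cong (E-zero k) (trans (+-congˡ (trans (-‿cong (zeroʳ _)) -0#≈0#)) (+-identityʳ _))) (*-identityˡ _)
      where open import Algebra.Properties.Ring ring using (-0#≈0#)

    H-zero : ∀ c k → H c k 0 ≈ 1#
    H-zero c zero    = refl
    H-zero c (suc k) = trans (*-cong (H-zero c k) (geometric-1 (c * x k) 0)) (*-identityˡ _)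

    F-zero : F 0 ≈ 1#
    F-zero = trans (*-identityˡ _) (E-zero N)

    multisetSeries-zero : ∀ ws → All (λ w → 1 ≤ length w) ws → multisetSeries ws 0 ≈ 1#
    multisetSeries-zero []       []          = +-identityʳ _
    multisetSeries-zero (w ∷ ws) (w>0 ∷ ws>0) = trans (at (multisetSeries-∷ w ws w>0) 0)
      (trans (*-cong (trans (∑<-suc 0 _) (trans (+-congˡ (∑<-empty _)) (+-identityʳ _))) (multisetSeries-zero ws ws>0)) (*-identityˡ _))

    -- Both series have constant term 1, and their logarithmic derivatives agree up to degree n. The
    -- barred singletons missing among necklaces cancel against the term P(t^l) from the diagonal of
    -- the transfer matrix.
    ornaments≈F⋆H : ∀ n → multisetSeries (necklaces l N n) n ≈ (F ⋆ H r N) n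
    ornaments≈F⋆H n = logDer-unique torsionFree n
      (logDer-multisetSeries (necklaces l N n) (necklaces-nonempty l N n)) logDer-F⋆H refl same
      (trans (multisetSeries-zero (necklaces l N n) (necklaces-nonempty l N n))
        (sym (trans (*-cong F-zero (H-zero r N)) (*-identityˡ _)))) n ℕ.≤-refl
      where
      open IntegerSolver S using () renaming (solve to solveS; _:=_ to _:=ˢ_; _:+_ to _:+ˢ_; _:-_ to _:-ˢ_)
      same : ∀ i → i ≤ n → powerSums (necklaces l N n) i ≈ (((θ K ⋆ W) ⊕ ⊝ P 1#) ⊕ P r) i
      same i i≤n = trans
        (solveS 3 (λ p a b → p :=ˢ (p :+ˢ (a :+ˢ b)) :-ˢ (a :+ˢ b)) refl (powerSums (necklaces l N n) i) (P (t ^ l) i) (P 1# i))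
        (trans (+-congʳ (trans (powerSums-closed n i i≤n) (+-congʳ (at closed≋ i))))
          (solveS 4 (λ a k r b → ((a :+ˢ k) :+ˢ r) :-ˢ (a :+ˢ b) :=ˢ (k :-ˢ b) :+ˢ r) refl (P (t ^ l) i) ((θ K ⋆ W) i) (P r i) (P 1# i)))

    ⋆-graded : ∀ c {f f′ g g′ : Series} → (∀ i → f i ≈ c ^ i * f′ i) → (∀ i → g i ≈ c ^ i * g′ i) →
               ∀ n → (f ⋆ g) n ≈ c ^ n * (f′ ⋆ g′) n
    ⋆-graded c {f} {f′} {g} {g′} p q n = trans (⋆-sum f g n) (trans (∑<-cong (suc n) (λ { i (s≤s i≤n) →
        trans (*-cong (p i) (q (n ∸ i))) (trans (rearrange (c ^ i) (f′ i) (c ^ (n ∸ i)) (g′ (n ∸ i)))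
          (*-congʳ (trans (sym (^-homo-* c i (n ∸ i))) (reflexive (≡.cong (c ^_) (ℕ.m+[n∸m]≡n i≤n)))))) }))
      (trans (sym (∑<-*ˡ (suc n) (c ^ n) _)) (*-congˡ (sym (⋆-sum f′ g′ n)))))
      where
      open IntegerSolver S using () renaming (solve to solveS; _:=_ to _:=ˢ_; _:*_ to _:*ˢ_)
      rearrange : ∀ a b c d → (a * b) * (c * d) ≈ (a * c) * (b * d)
      rearrange = solveS 4 (λ a b c d → (a :*ˢ b) :*ˢ (c :*ˢ d) :=ˢ (a :*ˢ c) :*ˢ (b :*ˢ d)) refl

    H-scale : ∀ c k d → H c k d ≈ c ^ d * H 1# k d
    H-scale c zero    zero    = sym (*-identityˡ _)
    H-scale c zero    (suc d) = sym (zeroʳ _)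
    H-scale c (suc k) d = ⋆-graded c (H-scale c k) (λ i → trans (geometric-1 (c * x k) i)
      (trans (^-distrib-* c (x k) i) (*-congˡ (sym (trans (geometric-1 (1# * x k) i) (^-congˡ i (*-identityˡ _))))))) d

    h : ℕ → Carrier
    h = H 1# N

    geometricSum : ∀ n → (t - 1#) * ∑< n (λ i → t ^ i) ≈ t ^ n - 1#
    geometricSum zero    = trans (*-congˡ (∑<-empty _)) (trans (zeroʳ _) (sym (-‿inverseʳ 1#)))
    geometricSum (suc n) = trans (*-congˡ (∑<-last n _)) (trans (distribˡ _ _ _) (trans (+-congʳ (geometricSum n))
      (solveS 2 (λ t p → (p :-ˢ conˢ (+ 1)) :+ˢ (t :-ˢ conˢ (+ 1)) :*ˢ p :=ˢ t :*ˢ p :-ˢ conˢ (+ 1)) refl t (t ^ n))))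
      where open IntegerSolver S using () renaming (solve to solveS; _:=_ to _:=ˢ_; _:*_ to _:*ˢ_; _:+_ to _:+ˢ_; _:-_ to _:-ˢ_; con to conˢ)

    -- t + t² + ... + t^{ld-1}, which is empty for ld ≤ 1.
    [_]ₜ : ℕ → Carrier
    [ d ]ₜ = ∑< (l ℕ.* d ∸ 1) (λ i → t ^ suc i)

    G : Series
    G zero    = 0#
    G (suc d) = [ suc d ]ₜ * h (suc d)

    -- Both sides times t − 1 equal t H(z) − H(t^l z).
    [1-K]⋆H : (Z.1# ⊕ ⊝ K) ⋆ H 1# N ≋ Z.1# ⊕ ⊝ G
    [1-K]⋆H = coeffs λ d → cancel _ _ (trans (sym (const-⋆ (t - 1#) _ d)) (trans (at lhs d) (trans (+-congʳ (const-⋆ t (H 1# N) d)) (rhs d))))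
      where
      κ = const (t - 1#)
      κT̂ : κ ⋆ T̂ ≋ τ-1
      κT̂ = coeffs λ d → trans (const-⋆ (t - 1#) T̂ d) (go d)
        where go : ∀ d → (t - 1#) * T̂ d ≈ τ-1 d
              go zero    = geometricSum l
              go (suc d) = zeroʳ _
      κ+1 : κ ⊕ Z.1# ≋ const t
      κ+1 = coeffs λ { zero → trans (+-assoc _ _ _) (trans (+-congˡ (-‿inverseˡ 1#)) (+-identityʳ _)) ; (suc d) → +-identityʳ _ }
      1+Y : (Z.1# ⊕ (τ-1 ⋆ Y)) ⋆ H 1# N ≋ H (t ^ l) N
      1+Y = begin
        m ⋆ H 1# N  ≈⟨ Z.*-identityˡ _ ⟨
        Z.1# ⋆ (m ⋆ H 1# N)  ≈⟨ Z.*-congʳ (E-H (t ^ l) N) ⟨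
        (E τ N ⋆ H (t ^ l) N) ⋆ (m ⋆ H 1# N)  ≈⟨ solve 4 (λ e h m k → (e :* h) :* (m :* k) := ((e :* m) :* k) :* h) Z.refl _ _ _ _ ⟩
        ((E τ N ⋆ m) ⋆ H 1# N) ⋆ H (t ^ l) N  ≈⟨ Z.*-congʳ (Z.*-congʳ (E-Y N)) ⟩
        (E Z.1# N ⋆ H 1# N) ⋆ H (t ^ l) N  ≈⟨ Z.trans (Z.*-congʳ (E-H 1# N)) (Z.*-identityˡ _) ⟩
        H (t ^ l) N ∎
        where m = Z.1# ⊕ (τ-1 ⋆ Y)
      lhs : κ ⋆ ((Z.1# ⊕ ⊝ K) ⋆ H 1# N) ≋ (const t ⋆ H 1# N) ⊕ ⊝ H (t ^ l) N
      lhs = begin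
        κ ⋆ ((Z.1# ⊕ ⊝ (T̂ ⋆ Y)) ⋆ H 1# N)
          ≈⟨ solve 4 (λ κ t y h → κ :* ((con (+ 1) :- t :* y) :* h) := (κ :+ con (+ 1)) :* h :- (con (+ 1) :+ (κ :* t) :* y) :* h) Z.refl κ T̂ Y (H 1# N) ⟩
        ((κ ⊕ Z.1#) ⋆ H 1# N) ⊕ ⊝ ((Z.1# ⊕ ((κ ⋆ T̂) ⋆ Y)) ⋆ H 1# N)
          ≈⟨ Z.+-cong (Z.*-congʳ κ+1) (Z.-‿cong (Z.trans (Z.*-congʳ (Z.+-congˡ (Z.*-congʳ κT̂))) 1+Y)) ⟩
        (const t ⋆ H 1# N) ⊕ ⊝ H (t ^ l) N ∎
      open IntegerSolver S using () renaming (solve to solveS; _:=_ to _:=ˢ_; _:*_ to _:*ˢ_; _:-_ to _:-ˢ_; con to conˢ)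
      rhs : ∀ d → t * h d + - H (t ^ l) N d ≈ (t - 1#) * (const 1# d + - G d)
      rhs zero = trans (+-cong (*-congˡ (H-zero 1# N)) (-‿cong (H-zero (t ^ l) N)))
        (solveS 1 (λ t → t :*ˢ conˢ (+ 1) :-ˢ conˢ (+ 1) :=ˢ (t :-ˢ conˢ (+ 1)) :*ˢ (conˢ (+ 1) :-ˢ conˢ (+ 0))) refl t)
      rhs (suc d) = trans (+-congˡ (-‿cong (trans (H-scale (t ^ l) N (suc d)) (*-congʳ pow))))
        (trans (solveS 4 (λ t s p h → t :*ˢ h :-ˢ (t :*ˢ p) :*ˢ h :=ˢ
                  conˢ (+ 0) :-ˢ t :*ˢ ((p :-ˢ conˢ (+ 1)) :*ˢ h)) refl t 1# (t ^ k) (h (suc d)))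
        (trans (+-congˡ (-‿cong (*-congˡ (*-congʳ (sym (geometricSum k))))))
        (trans (solveS 3 (λ t s h → conˢ (+ 0) :-ˢ t :*ˢ (((t :-ˢ conˢ (+ 1)) :*ˢ s) :*ˢ h) :=ˢ
                  (t :-ˢ conˢ (+ 1)) :*ˢ (conˢ (+ 0) :-ˢ (t :*ˢ s) :*ˢ h)) refl t (∑< k (λ i → t ^ i)) (h (suc d)))
          (*-congˡ (+-congˡ (-‿cong (*-congʳ (∑<-*ˡ k t _))))))))
        where
        k = l ℕ.* suc d ∸ 1
        pow : (t ^ l) ^ suc d ≈ t * t ^ k
        pow = ^-assocʳ t l (suc d)

    F⋆[1-G] : F ⋆ (Z.1# ⊕ ⊝ G) ≋ Z.1#
    F⋆[1-G] = begin
      F ⋆ (Z.1# ⊕ ⊝ G)  ≈⟨ Z.*-congˡ [1-K]⋆H ⟨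
      (W ⋆ E Z.1# N) ⋆ ((Z.1# ⊕ ⊝ K) ⋆ H 1# N)  ≈⟨ solve 4 (λ w e k h → (w :* e) :* (k :* h) := (k :* w) :* (e :* h)) Z.refl _ _ _ _ ⟩
      ((Z.1# ⊕ ⊝ K) ⋆ W) ⋆ (E Z.1# N ⋆ H 1# N)  ≈⟨ Z.*-cong W-inverse (E-H 1# N) ⟩
      Z.1# ⋆ Z.1#  ≈⟨ Z.*-identityˡ _ ⟩
      Z.1# ∎

    F-unfold : F ≋ Z.1# ⊕ (G ⋆ F)
    F-unfold = Z.trans (solve 2 (λ f g → f := f :* (con (+ 1) :- g) :+ g :* f) Z.refl F G) (Z.+-congʳ F⋆[1-G])

    F-suc : ∀ n → F (suc n) ≈ ∑< (suc n) (λ i → ([ suc i ]ₜ * h (suc i)) * F (n ∸ i))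
    F-suc n = trans (at F-unfold (suc n)) (trans (+-identityˡ _) (trans (+-congʳ (zeroˡ _)) (trans (+-identityˡ _) (⋆-sum (G ∘ suc) F n))))

    ornaments : ∀ n → multisetSeries (necklaces l N n) n ≈ ∑< (suc n) (λ i → (r ^ i * h i) * F (n ∸ i))
    ornaments n = trans (ornaments≈F⋆H n) (trans (⋆-comm F (H r N) n) (trans (⋆-sum (H r N) F n)
      (∑<-cong (suc n) (λ i _ → *-congʳ (H-scale r N i)))))

-- Polynomials with extractable coefficients

module Homogeneous (R : Ring₀) where
  open CommutativeRing R hiding (zero)
  open FiniteSums R
  open PowerSeries R
  open SeriesTools R
  open import Algebra.Properties.Semiring.Exp semiring using (_^_)

  -- The series Σ_d h_d(qs) z^d, by recursion on the list so that the first variable can be split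
  -- off.
  complete : List Carrier → Series
  complete []       = Z.1#
  complete (q ∷ qs) = geometric q 1 ⋆ complete qs

  complete-snoc : ∀ qs q → complete (qs ++ q ∷ []) ≋ complete qs ⋆ geometric q 1
  complete-snoc []       q = Z.*-comm _ _
  complete-snoc (p ∷ qs) q = Z.trans (Z.*-congˡ (complete-snoc qs q)) (Z.sym (Z.*-assoc _ _ _))

  module RZ = CommutativeRing ⟨_⟦z⟧⟩
  module PZ = PowerSeries ⟨_⟦z⟧⟩
  open import Algebra.Properties.Semiring.Exp RZ.semiring using () renaming (_^_ to _^ᶻ_)

  const-cong : ∀ {a b} → a ≈ b → const a ≋ const b
  const-cong p = coeffs λ { zero → p ; (suc n) → refl }

  const-* : ∀ a b → const (a * b) ≋ const a ⋆ const b
  const-* a b = coeffs λ { zero → refl ; (suc n) → sym (trans (const-⋆ a (const b) (suc n)) (zeroʳ a)) }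

  const-+ : ∀ a b → const (a + b) ≋ const a ⊕ const b
  const-+ a b = coeffs λ { zero → refl ; (suc n) → sym (+-identityʳ _) }

  const-^ : ∀ a n → const (a ^ n) ≋ const a ^ᶻ n
  const-^ a zero    = RZ.refl
  const-^ a (suc n) = RZ.trans (const-* a (a ^ n)) (RZ.*-congˡ (const-^ a n))

  const-⋆-const : ∀ (f g : Series) n → const ((f ⋆ g) n) ≋ ((const ∘ f) PZ.⋆ (const ∘ g)) n
  const-⋆-const f g zero    = const-* _ _
  const-⋆-const f g (suc n) = RZ.trans (const-+ _ _) (RZ.+-cong (const-* _ _) (const-⋆-const (f ∘ suc) g n))

  X : Series
  X = monomial 1# 1

  X-⋆-suc : ∀ f n → (X ⋆ f) (suc n) ≈ f n
  X-⋆-suc f n = trans (monomial-⋆ 1# 1 f (suc n)) (*-identityˡ _)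

  X^-⋆ : ∀ p (f : Series) n → (X ^ᶻ p ⋆ f) n ≈ (p ≤ᵇ n) ▸ f (n ∸ p)
  X^-⋆ zero    f n       = at (RZ.*-identityˡ f) n
  X^-⋆ (suc p) f zero    = trans (at (RZ.*-assoc X (X ^ᶻ p) f) 0) (monomial-⋆ 1# 1 (X ^ᶻ p ⋆ f) 0)
  X^-⋆ (suc p) f (suc n) = trans (at (RZ.*-assoc X (X ^ᶻ p) f) (suc n)) (trans (X-⋆-suc (X ^ᶻ p ⋆ f) n)
    (trans (X^-⋆ p f n) (reflexive (≡.cong (_▸ f (n ∸ p)) (≡.sym (≤ᵇ-suc p n))))))

  -- From f = X f - (X - 1) f, coefficient n of f is determined by coefficient n - 1 and by (X - 1)
  -- f. Used with X = t, this is the cancellation of t - 1.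
  X-1-cancel : ∀ a b → (X ⊕ ⊝ Z.1#) ⋆ a ≋ (X ⊕ ⊝ Z.1#) ⋆ b → a ≋ b
  X-1-cancel a b p = coeffs go
    where
    open import Relation.Binary.Reasoning.Setoid setoid
    expand : ∀ f n → f n ≈ (X ⋆ f) n - ((X ⊕ ⊝ Z.1#) ⋆ f) n
    expand f n = at (solve 2 (λ x f → f := x :* f :- (x :- con (+ 1)) :* f) Z.refl X f) n
      where open IntegerSolver ⟨_⟦z⟧⟩ using (solve; _:=_; _:+_; _:*_; :-_; _:-_; con)
    go : ∀ n → a n ≈ b n
    go zero    = trans (expand a 0) (trans (+-cong (trans (monomial-⋆ 1# 1 a 0) (sym (monomial-⋆ 1# 1 b 0))) (-‿cong (at p 0))) (sym (expand b 0)))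
    go (suc n) = trans (expand a (suc n)) (trans (+-cong (trans (X-⋆-suc a n) (trans (go n) (sym (X-⋆-suc b n)))) (-‿cong (at p (suc n)))) (sym (expand b (suc n))))

  torsionFree-lift : TorsionFree → SeriesTools.TorsionFree ⟨_⟦z⟧⟩
  torsionFree-lift tf n f g p = coeffs λ d → tf n (f d) (g d)
    (trans (sym (scale (suc n) f d)) (trans (at p d) (scale (suc n) g d)))
    where
    open import Algebra.Properties.Semiring.Mult RZ.semiring using () renaming (_×_ to _·ᶻ_)
    open import Algebra.Properties.Semiring.Mult semiring using () renaming (_×_ to _·_)
    scale : ∀ n f d → (n ·ᶻ f) d ≈ n · f d
    scale zero    f d = refl
    scale (suc n) f d = +-congˡ (scale n f d)

module CompleteLift (R : Ring₀) where
  open CommutativeRing R hiding (zero)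
  open PowerSeries R
  open Homogeneous R
  open SeriesTools R using (geometric-1)
  open PowerSeries ⟨_⟦z⟧⟩ using () renaming (⋆-cong′ to ⋆ᶻ-cong′)
  module HZ = Homogeneous ⟨_⟦z⟧⟩

  complete-const : ∀ qs n → HZ.complete (map const qs) n ≋ const (complete qs n)
  complete-const []       zero    = RZ.refl
  complete-const []       (suc n) = coeffs λ { zero → refl ; (suc d) → refl }
  complete-const (q ∷ qs) n = RZ.trans
    (⋆ᶻ-cong′ (λ d → RZ.trans (SeriesTools.geometric-1 ⟨_⟦z⟧⟩ (const q) d) (RZ.sym (RZ.trans (const-cong (geometric-1 q d)) (const-^ q d)))) (complete-const qs) n)
    (RZ.sym (const-⋆-const _ (complete qs) n))

-- Power series in several variables and the extraction of their coefficients

MPS : ℕ → Ring₀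
MPS zero    = ℤ.+-*-commutativeRing
MPS (suc n) = PowerSeries.⟨_⟦z⟧⟩ (MPS n)

⟦_⟧ : ℕ → Set
⟦ n ⟧ = CommutativeRing.Carrier (MPS n)

-- Variable 0 is the outermost one, so exponent lists name the variables in order and the leading
-- exponent is extracted first.
variables : ∀ n → ℕ → ⟦ n ⟧
variables zero    i       = + 0
variables (suc n) zero    = Homogeneous.X (MPS n)
variables (suc n) (suc i) = PowerSeries.const (MPS n) (variables n i)

torsionFree : ∀ n → SeriesTools.TorsionFree (MPS n)
torsionFree zero m x y p = ℤ.*-cancelˡ-≡ (+ suc m) x y (≡.trans (≡.sym (scale (suc m) x)) (≡.trans p (scale (suc m) y)))
  where
  open import Algebra.Properties.Semiring.Mult (CommutativeRing.semiring ℤ.+-*-commutativeRing) using () renaming (_×_ to _·_)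
  scale : ∀ m x → m · x ≡ + m ℤ.* x
  scale zero    x = ≡.sym (ℤ.*-zeroˡ x)
  scale (suc m) x = ≡.trans (≡.cong (ℤ._+_ x) (scale m x)) (≡.sym (ℤ.suc-* (+ m) x))
torsionFree (suc n) = Homogeneous.torsionFree-lift (MPS n) (torsionFree n)

-- Lists that are too short give the default 0, and surplus entries are ignored; the equations with
-- `hcoef` and `Qcount` therefore fix the length.
coeff : ∀ n → ⟦ n ⟧ → List ℕ → ℤ
coeff zero    f α       = f
coeff (suc n) f []      = + 0
coeff (suc n) f (k ∷ α) = coeff n (f k) α

module _ where
  open CommutativeRing using (_≈_; 0#; _+_)

  coeff-cong : ∀ n {f g} → _≈_ (MPS n) f g → ∀ α → coeff n f α ≡ coeff n g α
  coeff-cong zero    p α       = p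
  coeff-cong (suc n) p []      = ≡.refl
  coeff-cong (suc n) p (k ∷ α) = coeff-cong n (PowerSeries.at p k) α

  coeff-0 : ∀ n α → coeff n (0# (MPS n)) α ≡ + 0
  coeff-0 zero    α       = ≡.refl
  coeff-0 (suc n) []      = ≡.refl
  coeff-0 (suc n) (k ∷ α) = coeff-0 n α

  coeff-+ : ∀ n f g α → coeff n (_+_ (MPS n) f g) α ≡ coeff n f α ℤ.+ coeff n g α
  coeff-+ zero    f g α       = ≡.refl
  coeff-+ (suc n) f g []      = ≡.refl
  coeff-+ (suc n) f g (k ∷ α) = coeff-+ n (f k) (g k) α

module ℤΣ = FiniteSums ℤ.+-*-commutativeRing
open ℤΣ using () renaming (_▸_ to _▸ᶻ_)

coeff-▸ : ∀ n b f α → coeff n (FiniteSums._▸_ (MPS n) b f) α ≡ b ▸ᶻ coeff n f α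
coeff-▸ n true  f α = ≡.refl
coeff-▸ n false f α = coeff-0 n α

coeff-∑ : ∀ n {A : Set} (xs : List A) (f : A → ⟦ n ⟧) α → coeff n (FiniteSums.∑ (MPS n) xs f) α ≡ ℤΣ.∑ xs (λ x → coeff n (f x) α)
coeff-∑ n []       f α = coeff-0 n α
coeff-∑ n (x ∷ xs) f α = ≡.trans (coeff-+ n (f x) _ α) (≡.cong (ℤ._+_ (coeff n (f x) α)) (coeff-∑ n xs f α))

coeff-∑< : ∀ n k (f : ℕ → ⟦ n ⟧) α → coeff n (FiniteSums.∑< (MPS n) k f) α ≡ ℤΣ.∑< k (λ i → coeff n (f i) α)
coeff-∑< n zero    f α = ≡.trans (coeff-cong n (FiniteSums.∑<-empty (MPS n) f) α) (≡.trans (coeff-0 n α) (≡.sym (ℤΣ.∑<-empty _)))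
coeff-∑< n (suc k) f α = ≡.trans (coeff-cong n (FiniteSums.∑<-suc (MPS n) k f) α) (≡.trans (coeff-+ n (f 0) _ α)
  (≡.trans (≡.cong (ℤ._+_ (coeff n (f 0) α)) (coeff-∑< n k (f ∘ suc) α)) (≡.sym (ℤΣ.∑<-suc k _))))

-- Exponent vectors are functions ℕ → ℕ of which only the first n values matter.
match : ℕ → (ℕ → ℕ) → List ℕ → Bool
match zero    β α       = true
match (suc n) β []      = false
match (suc n) β (k ∷ α) = (β 0 ≡ᵇ k) ∧ match n (β ∘ suc) α

-- The flag b makes the predicate stable under taking coefficients in the leading variable.
IsMonomial : Bool → ∀ n → (ℕ → ℕ) → ⟦ n ⟧ → Set
IsMonomial b n β f = ∀ α → coeff n f α ≡ (b ∧ match n β α) ▸ᶻ + 1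

match-cong : ∀ n {β β′} → (∀ i → i < n → β i ≡ β′ i) → ∀ α → match n β α ≡ match n β′ α
match-cong zero    p α       = ≡.refl
match-cong (suc n) p []      = ≡.refl
match-cong (suc n) p (k ∷ α) = ≡.cong₂ _∧_ (≡.cong (_≡ᵇ k) (p 0 (s≤s z≤n))) (match-cong n (λ i i<n → p (suc i) (s≤s i<n)) α)

isMonomial-cong : ∀ {b} n {β β′ f g} → (∀ i → i < n → β i ≡ β′ i) → CommutativeRing._≈_ (MPS n) f g →
  IsMonomial b n β f → IsMonomial b n β′ g
isMonomial-cong {b} n {β} {β′} p q m α = ≡.trans (≡.sym (coeff-cong n q α))
  (≡.trans (m α) (≡.cong (λ c → (b ∧ c) ▸ᶻ + 1) (match-cong n p α)))

1-isMonomial : ∀ n → IsMonomial true n (λ _ → 0) (CommutativeRing.1# (MPS n))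
1-isMonomial zero    α           = ≡.refl
1-isMonomial (suc n) []          = ≡.refl
1-isMonomial (suc n) (zero ∷ α)  = 1-isMonomial n α
1-isMonomial (suc n) (suc k ∷ α) = coeff-0 n α

bump : ℕ → (ℕ → ℕ) → ℕ → ℕ
bump zero    β zero    = suc (β 0)
bump zero    β (suc k) = β (suc k)
bump (suc i) β zero    = β 0
bump (suc i) β (suc k) = bump i (β ∘ suc) k

variable-isMonomial : ∀ n i {b β f} → i < n → IsMonomial b n β f →
  IsMonomial b n (bump i β) (CommutativeRing._*_ (MPS n) (variables n i) f)
variable-isMonomial (suc n) i       {b} {β} {f} i<n m []          = m []
variable-isMonomial (suc n) zero    {b} {β} {f} i<n m (zero ∷ α)  =
  ≡.trans (coeff-cong n (SeriesTools.monomial-⋆ (MPS n) (CommutativeRing.1# (MPS n)) 1 f 0) α) (≡.trans (coeff-0 n α) (≡.sym (flag b)))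
  where
  flag : ∀ b → (b ∧ false) ▸ᶻ + 1 ≡ + 0
  flag true  = ≡.refl
  flag false = ≡.refl
variable-isMonomial (suc n) zero    {b} {β} {f} i<n m (suc k ∷ α) =
  ≡.trans (coeff-cong n (Homogeneous.X-⋆-suc (MPS n) f k) α) (m (k ∷ α))
variable-isMonomial (suc n) (suc i) {b} {β} {f} (s≤s i<n) m (k ∷ α) =
  ≡.trans (coeff-cong n (PowerSeries.const-⋆ (MPS n) (variables n i) f k) α)
    (≡.trans (variable-isMonomial n i {b ∧ (β 0 ≡ᵇ k)} {β ∘ suc} {f k} i<n
        (λ α → ≡.trans (m (k ∷ α)) (≡.cong (_▸ᶻ + 1) (≡.sym (∧-assoc b _ _)))) α)
      (≡.cong (_▸ᶻ + 1) (∧-assoc b _ _)))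

words-All : ∀ {Q : Letter → Set} {A} n → All Q A → All (All Q) (words A n)
words-All zero    p = [] ∷ []
words-All {Q} {A} (suc n) p = All.concat⁺ (All.map⁺ (All.map (λ q → All.map⁺ (All.map (q ∷_) (words-All n p))) p))

multisets-All : ∀ {P : Word → Set} ws n → All P ws → All (All P) (multisets ws n)
multisets-All []       zero    p       = [] ∷ []
multisets-All []       (suc n) p       = []
multisets-All (w ∷ ws) n       (p ∷ ps) = All.concat⁺ (All.map⁺ (All.universal
  (λ c → All.map⁺ (All.map (All.++⁺ (All.replicate⁺ c p)) (multisets-All ws (n ∸ c ℕ.* length w) ps)))
  (filterB (λ c → c ℕ.* length w ≤ᵇ n) (upTo (suc n)))))

module Extraction (N l′ : ℕ) where
  S : Ring₀
  S = MPS (2 ℕ.+ N)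
  open CommutativeRing S hiding (zero)
  open import Algebra.Properties.Semiring.Exp semiring using (_^_)

  t r : Carrier
  t = variables (2 ℕ.+ N) 0
  r = variables (2 ℕ.+ N) 1

  x : ℕ → Carrier
  x u = variables (2 ℕ.+ N) (2 ℕ.+ u)

  open Ornaments S N l′ x t r using (l; A; wtL; W; wtW)
  open SeriesTools S using (module Multisets)
  open Multisets W using (weight)

  -- in the order t, r, x₀, x₁, …
  exponents : List Letter → ℕ → ℕ → ℕ
  exponents w j zero          = sum (map (kL l) w)
  exponents w j (suc zero)    = j
  exponents w j (suc (suc u)) = countB (λ a → absL a ≡ᵇ u) w

  Monomial : List Letter → ℕ → Carrier → Set
  Monomial w j f = IsMonomial true (2 ℕ.+ N) (exponents w j) f

  t^-monomial : ∀ m {β f} → IsMonomial true (2 ℕ.+ N) β f →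
    IsMonomial true (2 ℕ.+ N) (λ { zero → m ℕ.+ β 0 ; (suc i) → β (suc i) }) (t ^ m * f)
  t^-monomial zero    p = isMonomial-cong (2 ℕ.+ N) (λ { zero _ → ≡.refl ; (suc i) _ → ≡.refl }) (sym (*-identityˡ _)) p
  t^-monomial (suc m) p = isMonomial-cong (2 ℕ.+ N) (λ { zero _ → ≡.refl ; (suc i) _ → ≡.refl }) (sym (*-assoc _ _ _))
    (variable-isMonomial (2 ℕ.+ N) 0 (s≤s z≤n) (t^-monomial m p))

  bump-count : ∀ v (c : ℕ → ℕ) u → bump v c u ≡ (if v ≡ᵇ u then suc (c u) else c u)
  bump-count zero    c zero    = ≡.refl
  bump-count zero    c (suc u) = ≡.refl
  bump-count (suc v) c zero    = ≡.refl
  bump-count (suc v) c (suc u) = bump-count v (c ∘ suc) u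

  countB-∷ : ∀ {A : Set} (p : A → Bool) a w → countB p (a ∷ w) ≡ (if p a then suc (countB p w) else countB p w)
  countB-∷ p a w with p a
  ... | true  = ≡.refl
  ... | false = ≡.refl

  letter-monomial : ∀ a w j {f} → absL a < N → Monomial w j f → Monomial (a ∷ w) j (wtL a * f)
  letter-monomial (unb v m) w j v<N p = isMonomial-cong (2 ℕ.+ N)
    (λ { zero _ → ≡.refl ; (suc zero) _ → ≡.refl ; (suc (suc u)) _ → ≡.trans (bump-count v _ u) (≡.sym (countB-∷ (λ a → absL a ≡ᵇ u) (unb v m) w)) }) (sym (*-assoc _ _ _))
    (variable-isMonomial (2 ℕ.+ N) (2 ℕ.+ v) (s≤s (s≤s v<N)) (t^-monomial m p))
  letter-monomial (bar v) w j v<N p = isMonomial-cong (2 ℕ.+ N)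
    (λ { zero _ → ≡.refl ; (suc zero) _ → ≡.refl ; (suc (suc u)) _ → ≡.trans (bump-count v _ u) (≡.sym (countB-∷ (λ a → absL a ≡ᵇ u) (bar v) w)) }) (sym (*-assoc _ _ _))
    (variable-isMonomial (2 ℕ.+ N) (2 ℕ.+ v) (s≤s (s≤s v<N)) (t^-monomial l p))

  word-monomial : ∀ v w j {f} → All (λ a → absL a < N) v → Monomial w j f → Monomial (v ++ w) j (wtW v * f)
  word-monomial []      w j []        p = isMonomial-cong (2 ℕ.+ N) (λ _ _ → ≡.refl) (sym (*-identityˡ _)) p
  word-monomial (a ∷ v) w j (q ∷ qs) p = isMonomial-cong (2 ℕ.+ N) (λ _ _ → ≡.refl) (sym (*-assoc _ _ _))
    (letter-monomial a (v ++ w) j q (word-monomial v w j qs p))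

  necklace-monomial : ∀ v w j {f} → All (λ a → absL a < N) v → Monomial w j f →
    Monomial (v ++ w) (if isZeroSingle v then suc j else j) (W v * f)
  necklace-monomial v w j q p with isZeroSingle v
  ... | false = word-monomial v w j q p
  ... | true  = isMonomial-cong (2 ℕ.+ N) (λ { zero _ → ≡.refl ; (suc zero) _ → ≡.refl ; (suc (suc u)) _ → ≡.refl }) (sym (*-assoc _ _ _))
    (variable-isMonomial (2 ℕ.+ N) 1 (s≤s (s≤s z≤n)) (word-monomial v w j q p))

  weight-monomial : ∀ R → All (All (λ a → absL a < N)) R → Monomial (concat R) (jstat R) (weight R)
  weight-monomial []      []       = isMonomial-cong (2 ℕ.+ N) (λ { zero _ → ≡.refl ; (suc zero) _ → ≡.refl ; (suc (suc u)) _ → ≡.refl }) refl (1-isMonomial (2 ℕ.+ N))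
  weight-monomial (v ∷ R) (q ∷ qs) = ≡.subst (λ j → Monomial (v ++ concat R) j (W v * weight R))
    (≡.sym (countB-∷ isZeroSingle v R)) (necklace-monomial v (concat R) (jstat R) q (weight-monomial R qs))

  match-content : ∀ n (c : ℕ → ℕ) α → length α ≡ n → match n c α ≡ eqNL (applyUpTo c n) α
  match-content zero    c []      _   = ≡.refl
  match-content (suc n) c (a ∷ α) len = ≡.cong ((c 0 ≡ᵇ a) ∧_) (match-content n (c ∘ suc) α (ℕ.suc-injective len))

  -- The weight of an ornament is one monomial with coefficient 1, whose exponents are its
  -- statistics k and j and its content. A coefficient of the sum therefore counts ornaments.
  coeff-multisets : ∀ n k j α → length α ≡ N →
    coeff (2 ℕ.+ N) (FiniteSums.∑ S (multisets (necklaces l N n) n) weight) (k ∷ j ∷ α) ≡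
    + countB (λ R → eqNL (content N R) α ∧ (kstat l R ≡ᵇ k) ∧ (jstat R ≡ᵇ j)) (multisets (necklaces l N n) n)
  coeff-multisets n k j α len = ≡.trans (coeff-∑ (2 ℕ.+ N) (multisets (necklaces l N n) n) weight (k ∷ j ∷ α))
    (count (multisets (necklaces l N n) n) (multisets-All (necklaces l N n) n letters))
    where
    letters : All (All (λ a → absL a < N)) (necklaces l N n)
    letters = All.concat⁺ (All.map⁺ (All.universal
      (λ m → filterB-All (isNecklace l) (words-All (suc m) (All.map proj₁ (alphabet-letters l N)))) (upTo n)))
    test : List Word → Bool
    test R = eqNL (content N R) α ∧ (kstat l R ≡ᵇ k) ∧ (jstat R ≡ᵇ j)
    reorder : ∀ R → match (2 ℕ.+ N) (exponents (concat R) (jstat R)) (k ∷ j ∷ α) ≡ test R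
    reorder R = ≡.trans (≡.trans (≡.sym (∧-assoc (kstat l R ≡ᵇ k) (jstat R ≡ᵇ j) _)) (∧-comm ((kstat l R ≡ᵇ k) ∧ (jstat R ≡ᵇ j)) _))
      (≡.cong (_∧ ((kstat l R ≡ᵇ k) ∧ (jstat R ≡ᵇ j))) (≡.trans (match-content N _ α len)
        (≡.cong (λ c → eqNL c α) (≡.sym (map-applyUpTo (λ i → countB (λ a → absL a ≡ᵇ i) (concat R)) (λ i → i) N)))))
    count : ∀ Rs → All (All (All (λ a → absL a < N))) Rs → ℤΣ.∑ Rs (λ R → coeff (2 ℕ.+ N) (weight R) (k ∷ j ∷ α)) ≡ + countB test Rs
    count []       []       = ≡.refl
    count (R ∷ Rs) (q ∷ qs) = ≡.trans (≡.cong₂ ℤ._+_ (≡.trans (weight-monomial R q (k ∷ j ∷ α)) (≡.cong (_▸ᶻ + 1) (reorder R))) (count Rs qs))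
      (≡.sym (≡.trans (≡.cong +_ (countB-∷ test R Rs)) (split (test R))))
      where
      split : ∀ b → + (if b then suc (countB test Rs) else countB test Rs) ≡ (b ▸ᶻ + 1) ℤ.+ + countB test Rs
      split true  = ≡.refl
      split false = ≡.refl

-- Complete homogeneous products

hom : ∀ N → ℕ → ⟦ N ⟧
hom N = Homogeneous.complete (MPS N) (applyUpTo (variables N) N)

module _ (N : ℕ) where
  open CommutativeRing (MPS N) hiding (zero)
  open FiniteSums (MPS N)
  open PowerSeries (MPS N)
  open SeriesTools (MPS N)
  open Homogeneous (MPS N)
  open CompleteLift (MPS N)
  open import Algebra.Properties.Semiring.Exp RZ.semiring using () renaming (_^_ to _^ᶻ_)

  -- Expanding the geometric factor of the first variable gives h_p(x₀, x₁, ...) = Σ_i x₀^i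
  -- h_{p-i}(x₁, ...); the coefficient of x₀^a is taken.
  hom-suc : ∀ p a → hom (suc N) p a ≈ (a ≤ᵇ p) ▸ hom N (p ∸ a)
  hom-suc p a = trans (at expand a) (trans (∑<-at (suc p) (λ i → X ^ᶻ i ⋆ const (hom N (p ∸ i))) a)
    (trans (∑<-cong (suc p) (λ i _ → X^-⋆ i (const (hom N (p ∸ i))) a)) pick))
    where
    qs = map const (applyUpTo (variables N) N)
    expand : hom (suc N) p ≋ FZ.∑< (suc p) (λ i → X ^ᶻ i ⋆ const (hom N (p ∸ i)))
    expand = RZ.trans (RZ.reflexive (≡.cong (λ vs → HZ.complete (X ∷ vs) p) (≡.sym (map-applyUpTo const (variables N) N))))
      (RZ.trans (SeriesTools.⋆-sum ⟨_⟦z⟧⟩ (SeriesTools.geometric ⟨_⟦z⟧⟩ X 1) (HZ.complete qs) p)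
        (FZ.∑<-cong (suc p) (λ i _ → RZ.*-cong (SeriesTools.geometric-1 ⟨_⟦z⟧⟩ X i) (complete-const (applyUpTo (variables N) N) (p ∸ i)))))
    off : ∀ i → i ≢ a → (i ≤ᵇ a) ▸ const (hom N (p ∸ i)) (a ∸ i) ≈ 0#
    off i i≢a with i ℕ.≤? a
    ... | no i≰a = reflexive (≡.cong (_▸ const (hom N (p ∸ i)) (a ∸ i)) (≤ᵇ-false i≰a))
    ... | yes i≤a with a ∸ i in eq
    ...   | zero  = ⊥-elim (i≢a (ℕ.≤-antisym i≤a (ℕ.m∸n≡0⇒m≤n eq)))
    ...   | suc d = ▸-0 (i ≤ᵇ a)
    pick : ∑< (suc p) (λ i → (i ≤ᵇ a) ▸ const (hom N (p ∸ i)) (a ∸ i)) ≈ (a ≤ᵇ p) ▸ hom N (p ∸ a)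
    pick with a ℕ.≤? p
    ... | no a≰p = trans (∑<-zero (suc p) (λ { i (s≤s i≤p) → off i λ { ≡.refl → a≰p i≤p } }))
      (reflexive (≡.cong (_▸ hom N (p ∸ a)) (≡.sym (≤ᵇ-false a≰p))))
    ... | yes a≤p = trans (∑<-single (suc p) a (s≤s a≤p) off)
      (trans (reflexive (≡.cong₂ (λ b d → b ▸ const (hom N (p ∸ a)) d) (≤ᵇ-true (ℕ.≤-refl {a})) (ℕ.n∸n≡0 a)))
        (reflexive (≡.cong (_▸ hom N (p ∸ a)) (≡.sym (≤ᵇ-true a≤p)))))

-- Both sums run over b ≤ min (a, p), and both are cut out of the sum over b ≤ a + p.
∑<-exchange : ∀ a p (f : ℕ → ℤ) → ℤΣ.∑< (suc a) (λ b → (b ≤ᵇ p) ▸ᶻ f b) ≡ ℤΣ.∑< (suc p) (λ b → (b ≤ᵇ a) ▸ᶻ f b)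
∑<-exchange a p f = ≡.trans (≡.sym (left a p)) (≡.trans (≡.trans
    (ℤΣ.∑<-cong (suc (a ℕ.+ p)) (λ b _ → ℤΣ.▸-swap (b ≤ᵇ a) (b ≤ᵇ p) (f b)))
    (≡.cong (λ n → ℤΣ.∑< (suc n) (λ b → (b ≤ᵇ p) ▸ᶻ (b ≤ᵇ a) ▸ᶻ f b)) (ℕ.+-comm a p))) (left p a))
  where
  left : ∀ a p → ℤΣ.∑< (suc (a ℕ.+ p)) (λ b → (b ≤ᵇ a) ▸ᶻ (b ≤ᵇ p) ▸ᶻ f b) ≡ ℤΣ.∑< (suc a) (λ b → (b ≤ᵇ p) ▸ᶻ f b)
  left a p = ≡.trans (SeriesTools.∑<-extend ℤ.+-*-commutativeRing (suc a) (suc (a ℕ.+ p)) (s≤s (ℕ.m≤m+n a p))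
      (λ b a<b → ≡.cong (_▸ᶻ ((b ≤ᵇ p) ▸ᶻ f b)) (≤ᵇ-false (ℕ.<⇒≱ a<b))))
    (ℤΣ.∑<-cong (suc a) (λ { b (s≤s b≤a) → ≡.cong (_▸ᶻ ((b ≤ᵇ p) ▸ᶻ f b)) (≤ᵇ-true b≤a) }))

-- h_p is the sum of all monomials of degree p, which `vecs` enumerates, and multiplication by a
-- monomial shifts exponents. The right-hand side mirrors the recursion of `hcoef`; the Cauchy
-- product bounds the first exponent by a and `vecs` by p, hence the exchange.
coeff-hom-* : ∀ N p g α → length α ≡ N → coeff N (CommutativeRing._*_ (MPS N) (hom N p) g) α ≡
  ℤΣ.∑ (vecs N p) (λ β → leqPW β α ▸ᶻ coeff N g (zipWith _∸_ α β))
coeff-hom-* zero    zero    g []       _   = ≡.trans (ℤ.*-identityˡ g) (≡.sym (ℤ.+-identityʳ g))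
coeff-hom-* zero    (suc p) g []       _   = ℤ.*-zeroˡ g
coeff-hom-* (suc N) p       g (a ∷ α)  len = begin
  coeff N ((hom (suc N) p ⋆ g) a) α
    ≡⟨ coeff-cong N (⋆-sum (hom (suc N) p) g a) α ⟩
  coeff N (∑< (suc a) (λ b → hom (suc N) p b * g (a ∸ b))) α
    ≡⟨ coeff-∑< N (suc a) _ α ⟩
  ℤΣ.∑< (suc a) (λ b → coeff N (hom (suc N) p b * g (a ∸ b)) α)
    ≡⟨ ℤΣ.∑<-cong (suc a) (λ b _ → term b) ⟩
  ℤΣ.∑< (suc a) (λ b → (b ≤ᵇ p) ▸ᶻ Φ b)
    ≡⟨ ∑<-exchange a p Φ ⟩
  ℤΣ.∑< (suc p) (λ b → (b ≤ᵇ a) ▸ᶻ Φ b)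
    ≡⟨ ℤΣ.∑<-cong (suc p) (λ b _ → regroup b) ⟩
  ℤΣ.∑< (suc p) (λ b → ℤΣ.∑ (map (b ∷_) (vecs N (p ∸ b))) rhs)
    ≡⟨ ℤΣ.∑-upTo (suc p) _ ⟨
  ℤΣ.∑ (upTo (suc p)) (λ b → ℤΣ.∑ (map (b ∷_) (vecs N (p ∸ b))) rhs)
    ≡⟨ ℤΣ.∑-concatMap (λ b → map (b ∷_) (vecs N (p ∸ b))) (upTo (suc p)) rhs ⟨
  ℤΣ.∑ (vecs (suc N) p) rhs ∎
  where
  open ≡.≡-Reasoning
  open CommutativeRing (MPS N) using (_*_)
  open FiniteSums (MPS N) using (∑<)
  open PowerSeries (MPS N) using (_⋆_)
  open SeriesTools (MPS N) using (⋆-sum)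
  rhs : List ℕ → ℤ
  rhs β = leqPW β (a ∷ α) ▸ᶻ coeff (suc N) g (zipWith _∸_ (a ∷ α) β)
  Φ : ℕ → ℤ
  Φ b = ℤΣ.∑ (vecs N (p ∸ b)) (λ β → leqPW β α ▸ᶻ coeff N (g (a ∸ b)) (zipWith _∸_ α β))
  term : ∀ b → coeff N (hom (suc N) p b * g (a ∸ b)) α ≡ (b ≤ᵇ p) ▸ᶻ Φ b
  term b = ≡.trans (coeff-cong N (R.trans (R.*-congʳ (hom-suc N p b)) (FiniteSums.▸-*ʳ (MPS N) (b ≤ᵇ p) (g (a ∸ b)) (hom N (p ∸ b)))) α)
    (≡.trans (coeff-▸ N (b ≤ᵇ p) _ α) (ℤΣ.▸-cong (b ≤ᵇ p) (coeff-hom-* N (p ∸ b) (g (a ∸ b)) α (ℕ.suc-injective len))))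
    where module R = CommutativeRing (MPS N)
  regroup : ∀ b → (b ≤ᵇ a) ▸ᶻ Φ b ≡ ℤΣ.∑ (map (b ∷_) (vecs N (p ∸ b))) rhs
  regroup b = ≡.trans (ℤΣ.∑-▸ (vecs N (p ∸ b)) (b ≤ᵇ a) _) (≡.trans
    (ℤΣ.∑-cong (vecs N (p ∸ b)) (λ β → ≡.sym (ℤΣ.▸-∧ (b ≤ᵇ a) (leqPW β α) _)))
    (≡.sym (ℤΣ.∑-map (b ∷_) (vecs N (p ∸ b)) rhs)))

hprod : ∀ N → List ℕ → ⟦ N ⟧
hprod N []       = CommutativeRing.1# (MPS N)
hprod N (p ∷ ps) = CommutativeRing._*_ (MPS N) (hom N p) (hprod N ps)

pos-sum : ∀ {A : Set} (xs : List A) (f : A → ℕ) → + sum (map f xs) ≡ ℤΣ.∑ xs (λ x → + f x)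
pos-sum []       f = ≡.refl
pos-sum (x ∷ xs) f = ≡.trans (ℤ.pos-+ (f x) _) (≡.cong (ℤ._+_ (+ f x)) (pos-sum xs f))

pos-▸ : ∀ b n → + (if b then n else 0) ≡ b ▸ᶻ + n
pos-▸ true  n = ≡.refl
pos-▸ false n = ≡.refl

leqPW-length : ∀ β α → leqPW β α ≡ true → length (zipWith _∸_ α β) ≡ length α
leqPW-length []      []      _ = ≡.refl
leqPW-length (b ∷ β) (a ∷ α) p = ≡.cong suc (leqPW-length β α (proj₂ (∧-true {b ≤ᵇ a} p)))

coeff-hprod : ∀ N ps α → length α ≡ N → coeff N (hprod N ps) α ≡ + hcoef ps α
coeff-hprod N []       α len = unit N α len
  where
  unit : ∀ N α → length α ≡ N → coeff N (CommutativeRing.1# (MPS N)) α ≡ + (if allB (λ a → a ≡ᵇ 0) α then 1 else 0)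
  unit zero    []          _   = ≡.refl
  unit (suc N) (zero ∷ α)  len = unit N α (ℕ.suc-injective len)
  unit (suc N) (suc a ∷ α) len = coeff-0 N α
coeff-hprod N (p ∷ ps) α ≡.refl = ≡.trans (coeff-hom-* N p (hprod N ps) α ≡.refl) (≡.trans
  (ℤΣ.∑-cong (vecs N p) (λ β → ≡.trans (ℤΣ.▸-congᵇ {leqPW β α} (λ q → coeff-hprod N ps (zipWith _∸_ α β) (leqPW-length β α q)))
    (≡.sym (pos-▸ (leqPW β α) _))))
  (≡.sym (pos-sum (vecs N p) _)))

-- Products of symmetric intervals of powers of t

module QSums (R : Ring₀) (t : CommutativeRing.Carrier R) where
  open CommutativeRing R hiding (zero)
  open FiniteSums R
  open import Algebra.Properties.Semiring.Exp semiring using (_^_; ^-homo-*)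
  open import Relation.Binary.Reasoning.Setoid setoid
  open IntegerSolver R using (solve; _:=_; _:+_; _:*_; con)

  bracket : ℕ → Carrier
  bracket n = ∑< n (λ i → t ^ i)

  bracket-suc : ∀ n → bracket (suc n) ≈ 1# + t * bracket n
  bracket-suc n = trans (∑<-suc n _) (+-congˡ (sym (∑<-*ˡ n t _)))

  bracket-+ : ∀ m n → bracket (m ℕ.+ n) ≈ bracket m + t ^ m * bracket n
  bracket-+ zero    n = sym (trans (+-cong (∑<-empty _) (*-identityˡ _)) (+-identityˡ _))
  bracket-+ (suc m) n = begin
    bracket (suc m ℕ.+ n)  ≈⟨ bracket-suc (m ℕ.+ n) ⟩
    1# + t * bracket (m ℕ.+ n)  ≈⟨ +-congˡ (*-congˡ (bracket-+ m n)) ⟩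
    1# + t * (bracket m + t ^ m * bracket n)  ≈⟨ solve 4 (λ t b p c → con (+ 1) :+ t :* (b :+ p :* c) := (con (+ 1) :+ t :* b) :+ (t :* p) :* c) refl t _ _ _ ⟩
    (1# + t * bracket m) + t ^ suc m * bracket n  ≈⟨ +-congʳ (bracket-suc m) ⟨
    bracket (suc m) + t ^ suc m * bracket n     ∎

  -- The Clebsch-Gordan rule. The p × q rectangle of exponents is a union of nested hooks; the e-th
  -- starts at t^e and has p + q - 1 - 2e cells with consecutive exponents. The induction peels off
  -- the outermost hook.
  bracket-* : ∀ p q → bracket p * bracket q ≈ ∑< (p ⊓ q) (λ e → t ^ e * bracket (p ℕ.+ q ∸ suc (e ℕ.+ e)))
  bracket-* zero    q       = trans (*-congʳ (∑<-empty _)) (trans (zeroˡ _) (sym (∑<-empty _)))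
  bracket-* (suc p) zero    = trans (*-congˡ (∑<-empty _)) (trans (zeroʳ _) (sym (∑<-empty _)))
  bracket-* (suc p) (suc q) = begin
    bracket (suc p) * bracket (suc q)
      ≈⟨ *-cong (bracket-suc p) (bracket-suc q) ⟩
    (1# + t * bracket p) * (1# + t * bracket q)
      ≈⟨ solve 3 (λ t a b → (con (+ 1) :+ t :* a) :* (con (+ 1) :+ t :* b) := (con (+ 1) :+ t :* b) :+ t :* (a :* (con (+ 1) :+ t :* b))) refl t (bracket p) (bracket q) ⟩
    (1# + t * bracket q) + t * (bracket p * (1# + t * bracket q))
      ≈⟨ +-cong (bracket-suc q) (*-congˡ (*-congˡ (bracket-suc q))) ⟨
    bracket (suc q) + t * (bracket p * bracket (suc q))
      ≈⟨ +-congˡ (*-congˡ (*-congˡ last)) ⟩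
    bracket (suc q) + t * (bracket p * (bracket q + t ^ q))
      ≈⟨ solve 5 (λ c t p q r → c :+ t :* (p :* (q :+ r)) := (c :+ (t :* r) :* p) :+ t :* (p :* q)) refl (bracket (suc q)) t (bracket p) (bracket q) (t ^ q) ⟩
    (bracket (suc q) + t ^ suc q * bracket p) + t * (bracket p * bracket q)
      ≈⟨ +-cong (bracket-+ (suc q) p) (*-congˡ (sym (bracket-* p q))) ⟨
    bracket (suc q ℕ.+ p) + t * ∑< (p ⊓ q) (λ e → t ^ e * bracket (p ℕ.+ q ∸ suc (e ℕ.+ e)))
      ≈⟨ +-cong (trans (reflexive (≡.cong bracket (≡.trans (ℕ.+-comm (suc q) p) ≡.refl))) (sym (*-identityˡ _)))
           (trans (∑<-*ˡ (p ⊓ q) t _) (∑<-cong (p ⊓ q) (λ e _ → trans (sym (*-assoc _ _ _))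
             (*-congˡ (reflexive (≡.cong bracket (index e))))))) ⟩
    1# * bracket (p ℕ.+ suc q) + ∑< (p ⊓ q) (λ e → t ^ suc e * bracket (p ℕ.+ suc q ∸ (suc e ℕ.+ suc e)))
      ≈⟨ ∑<-suc (p ⊓ q) _ ⟨
    ∑< (suc p ⊓ suc q) (λ e → t ^ e * bracket (suc p ℕ.+ suc q ∸ suc (e ℕ.+ e))) ∎
    where
    last : bracket (suc q) ≈ bracket q + t ^ q
    last = ∑<-last q _
    index : ∀ e → p ℕ.+ q ∸ suc (e ℕ.+ e) ≡ p ℕ.+ suc q ∸ (suc e ℕ.+ suc e)
    index e rewrite ℕ.+-suc p q | ℕ.+-suc e e = ≡.refl

  -- t^s + … + t^{c-s}, of centre c/2.
  interval : ℕ → ℕ → Carrier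
  interval s c = t ^ s * bracket (suc c ∸ (s ℕ.+ s))

  interval-* : ∀ s c s′ c′ → interval s c * interval s′ c′ ≈
    ∑< ((suc c ∸ (s ℕ.+ s)) ⊓ (suc c′ ∸ (s′ ℕ.+ s′))) (λ e → interval (s ℕ.+ s′ ℕ.+ e) (c ℕ.+ c′))
  interval-* s c s′ c′ = begin
    (t ^ s * bracket p) * (t ^ s′ * bracket q)
      ≈⟨ solve 4 (λ a b c d → (a :* b) :* (c :* d) := (a :* c) :* (b :* d)) refl _ _ _ _ ⟩
    (t ^ s * t ^ s′) * (bracket p * bracket q)
      ≈⟨ *-cong (sym (^-homo-* t s s′)) (bracket-* p q) ⟩
    t ^ (s ℕ.+ s′) * ∑< (p ⊓ q) (λ e → t ^ e * bracket (p ℕ.+ q ∸ suc (e ℕ.+ e)))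
      ≈⟨ ∑<-*ˡ (p ⊓ q) _ _ ⟩
    ∑< (p ⊓ q) (λ e → t ^ (s ℕ.+ s′) * (t ^ e * bracket (p ℕ.+ q ∸ suc (e ℕ.+ e))))
      ≈⟨ ∑<-cong (p ⊓ q) (λ e e< → trans (sym (*-assoc _ _ _)) (*-cong (sym (^-homo-* t (s ℕ.+ s′) e))
           (reflexive (≡.cong bracket (index e e<))))) ⟩
    ∑< (p ⊓ q) (λ e → interval (s ℕ.+ s′ ℕ.+ e) (c ℕ.+ c′)) ∎
    where
    p = suc c ∸ (s ℕ.+ s)
    q = suc c′ ∸ (s′ ℕ.+ s′)
    undo : ∀ m n → 0 < m ∸ n → m ∸ n ℕ.+ n ≡ m
    undo m n pos = ℕ.m∸n+n≡m {m} {n} (ℕ.<⇒≤ (ℕ.m∸n≢0⇒n<m {m} {n} (ℕ.>⇒≢ pos)))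
    -- For e below the minimum neither interval is empty, which makes the truncated subtractions
    -- exact.
    index : ∀ e → e < p ⊓ q → p ℕ.+ q ∸ suc (e ℕ.+ e) ≡ suc (c ℕ.+ c′) ∸ ((s ℕ.+ s′ ℕ.+ e) ℕ.+ (s ℕ.+ s′ ℕ.+ e))
    index e e< = ≡.sym (≡.trans (≡.cong₂ _∸_ total (shape s s′ e))
        (≡.trans (ℕ.[m+n]∸[m+o]≡n∸o ((s ℕ.+ s) ℕ.+ (s′ ℕ.+ s′)) (p ℕ.+ q ∸ 1) (e ℕ.+ e)) (ℕ.∸-+-assoc (p ℕ.+ q) 1 (e ℕ.+ e))))
      where
      p>0 : 0 < p
      p>0 = ℕ.≤-trans (s≤s z≤n) (ℕ.≤-trans e< (ℕ.m⊓n≤m p q))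
      q>0 : 0 < q
      q>0 = ℕ.≤-trans (s≤s z≤n) (ℕ.≤-trans e< (ℕ.m⊓n≤n p q))
      rearrange : ∀ p q s s′ → (p ℕ.+ s) ℕ.+ (q ℕ.+ s′) ≡ (s ℕ.+ s′) ℕ.+ (p ℕ.+ q)
      rearrange = solve-∀
      shape : ∀ s s′ e → (s ℕ.+ s′ ℕ.+ e) ℕ.+ (s ℕ.+ s′ ℕ.+ e) ≡ ((s ℕ.+ s) ℕ.+ (s′ ℕ.+ s′)) ℕ.+ (e ℕ.+ e)
      shape = solve-∀
      total : suc (c ℕ.+ c′) ≡ ((s ℕ.+ s) ℕ.+ (s′ ℕ.+ s′)) ℕ.+ (p ℕ.+ q ∸ 1)
      total = ℕ.suc-injective (≡.trans (≡.cong suc (≡.sym (ℕ.+-suc c c′)))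
        (≡.trans (≡.cong₂ ℕ._+_ (≡.sym (undo (suc c) (s ℕ.+ s) p>0)) (≡.sym (undo (suc c′) (s′ ℕ.+ s′) q>0)))
        (≡.trans (rearrange p q (s ℕ.+ s) (s′ ℕ.+ s′))
        (≡.trans (≡.cong (((s ℕ.+ s) ℕ.+ (s′ ℕ.+ s′)) ℕ.+_) (≡.sym (ℕ.m+[n∸m]≡n {1} (ℕ.≤-trans p>0 (ℕ.m≤m+n p q)))))
          (ℕ.+-suc _ _)))))

-- Expansions

-- (s , λ) stands for (t^s + … + t^{c-s}) h_λ; the degree c is supplied by the context.
Expansion : Set
Expansion = List (ℕ × List ℕ)


-- The upper bound k ≤ c - s is written without subtraction, so an interval with 2s > c comes out
-- empty.
inInterval : ℕ → ℕ → ℕ → Bool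
inInterval s c k = (s ≤ᵇ k) ∧ (k ℕ.+ s ≤ᵇ c)

∑-interval : ∀ s c k y → ℤΣ.∑< (suc c ∸ (s ℕ.+ s)) (λ e → (s ℕ.+ e ≡ᵇ k) ▸ᶻ y) ≡ inInterval s c k ▸ᶻ y
∑-interval s c k y with s ℕ.≤? k
... | no s≰k = ≡.trans (ℤΣ.∑<-zero (suc c ∸ (s ℕ.+ s)) (λ e _ → ≡.cong (_▸ᶻ y) (≡ᵇ-false {s ℕ.+ e} λ { ≡.refl → s≰k (ℕ.m≤m+n s e) })))
  (≡.cong (λ b → (b ∧ (k ℕ.+ s ≤ᵇ c)) ▸ᶻ y) (≡.sym (≤ᵇ-false s≰k)))
... | yes s≤k with k ∸ s | ℕ.m+[n∸m]≡n s≤k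
...   | d | ≡.refl rewrite ≤ᵇ-true s≤k with (s ℕ.+ d) ℕ.+ s ℕ.≤? c
...     | yes k+s≤c = ≡.trans (ℤΣ.∑<-single (suc c ∸ (s ℕ.+ s)) d
            (ℕ.m+n≤o⇒m≤o∸n (suc d) (s≤s (≡.subst (_≤ c) (rearrange s d) k+s≤c)))
            (λ e e≢d → ≡.cong (_▸ᶻ y) (≡ᵇ-false (e≢d ∘ ℕ.+-cancelˡ-≡ s e d))))
          (≡.cong (_▸ᶻ y) (≡.trans (≡ᵇ-refl (s ℕ.+ d)) (≡.sym (≤ᵇ-true k+s≤c))))
  where
  rearrange : ∀ s d → (s ℕ.+ d) ℕ.+ s ≡ d ℕ.+ (s ℕ.+ s)
  rearrange = solve-∀
...     | no k+s≰c = ≡.trans (ℤΣ.∑<-zero (suc c ∸ (s ℕ.+ s)) (λ e e< → ≡.cong (_▸ᶻ y)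
            (≡ᵇ-false {s ℕ.+ e} λ eq → k+s≰c (bound e (ℕ.+-cancelˡ-≡ s e d eq) e<))))
          (≡.cong (_▸ᶻ y) (≡.sym (≤ᵇ-false k+s≰c)))
  where
  rearrange : ∀ s d → d ℕ.+ (s ℕ.+ s) ≡ (s ℕ.+ d) ℕ.+ s
  rearrange = solve-∀
  bound : ∀ e → e ≡ d → e < suc c ∸ (s ℕ.+ s) → (s ℕ.+ d) ℕ.+ s ≤ c
  bound e ≡.refl e< = ≡.subst (_≤ c) (rearrange s d) (ℕ.≤-pred (ℕ.m≤o∸n⇒m+n≤o (suc d)
    (ℕ.<⇒≤ (ℕ.m∸n≢0⇒n<m {suc c} {s ℕ.+ s} (ℕ.>⇒≢ (ℕ.≤-trans (s≤s z≤n) e<)))) e<))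

evalAt : ℕ → Expansion → ℕ → List ℕ → ℕ
evalAt c L k α = sum (map (λ { (s , ps) → if inInterval s c k then hcoef ps α else 0 }) L)

multiply : ℕ → ℕ → ℕ → ℕ → ℕ × List ℕ → Expansion
multiply s c p c′ (s′ , ps) = map (λ e → s ℕ.+ s′ ℕ.+ e , p ∷ ps) (upTo ((suc c ∸ (s ℕ.+ s)) ⊓ (suc c′ ∸ (s′ ℕ.+ s′))))

module Coefficients (N l′ : ℕ) where
  open Extraction N l′ public using (S; t; r; x; coeff-multisets)
  open CommutativeRing S hiding (zero)
  open FiniteSums S
  open Generating S N l′ x t r (torsionFree (2 ℕ.+ N)) (Homogeneous.X-1-cancel (MPS (1 ℕ.+ N))) public
    using (h; F; F-zero; F-suc; ornaments; [_]ₜ; H; H-zero)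
  open QSums S t public using (interval; interval-*)
  open import Algebra.Properties.Semiring.Exp semiring using (_^_; ^-congˡ; ^-homo-*)
  open import Relation.Binary.Reasoning.Setoid setoid

  module R₀ = CommutativeRing (MPS N)
  module R₁ = CommutativeRing (MPS (1 ℕ.+ N))
  module H₀ = Homogeneous (MPS N)
  module H₁ = Homogeneous (MPS (1 ℕ.+ N))
  open PowerSeries (MPS N) using () renaming (const to const₀)
  open PowerSeries (MPS (1 ℕ.+ N)) using () renaming (const to const₁; const-⋆ to const₁-⋆)
  open import Algebra.Properties.Semiring.Exp R₁.semiring using () renaming (_^_ to _^₁_)
  open PowerSeries using (at; coeffs)

  -- Series in the x_u alone, viewed as constants in r and then in t.
  ι : ⟦ N ⟧ → Carrier
  ι f = const₁ (const₀ f)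

  ι-* : ∀ f g → ι (f R₀.* g) ≈ ι f * ι g
  ι-* f g = trans (H₁.const-cong (H₀.const-* f g)) (H₁.const-* _ _)

  h≈ι-hom : ∀ p → h p ≈ ι (hom N p)
  h≈ι-hom p = begin
    h p
      ≈⟨ at (prefix N) p ⟩
    HZ.complete (applyUpTo x N) p
      ≡⟨ ≡.cong (λ qs → HZ.complete qs p) lift ⟩
    HZ.complete (map const₁ (map const₀ (applyUpTo (variables N) N))) p
      ≈⟨ CompleteLift.complete-const (MPS (1 ℕ.+ N)) (map const₀ (applyUpTo (variables N) N)) p ⟩
    const₁ (H₁.complete (map const₀ (applyUpTo (variables N) N)) p)
      ≈⟨ H₁.const-cong (CompleteLift.complete-const (MPS N) (applyUpTo (variables N) N) p) ⟩
    ι (hom N p) ∎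
    where
    module HZ = Homogeneous S
    module Z = CommutativeRing (PowerSeries.⟨_⟦z⟧⟩ S)
    open SeriesTools S using (geometric-1)
    lift : applyUpTo x N ≡ map const₁ (map const₀ (applyUpTo (variables N) N))
    lift = ≡.sym (≡.trans (≡.cong (map const₁) (map-applyUpTo const₀ (variables N) N)) (map-applyUpTo const₁ _ N))
    prefix : ∀ k → H 1# k Z.≈ HZ.complete (applyUpTo x k)
    prefix zero    = Z.refl
    prefix (suc k) = Z.trans (Z.*-cong (prefix k) (coeffs λ d → trans (geometric-1 (1# * x k) d)
        (trans (^-congˡ d (*-identityˡ _)) (sym (geometric-1 (x k) d)))))
      (Z.trans (Z.sym (HZ.complete-snoc (applyUpTo x k) (x k))) (Z.reflexive (≡.cong HZ.complete (applyUpTo-∷ʳ x k))))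

  eval : ℕ → Expansion → Carrier
  eval c L = ∑ L (λ { (s , ps) → interval s c * ι (hprod N ps) })

  coeff-shift : ∀ i f k j α → coeff (2 ℕ.+ N) (r ^ i * f) (k ∷ j ∷ α) ≡ (i ≤ᵇ j) ▸ᶻ coeff (2 ℕ.+ N) f (k ∷ j ∸ i ∷ α)
  coeff-shift i f k j α = ≡.trans (coeff-cong (2 ℕ.+ N) (*-congʳ (sym (H₁.const-^ H₀.X i))) (k ∷ j ∷ α))
    (≡.trans (coeff-cong (1 ℕ.+ N) (const₁-⋆ (H₀.X ^₁ i) f k) (j ∷ α))
    (≡.trans (coeff-cong N (H₀.X^-⋆ i (f k) j) α) (coeff-▸ N (i ≤ᵇ j) _ α)))

  coeff-t^-ι : ∀ p g k j α → coeff (2 ℕ.+ N) (t ^ p * ι g) (k ∷ j ∷ α) ≡ (p ≡ᵇ k) ▸ᶻ ((j ≡ᵇ 0) ▸ᶻ coeff N g α)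
  coeff-t^-ι p g k j α = ≡.trans (coeff-cong (1 ℕ.+ N) (H₁.X^-⋆ p (ι g) k) (j ∷ α))
    (≡.trans (coeff-▸ (1 ℕ.+ N) (p ≤ᵇ k) _ (j ∷ α)) (diagonal p k))
    where
    base : ∀ j → coeff (1 ℕ.+ N) (const₀ g) (j ∷ α) ≡ (j ≡ᵇ 0) ▸ᶻ coeff N g α
    base zero    = ≡.refl
    base (suc j) = coeff-0 N α
    diagonal : ∀ p k → (p ≤ᵇ k) ▸ᶻ coeff (1 ℕ.+ N) (ι g (k ∸ p)) (j ∷ α) ≡ (p ≡ᵇ k) ▸ᶻ ((j ≡ᵇ 0) ▸ᶻ coeff N g α)
    diagonal zero    zero    = base j
    diagonal zero    (suc k) = coeff-0 N α
    diagonal (suc p) zero    = ≡.refl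
    diagonal (suc p) (suc k) = ≡.trans (≡.cong (_▸ᶻ coeff (1 ℕ.+ N) (ι g (k ∸ p)) (j ∷ α)) (≤ᵇ-suc p k)) (diagonal p k)

  coeff-interval : ∀ s c g k j α → coeff (2 ℕ.+ N) (interval s c * ι g) (k ∷ j ∷ α) ≡
    inInterval s c k ▸ᶻ ((j ≡ᵇ 0) ▸ᶻ coeff N g α)
  coeff-interval s c g k j α = ≡.trans (coeff-cong (2 ℕ.+ N) expand (k ∷ j ∷ α)) (≡.trans (coeff-∑< (2 ℕ.+ N) q _ (k ∷ j ∷ α))
    (≡.trans (ℤΣ.∑<-cong q (λ e _ → coeff-t^-ι (s ℕ.+ e) g k j α)) (∑-interval s c k _)))
    where
    q = suc c ∸ (s ℕ.+ s)
    expand : interval s c * ι g ≈ ∑< q (λ e → t ^ (s ℕ.+ e) * ι g)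
    expand = trans (*-assoc _ _ _) (trans (*-congˡ (∑<-*ʳ q (ι g) _)) (trans (∑<-*ˡ q (t ^ s) _)
      (∑<-cong q (λ e _ → trans (sym (*-assoc _ _ _)) (*-congʳ (sym (^-homo-* t s e)))))))

  coeff-eval-0 : ∀ c L k α → length α ≡ N → coeff (2 ℕ.+ N) (eval c L) (k ∷ 0 ∷ α) ≡ + evalAt c L k α
  coeff-eval-0 c L k α len = ≡.trans (coeff-∑ (2 ℕ.+ N) L _ (k ∷ 0 ∷ α)) (≡.trans
    (ℤΣ.∑-cong L (λ { (s , ps) → ≡.trans (coeff-interval s c (hprod N ps) k 0 α)
      (≡.trans (ℤΣ.▸-cong (inInterval s c k) (coeff-hprod N ps α len)) (≡.sym (pos-▸ (inInterval s c k) _))) }))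
    (≡.sym (pos-sum L _)))

  coeff-eval-suc : ∀ c L k j α → coeff (2 ℕ.+ N) (eval c L) (k ∷ suc j ∷ α) ≡ + 0
  coeff-eval-suc c L k j α = ≡.trans (coeff-∑ (2 ℕ.+ N) L _ (k ∷ suc j ∷ α)) (≡.trans
    (ℤΣ.∑-cong L (λ { (s , ps) → ≡.trans (coeff-interval s c (hprod N ps) k (suc j) α) (ℤΣ.▸-0 (inInterval s c k)) }))
    (ℤΣ.∑-0 L))

  eval-++ : ∀ c L L′ → eval c (L ++ L′) ≈ eval c L + eval c L′
  eval-++ c L L′ = ∑-++ L L′ _

  eval-multiply : ∀ s c p c′ L → eval (c ℕ.+ c′) (concatMap (multiply s c p c′) L) ≈ (interval s c * h p) * eval c′ L
  eval-multiply s c p c′ L = begin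
    eval (c ℕ.+ c′) (concatMap (multiply s c p c′) L)
      ≈⟨ ∑-concatMap (multiply s c p c′) L _ ⟩
    ∑ L (λ y → eval (c ℕ.+ c′) (multiply s c p c′ y))
      ≈⟨ ∑-cong L (λ { (s′ , ps) → term s′ ps }) ⟩
    ∑ L (λ { (s′ , ps) → (interval s c * h p) * (interval s′ c′ * ι (hprod N ps)) })
      ≈⟨ ∑-*ˡ L _ _ ⟨
    (interval s c * h p) * eval c′ L ∎
    where
    open IntegerSolver S using (solve; _:=_; _:*_)
    rearrange : ∀ a b c d → (a * b) * (c * d) ≈ (a * c) * (b * d)
    rearrange = solve 4 (λ a b c d → (a :* b) :* (c :* d) := (a :* c) :* (b :* d)) refl
    term : ∀ s′ ps → eval (c ℕ.+ c′) (multiply s c p c′ (s′ , ps)) ≈ (interval s c * h p) * (interval s′ c′ * ι (hprod N ps))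
    term s′ ps = begin
      eval (c ℕ.+ c′) (multiply s c p c′ (s′ , ps))
        ≈⟨ ∑-map (λ e → s ℕ.+ s′ ℕ.+ e , p ∷ ps) (upTo q) _ ⟩
      ∑ (upTo q) (λ e → interval (s ℕ.+ s′ ℕ.+ e) (c ℕ.+ c′) * ι (hprod N (p ∷ ps)))
        ≈⟨ ∑-upTo q _ ⟩
      ∑< q (λ e → interval (s ℕ.+ s′ ℕ.+ e) (c ℕ.+ c′) * ι (hprod N (p ∷ ps)))
        ≈⟨ ∑<-*ʳ q _ _ ⟨
      ∑< q (λ e → interval (s ℕ.+ s′ ℕ.+ e) (c ℕ.+ c′)) * ι (hprod N (p ∷ ps))
        ≈⟨ *-cong (sym (interval-* s c s′ c′)) (trans (ι-* (hom N p) (hprod N ps)) (*-congʳ (sym (h≈ι-hom p)))) ⟩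
      (interval s c * interval s′ c′) * (h p * ι (hprod N ps))
        ≈⟨ rearrange _ _ _ _ ⟩
      (interval s c * h p) * (interval s′ c′ * ι (hprod N ps)) ∎
      where q = (suc c ∸ (s ℕ.+ s)) ⊓ (suc c′ ∸ (s′ ℕ.+ s′))

module Expansions (l′ : ℕ) where
  l : ℕ
  l = suc l′

  module C (N : ℕ) = Coefficients N l′
  open C using (eval; interval; h)
  module K (N : ℕ) = CommutativeRing (MPS (2 ℕ.+ N))

  Family : Set
  Family = ∀ N → ⟦ 2 ℕ.+ N ⟧

  -- The expansion must not depend on the number N of variables; all its exponents s are at least m.
  Expands : ℕ → ℕ → Family → Set
  Expands m c f = ∃[ L ] (All (λ e → m ≤ proj₁ e) L × (∀ N → K._≈_ N (f N) (eval N c L)))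

  expands-cong : ∀ {m c f g} → (∀ N → K._≈_ N (f N) (g N)) → Expands m c g → Expands m c f
  expands-cong p (L , m≤ , q) = L , m≤ , λ N → K.trans N (p N) (q N)

  expands-weaken : ∀ {m m′ c f} → m′ ≤ m → Expands m c f → Expands m′ c f
  expands-weaken m′≤m (L , m≤ , q) = L , All.map (ℕ.≤-trans m′≤m) m≤ , q

  expands-∑< : ∀ {m c} n (f : ℕ → Family) → (∀ i → i < n → Expands m c (f i)) →
    Expands m c (λ N → FiniteSums.∑< (MPS (2 ℕ.+ N)) n (λ i → f i N))
  expands-∑< zero    f p = [] , [] , λ N → FiniteSums.∑<-empty (MPS (2 ℕ.+ N)) (λ i → f i N)
  expands-∑< {m} {c} (suc n) f p with p 0 (s≤s z≤n) | expands-∑< n (f ∘ suc) (λ i i<n → p (suc i) (s≤s i<n))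
  ... | L , m≤ , q | L′ , m≤′ , q′ = L ++ L′ , All.++⁺ m≤ m≤′ , λ N →
    K.trans N (FiniteSums.∑<-suc (MPS (2 ℕ.+ N)) n (λ i → f i N))
      (K.trans N (K.+-cong N (q N) (q′ N)) (K.sym N (C.eval-++ N c L L′)))

  -- By `interval-*` the degrees add, hence the centres do too; the starting exponents only grow
  -- beyond their sum.
  expands-* : ∀ {m c f} s c′ p → Expands m c f →
    Expands (s ℕ.+ m) (c′ ℕ.+ c) (λ N → K._*_ N (K._*_ N (interval N s c′) (h N p)) (f N))
  expands-* {m} {c} s c′ p (L , m≤ , q) = concatMap (multiply s c′ p c) L
    , All.concat⁺ (All.map⁺ (All.map (λ m≤s′ → All.map⁺ (All.universal (λ e → ℕ.≤-trans (ℕ.+-monoʳ-≤ s m≤s′) (ℕ.m≤m+n _ e)) _)) m≤))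
    , λ N → K.trans N (K.*-congˡ N (q N)) (K.sym N (C.eval-multiply N s c′ p c L))

-- Symmetry and unimodality

module Partitions where
  open Data.List.Sort (Flip.decTotalOrder ℕ.≤-decTotalOrder) using (sort; sort-↭; sort-↗)

  positives : List ℕ → List ℕ
  positives []           = []
  positives (zero ∷ ps)  = positives ps
  positives (suc p ∷ ps) = suc p ∷ positives ps

  positives-positive : ∀ ps → All (1 ≤_) (positives ps)
  positives-positive []           = []
  positives-positive (zero ∷ ps)  = positives-positive ps
  positives-positive (suc p ∷ ps) = s≤s z≤n ∷ positives-positive ps

  -- `HPos` asks for positive, weakly decreasing parts, whereas expansions collect indices in
  -- arbitrary order. As h_0 = 1 and products commute, zeros are dropped and the rest is sorted.
  partition : List ℕ → List ℕ
  partition ps = sort (positives ps)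

  partition-isPartition : ∀ ps → IsPartition (partition ps)
  partition-isPartition ps = All-resp-↭ (↭-sym (sort-↭ (positives ps))) (positives-positive ps) , sort-↗ (positives ps)

  module _ (N : ℕ) where
    open CommutativeRing (MPS N) hiding (zero)

    complete-0 : ∀ qs → Homogeneous.complete (MPS N) qs 0 ≈ 1#
    complete-0 []       = refl
    complete-0 (q ∷ qs) = trans (*-cong (SeriesTools.geometric-1 (MPS N) q 0) (complete-0 qs)) (*-identityˡ _)

    hprod-positives : ∀ ps → hprod N (positives ps) ≈ hprod N ps
    hprod-positives []           = refl
    hprod-positives (zero ∷ ps)  = trans (hprod-positives ps) (sym (trans (*-congʳ (complete-0 (applyUpTo (variables N) N))) (*-identityˡ _)))
    hprod-positives (suc p ∷ ps) = *-congˡ (hprod-positives ps)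

    hprod-↭ : ∀ {ps qs} → ps ↭ qs → hprod N ps ≈ hprod N qs
    hprod-↭ ↭.refl         = refl
    hprod-↭ (↭.prep p e)   = *-congˡ (hprod-↭ e)
    hprod-↭ (↭.swap p q e) = trans (*-congˡ (*-congˡ (hprod-↭ e)))
      (trans (sym (*-assoc _ _ _)) (trans (*-congʳ (*-comm _ _)) (*-assoc _ _ _)))
    hprod-↭ (↭.trans e e′) = trans (hprod-↭ e) (hprod-↭ e′)

  -- The recursion of `hcoef` does not show its symmetry in the parts. It is read off from `hprod`,
  -- a product in a commutative ring.
  hcoef-partition : ∀ ps α → hcoef (partition ps) α ≡ hcoef ps α
  hcoef-partition ps α = ℤ.+-injective (≡.trans (≡.sym (coeff-hprod N (partition ps) α ≡.refl)) (≡.trans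
    (coeff-cong N (R.trans (hprod-↭ N (sort-↭ (positives ps))) (hprod-positives N ps)) α) (coeff-hprod N ps α ≡.refl)))
    where
    N = length α
    module R = CommutativeRing (MPS N)

open Partitions

combination : Expansion → (ℕ → ℕ) → List ℕ → ℕ
combination L b α = sum (map (λ { (s , ps) → b s ℕ.* hcoef ps α }) L)

HPos-combination : ∀ {f} L b → (∀ α → f α ≡ + combination L b α) → HPos f
HPos-combination L b p = map (λ { (s , ps) → b s , partition ps }) L
  , All.map⁺ (All.universal (λ { (s , ps) → partition-isPartition ps }) L)
  , λ α → ≡.trans (p α) (≡.cong +_ (go L α))
  where
  go : ∀ L α → combination L b α ≡ sum (map (λ cλ → proj₁ cλ ℕ.* hcoef (proj₂ cλ) α) (map (λ { (s , ps) → b s , partition ps }) L))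
  go []             α = ≡.refl
  go ((s , ps) ∷ L) α = ≡.cong₂ ℕ._+_ (≡.cong (b s ℕ.*_) (≡.sym (hcoef-partition ps α))) (go L α)

combination-∸ : ∀ L b b′ α → (∀ s → b s ≤ b′ s) →
  + combination L b′ α ℤ.- + combination L b α ≡ + combination L (λ s → b′ s ∸ b s) α
combination-∸ L b b′ α p = ≡.trans (≡.cong (λ n → + n ℤ.- + combination L b α) (≡.sym (go L)))
  (≡.trans (≡.cong (ℤ._- + combination L b α) (ℤ.pos-+ X Y))
  (≡.trans (ℤ.+-assoc (+ X) (+ Y) (ℤ.- + Y)) (≡.trans (≡.cong (ℤ._+_ (+ X)) (ℤ.+-inverseʳ (+ Y))) (ℤ.+-identityʳ (+ X)))))
  where
  X = combination L (λ s → b′ s ∸ b s) α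
  Y = combination L b α
  open import Algebra.Properties.CommutativeSemigroup ℕ.+-commutativeSemigroup using (interchange)
  go : ∀ L → combination L (λ s → b′ s ∸ b s) α ℕ.+ combination L b α ≡ combination L b′ α
  go []             = ≡.refl
  go ((s , ps) ∷ L) = ≡.trans (interchange ((b′ s ∸ b s) ℕ.* hcoef ps α) _ _ _) (≡.cong₂ ℕ._+_
    (≡.trans (≡.sym (ℕ.*-distribʳ-+ (hcoef ps α) (b′ s ∸ b s) (b s))) (≡.cong (ℕ._* hcoef ps α) (ℕ.m∸n+n≡m (p s)))) (go L))

indicator : ℕ → ℕ → ℕ → ℕ
indicator c k s = if inInterval s c k then 1 else 0

evalAt-combination : ∀ c L k α → evalAt c L k α ≡ combination L (indicator c k) α
evalAt-combination c []             k α = ≡.refl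
evalAt-combination c ((s , ps) ∷ L) k α = ≡.cong₂ ℕ._+_ (go (inInterval s c k)) (evalAt-combination c L k α)
  where
  go : ∀ b → (if b then hcoef ps α else 0) ≡ (if b then 1 else 0) ℕ.* hcoef ps α
  go true  = ≡.sym (ℕ.*-identityˡ _)
  go false = ≡.refl

evalAt-cong : ∀ c L k k′ α → All (λ e → inInterval (proj₁ e) c k ≡ inInterval (proj₁ e) c k′) L → evalAt c L k α ≡ evalAt c L k′ α
evalAt-cong c []             k k′ α []       = ≡.refl
evalAt-cong c ((s , ps) ∷ L) k k′ α (p ∷ ps′) = ≡.cong₂ ℕ._+_ (≡.cong (λ b → if b then hcoef ps α else 0) p) (evalAt-cong c L k k′ α ps′)

evalAt-zero : ∀ c L k α → All (λ e → inInterval (proj₁ e) c k ≡ false) L → evalAt c L k α ≡ 0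
evalAt-zero c []             k α []        = ≡.refl
evalAt-zero c ((s , ps) ∷ L) k α (p ∷ ps′) = ≡.cong₂ ℕ._+_ (≡.cong (λ b → if b then hcoef ps α else 0) p) (evalAt-zero c L k α ps′)

inInterval-sound : ∀ s c k → inInterval s c k ≡ true → s ≤ k × k ℕ.+ s ≤ c
inInterval-sound s c k p with ∧-true {s ≤ᵇ k} p
... | q , r = ≤ᵇ-sound q , ≤ᵇ-sound r

inInterval-complete : ∀ s c k → s ≤ k → k ℕ.+ s ≤ c → inInterval s c k ≡ true
inInterval-complete s c k p q rewrite ≤ᵇ-true p | ≤ᵇ-true q = ≡.refl

inInterval-> : ∀ s c k → c < k → inInterval s c k ≡ false
inInterval-> s c k c<k with inInterval s c k in eq
... | false = ≡.refl
... | true  = ⊥-elim (ℕ.<⇒≱ c<k (ℕ.≤-trans (ℕ.m≤m+n k s) (proj₂ (inInterval-sound s c k eq))))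

inInterval-reflect : ∀ s c k → k ≤ c → inInterval s c k ≡ true → inInterval s c (c ∸ k) ≡ true
inInterval-reflect s c k k≤c p with inInterval-sound s c k p
... | s≤k , k+s≤c = inInterval-complete s c (c ∸ k) (ℕ.m+n≤o⇒m≤o∸n s (≡.subst (_≤ c) (ℕ.+-comm k s) k+s≤c))
  (≡.subst (c ∸ k ℕ.+ s ≤_) (ℕ.m∸n+n≡m k≤c) (ℕ.+-monoʳ-≤ (c ∸ k) s≤k))

inInterval-sym : ∀ s c k → k ≤ c → inInterval s c k ≡ inInterval s c (c ∸ k)
inInterval-sym s c k k≤c with inInterval s c k in eq | inInterval s c (c ∸ k) in eq′
... | true  | true  = ≡.refl
... | false | false = ≡.refl
... | true  | false = ≡.trans (≡.sym (inInterval-reflect s c k k≤c eq)) eq′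
... | false | true  = ≡.trans (≡.sym eq) (≡.subst (λ i → inInterval s c i ≡ true) (ℕ.m∸[m∸n]≡n k≤c)
                        (inInterval-reflect s c (c ∸ k) (ℕ.m∸n≤m c k) eq′))

-- Left of the centre only the lower bound of an interval can fail, and it gets weaker as k grows.
indicator-mono : ∀ c k s → suc k ℕ.+ suc k ≤ c → indicator c k s ≤ indicator c (suc k) s
indicator-mono c k s 2k+2≤c with inInterval s c k in eq
... | false = z≤n
... | true with inInterval-sound s c k eq
...   | s≤k , _ rewrite inInterval-complete s c (suc k) (ℕ.m≤n⇒m≤1+n s≤k)
          (ℕ.≤-trans (ℕ.+-monoʳ-≤ (suc k) (ℕ.m≤n⇒m≤1+n s≤k)) 2k+2≤c) = ℕ.≤-refl

half-sum : ∀ c → c / 2 ℕ.+ (c ℕ.+ 1) / 2 ≡ c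
half-sum zero          = ≡.refl
half-sum (suc zero)    = ≡.refl
half-sum (suc (suc c)) = ≡.trans (≡.cong₂ ℕ._+_ (half-suc c) (half-suc (c ℕ.+ 1)))
  (≡.cong suc (≡.trans (ℕ.+-suc (c / 2) ((c ℕ.+ 1) / 2)) (≡.cong suc (half-sum c))))
  where
  half-suc : ∀ c → suc (suc c) / 2 ≡ suc (c / 2)
  half-suc c = ℕ.+-distrib-/-∣ˡ {2} c {2} (divides 1 ≡.refl)

half-≤ : ∀ c → c / 2 ≤ (c ℕ.+ 1) / 2
half-≤ c = ℕ./-monoˡ-≤ 2 (ℕ.m≤m+n c 1)

module Shape (a : ℕ → SymF) (c : ℕ) (L : Expansion) (a≡ : ∀ k α → a k α ≡ + evalAt c L k α) where

  hpos : ∀ k → HPos (a k)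
  hpos k = HPos-combination L (indicator c k) (λ α → ≡.trans (a≡ k α) (≡.cong +_ (evalAt-combination c L k α)))

  vanishes : ∀ k → c < k → IsZeroF (a k)
  vanishes k c<k α = ≡.trans (a≡ k α) (≡.cong +_ (evalAt-zero c L k α (All.universal (λ e → inInterval-> (proj₁ e) c k c<k) L)))

  symmetric : ∀ k → k ≤ c → a k ≈F a (c ∸ k)
  symmetric k k≤c α = ≡.trans (a≡ k α) (≡.trans (≡.cong +_ (evalAt-cong c L k (c ∸ k) α
    (All.universal (λ e → inInterval-sym (proj₁ e) c k k≤c) L))) (≡.sym (a≡ (c ∸ k) α)))

  increasing : ∀ k → suc k ℕ.+ suc k ≤ c → a k ≤h a (suc k)
  increasing k p = HPos-combination L (λ s → indicator c (suc k) s ∸ indicator c k s) (λ α → ≡.trans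
    (≡.cong₂ ℤ._-_ (≡.trans (a≡ (suc k) α) (≡.cong +_ (evalAt-combination c L (suc k) α)))
                   (≡.trans (a≡ k α) (≡.cong +_ (evalAt-combination c L k α))))
    (combination-∸ L (indicator c k) (indicator c (suc k)) α (λ s → indicator-mono c k s p)))

  ≤h-resp : ∀ {f f′ g g′} → f ≈F f′ → g ≈F g′ → f′ ≤h g′ → f ≤h g
  ≤h-resp p q (M , ps , eq) = M , ps , λ α → ≡.trans (≡.cong₂ ℤ._-_ (q α) (p α)) (eq α)

  -- The bound D of the polynomial may differ from the degree c of the expansion. Once nothing lives
  -- above D, reflection at c / 2 exchanges the lowest and the highest nonzero coefficient, so r + s
  -- = c.
  symUnimodal : ∀ D → (∀ i → D < i → IsZeroF (a i)) → SymUnimodal a D c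
  symUnimodal D beyond r s (_ , (αr , ar≢0) , below) (_ , (αs , as≢0) , above) =
      r+s≡c
    , (λ i i≤ → ≡.subst (λ k → a (r ℕ.+ i) ≈F a k) (reflect i) (symmetric (r ℕ.+ i) (r+i≤c i i≤)))
    , (λ i _ i< → increasing i (ℕ.≤-trans (ℕ.+-mono-≤ i< i<) (≡.subst (λ n → n / 2 ℕ.+ n / 2 ≤ c) (≡.sym r+s≡c) 2⌊c/2⌋≤c)))
    , ≡.subst (λ n → a (n / 2) ≈F a ((n ℕ.+ 1) / 2)) (≡.sym r+s≡c)
        (≡.subst (λ k → a (c / 2) ≈F a k) middle (symmetric (c / 2) (≡.subst (c / 2 ≤_) (half-sum c) (ℕ.m≤m+n _ _))))
    , (λ i ≤i i<s → decreasing i (≡.subst (λ n → (n ℕ.+ 1) / 2 ≤ i) r+s≡c ≤i) (ℕ.≤-trans i<s s≤c))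
    where
    r≤c : r ≤ c
    r≤c = ℕ.≮⇒≥ λ c<r → ar≢0 (vanishes r c<r αr)
    s≤c : s ≤ c
    s≤c = ℕ.≮⇒≥ λ c<s → as≢0 (vanishes s c<s αs)
    -- The coefficient at c - r equals the nonzero one at r, so it cannot lie above the highest
    -- nonzero degree.
    c∸r≤s : c ∸ r ≤ s
    c∸r≤s = ℕ.≮⇒≥ λ s< → ar≢0 (≡.trans (symmetric r r≤c αr) (zero-above (c ∸ r) s< αr))
      where
      zero-above : ∀ i → s < i → IsZeroF (a i)
      zero-above i s<i with i ℕ.≤? D
      ... | yes i≤D = above i s<i i≤D
      ... | no i≰D  = beyond i (ℕ.≰⇒> i≰D)
    r≤c∸s : r ≤ c ∸ s
    r≤c∸s = ℕ.≮⇒≥ λ <r → as≢0 (≡.trans (symmetric s s≤c αs) (below (c ∸ s) <r αs))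
    r+s≡c : r ℕ.+ s ≡ c
    r+s≡c = ℕ.≤-antisym (ℕ.m≤o∸n⇒m+n≤o r s≤c r≤c∸s)
      (≡.subst (_≤ r ℕ.+ s) (ℕ.m+[n∸m]≡n r≤c) (ℕ.+-monoʳ-≤ r c∸r≤s))
    r+i≤c : ∀ i → i ≤ s ∸ r → r ℕ.+ i ≤ c
    r+i≤c i i≤ = ≡.subst (r ℕ.+ i ≤_) r+s≡c (ℕ.+-monoʳ-≤ r (ℕ.≤-trans i≤ (ℕ.m∸n≤m s r)))
    reflect : ∀ i → c ∸ (r ℕ.+ i) ≡ s ∸ i
    reflect i = ≡.trans (≡.cong (_∸ (r ℕ.+ i)) (≡.sym r+s≡c)) (ℕ.[m+n]∸[m+o]≡n∸o r s i)
    middle : c ∸ c / 2 ≡ (c ℕ.+ 1) / 2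
    middle = ≡.trans (≡.cong (_∸ c / 2) (≡.sym (half-sum c))) (ℕ.m+n∸m≡n (c / 2) _)
    2⌊c/2⌋≤c : c / 2 ℕ.+ c / 2 ≤ c
    2⌊c/2⌋≤c = ≡.subst (c / 2 ℕ.+ c / 2 ≤_) (half-sum c) (ℕ.+-monoʳ-≤ (c / 2) (half-≤ c))
    -- Reflection turns the descent from i to i + 1 into the ascent from c - i - 1 to c - i.
    decreasing : ∀ i → (c ℕ.+ 1) / 2 ≤ i → suc i ≤ c → a (suc i) ≤h a i
    decreasing i ≤i i<c = ≤h-resp (symmetric (suc i) i<c)
        (≡.subst (λ k → a i ≈F a k) (≡.sym pred) (symmetric i (ℕ.<⇒≤ i<c)))
        (increasing (c ∸ suc i) (≡.subst (λ k → k ℕ.+ k ≤ c) (≡.sym pred) bound))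
      where
      pred : suc (c ∸ suc i) ≡ c ∸ i
      pred = ≡.sym (ℕ.+-∸-assoc 1 i<c)
      c≤2i : c ≤ i ℕ.+ i
      c≤2i = ≡.subst (_≤ i ℕ.+ i) (half-sum c) (ℕ.+-mono-≤ (ℕ.≤-trans (half-≤ c) ≤i) ≤i)
      bound : (c ∸ i) ℕ.+ (c ∸ i) ≤ c
      bound = ≡.subst ((c ∸ i) ℕ.+ (c ∸ i) ≤_) (ℕ.m∸n+n≡m (ℕ.<⇒≤ i<c))
        (ℕ.+-monoʳ-≤ (c ∸ i) (ℕ.m≤n+o⇒m∸n≤o c i c≤2i))

open import Data.Nat using (_*_)

-- The polynomials Σ_k Q_{n,k,j} t^k and Σ_k Q_{n,k} t^k

module Main (l′ : ℕ) where
  open Expansions l′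
  open C using (interval; h; F; [_]ₜ; ι)

  -- The bracket is symmetric about ld / 2, so every product of brackets in the recursion for F_n is
  -- symmetric about ln / 2.
  interval-1 : ∀ N d → K._≈_ N ([_]ₜ N d) (interval N 1 (l * d))
  interval-1 N d = K.sym N (K.trans N (K.*-congʳ N (K.*-identityʳ N _)) (FiniteSums.∑<-*ˡ (MPS (2 ℕ.+ N)) (l * d ∸ 1) _ _))

  interval-0 : ∀ N d → K._≈_ N (interval N 0 (l * d ∸ 1)) (K._+_ N (K.1# N) ([_]ₜ N d))
  interval-0 N d = K.trans N (K.*-identityˡ N _) (FiniteSums.∑<-suc (MPS (2 ℕ.+ N)) (l * d ∸ 1) _)

  interval-00 : ∀ N → K._≈_ N (interval N 0 0) (K.1# N)
  interval-00 N = K.trans N (K.*-identityˡ N _) (K.trans N (FiniteSums.∑<-suc (MPS (2 ℕ.+ N)) 0 _)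
    (K.trans N (K.+-congˡ N (FiniteSums.∑<-empty (MPS (2 ℕ.+ N)) _)) (K.+-identityʳ N _)))

  degrees : ∀ n i → i ≤ n → l * suc i ℕ.+ l * (n ∸ i) ≡ l * suc n
  degrees n i i≤n = ≡.trans (≡.sym (ℕ.*-distribˡ-+ l (suc i) (n ∸ i))) (≡.cong (λ k → l * suc k) (ℕ.m+[n∸m]≡n i≤n))

  opaque
    -- F_0 = 1 is the interval with s = c = 0. For n ≥ 1 every term of the recursion contains a
    -- bracket divisible by t, so its intervals start at 1 or later; the bound `1 ⊓ n` records both
    -- cases. The recursion passes from n + 1 to n ∸ i, hence the auxiliary bound b.
    F-expands : ∀ n → Expands (1 ⊓ n) (l * n) (λ N → F N n)
    F-expands n = go n n ℕ.≤-refl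
      where
      go : ∀ b n → n ≤ b → Expands (1 ⊓ n) (l * n) (λ N → F N n)
      go b zero _ rewrite ℕ.*-zeroʳ l′ = (0 , []) ∷ [] , z≤n ∷ [] , λ N → K.trans N (C.F-zero N)
        (K.sym N (K.trans N (K.+-identityʳ N _) (K.trans N (K.*-identityʳ N _) (interval-00 N))))
      go (suc b) (suc n) (s≤s n≤b) = expands-cong (λ N → C.F-suc N n)
        (expands-∑< (suc n) (λ i N → K._*_ N (K._*_ N ([_]ₜ N (suc i)) (h N (suc i))) (F N (n ∸ i))) term)
        where
        term : ∀ i → i < suc n → Expands 1 (l * suc n) (λ N → K._*_ N (K._*_ N ([_]ₜ N (suc i)) (h N (suc i))) (F N (n ∸ i)))
        term i (s≤s i≤n) = ≡.subst (λ c → Expands 1 c (λ N → K._*_ N (K._*_ N ([_]ₜ N (suc i)) (h N (suc i))) (F N (n ∸ i)))) (degrees n i i≤n)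
          (expands-cong (λ N → K.*-congʳ N (K.*-congʳ N (interval-1 N (suc i))))
            (expands-* 1 (l * suc i) (suc i) (expands-weaken z≤n (go b (n ∸ i) (ℕ.≤-trans (ℕ.m∸n≤m n i) n≤b)))))

  part : ℕ → ℕ → Family
  part n j N = K._*_ N (h N j) (F N (n ∸ j))

  opaque
    part-expands : ∀ n j → Expands (1 ⊓ (n ∸ j)) (l * (n ∸ j)) (part n j)
    part-expands n j = expands-cong (λ N → K.*-congʳ N (K.sym N (K.trans N (K.*-congʳ N (interval-00 N)) (K.*-identityˡ N _))))
      (expands-* 0 0 j (F-expands (n ∸ j)))

  -- The number of variables is the length of α, exactly as in `Qcount`. It changes with α, which is
  -- why expansions are required to be uniform in N.
  Q-terms : ∀ n k j α → Q l n k j α ≡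
    ℤΣ.∑< (suc n) (λ i → (i ≤ᵇ j) ▸ᶻ coeff (2 ℕ.+ length α) (part n i (length α)) (k ∷ j ∸ i ∷ α))
  Q-terms n k j α = ≡.trans (≡.sym (C.coeff-multisets N n k j α ≡.refl)) (≡.trans
    (coeff-cong (2 ℕ.+ N) (C.ornaments N n) (k ∷ j ∷ α)) (≡.trans (coeff-∑< (2 ℕ.+ N) (suc n) _ (k ∷ j ∷ α))
      (ℤΣ.∑<-cong (suc n) (λ i _ → ≡.trans (coeff-cong (2 ℕ.+ N) (K.*-assoc N _ _ _) (k ∷ j ∷ α))
        (C.coeff-shift N i (part n i N) k j α)))))
    where N = length α

  -- Only i = j contributes, because the expansions do not involve r.
  Q-term-off : ∀ n k j α i → i ≢ j → (i ≤ᵇ j) ▸ᶻ coeff (2 ℕ.+ length α) (part n i (length α)) (k ∷ j ∸ i ∷ α) ≡ + 0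
  Q-term-off n k j α i i≢j with i ℕ.≤? j
  ... | no i≰j = ≡.cong (_▸ᶻ coeff (2 ℕ.+ length α) (part n i (length α)) (k ∷ j ∸ i ∷ α)) (≤ᵇ-false i≰j)
  ... | yes i≤j with j ∸ i in eq
  ...   | zero  = ⊥-elim (i≢j (ℕ.≤-antisym i≤j (ℕ.m∸n≡0⇒m≤n eq)))
  ...   | suc d with part-expands n i
  ...     | L , _ , p = ≡.trans (ℤΣ.▸-cong (i ≤ᵇ j) (≡.trans (coeff-cong (2 ℕ.+ length α) (p (length α)) (k ∷ suc d ∷ α))
              (C.coeff-eval-suc (length α) (l * (n ∸ i)) L k d α))) (ℤΣ.▸-0 (i ≤ᵇ j))

  Q-part : ∀ n k j α → j ≤ n → Q l n k j α ≡ coeff (2 ℕ.+ length α) (part n j (length α)) (k ∷ 0 ∷ α)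
  Q-part n k j α j≤n = ≡.trans (Q-terms n k j α) (≡.trans (ℤΣ.∑<-single (suc n) j (s≤s j≤n) (Q-term-off n k j α))
    (≡.cong₂ (λ b d → b ▸ᶻ coeff (2 ℕ.+ length α) (part n j (length α)) (k ∷ d ∷ α)) (≤ᵇ-true (ℕ.≤-refl {j})) (ℕ.n∸n≡0 j)))

  Q-zero : ∀ n k j α → n < j → Q l n k j α ≡ + 0
  Q-zero n k j α n<j = ≡.trans (Q-terms n k j α) (ℤΣ.∑<-zero (suc n)
    (λ { i (s≤s i≤n) → Q-term-off n k j α i (ℕ.<⇒≢ (ℕ.≤-<-trans i≤n n<j)) }))

  module QShape (n j : ℕ) (j≤n : j ≤ n) where
    L : Expansion
    L = proj₁ (part-expands n j)

    Q-evalAt : ∀ k α → Q l n k j α ≡ + evalAt (l * (n ∸ j)) L k α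
    Q-evalAt k α = ≡.trans (Q-part n k j α j≤n) (≡.trans
      (coeff-cong (2 ℕ.+ length α) (proj₂ (proj₂ (part-expands n j)) (length α)) (k ∷ 0 ∷ α))
      (C.coeff-eval-0 (length α) (l * (n ∸ j)) L k α ≡.refl))

    open Shape (λ k → Q l n k j) (l * (n ∸ j)) L Q-evalAt public

  h-positive : ∀ n k j → HPos (Q l n k j)
  h-positive n k j with j ℕ.≤? n
  ... | yes j≤n = QShape.hpos n j j≤n k
  ... | no j≰n  = [] , [] , λ α → Q-zero n k j α (ℕ.≰⇒> j≰n)

  Q-symUnimodal : ∀ n j → 1 ≤ n → j ≤ n → SymUnimodal (λ k → Q l n k j) (l * n ∸ 1) (l * (n ∸ j))
  Q-symUnimodal n@(suc n′) j _ j≤n = symUnimodal (l * n ∸ 1) beyond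
    where
    open QShape n j j≤n
    c = l * (n ∸ j)
    c≤ : c ≤ l * n
    c≤ = ℕ.*-monoʳ-≤ l (ℕ.m∸n≤m n j)
    low : All (λ e → 1 ⊓ (n ∸ j) ≤ proj₁ e) L
    low = proj₁ (proj₂ (part-expands n j))
    -- For j = 0 the degree bound ln − 1 is one less than twice the centre, but then t divides every term.
    beyond : ∀ i → l * n ∸ 1 < i → IsZeroF (Q l n i j)
    beyond i D<i with ℕ.m≤n⇒m<n∨m≡n (ℕ.≤-trans c≤ D<i)
    ... | inj₁ c<i = vanishes i c<i
    ... | inj₂ ≡.refl with n ∸ j in eq
    ...   | zero  = ⊥-elim (ℕ.n≮0 (≡.subst (l * n ∸ 1 <_) (ℕ.*-zeroʳ l) D<i))
    ...   | suc d = λ α → ≡.trans (symmetric′ α) (≡.trans (Q-evalAt 0 α) (≡.cong +_ (evalAt-zero _ L 0 α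
              (All.map (λ {e} 1≤s → off (proj₁ e) 1≤s) low′))))
      where
      symmetric′ : ∀ α → Q l n (l * suc d) j α ≡ Q l n 0 j α
      symmetric′ α = ≡.trans (≡.cong (λ m → Q l n (l * m) j α) (≡.sym eq))
        (≡.trans (symmetric c ℕ.≤-refl α) (≡.cong (λ m → Q l n m j α) (ℕ.n∸n≡0 c)))
      low′ : All (λ e → 1 ≤ proj₁ e) L
      low′ = ≡.subst (λ m → All (λ e → 1 ⊓ m ≤ proj₁ e) L) eq low
      off : ∀ s → 1 ≤ s → inInterval s c 0 ≡ false
      off (suc s) _ = ≡.refl

  total : ℕ → Family
  total n N = FiniteSums.∑< (MPS (2 ℕ.+ N)) (suc n) (λ j → part n j N)

  Qnk-∑< : ∀ n k α → Qnk l n k α ≡ ℤΣ.∑< (suc n) (λ j → Q l n k j α)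
  Qnk-∑< n k α = ≡.trans (go (upTo (suc n))) (ℤΣ.∑-upTo (suc n) (λ j → Q l n k j α))
    where
    go : ∀ js → sumℤ (map (λ j → Q l n k j α) js) ≡ ℤΣ.∑ js (λ j → Q l n k j α)
    go []       = ≡.refl
    go (j ∷ js) = ≡.cong (ℤ._+_ (Q l n k j α)) (go js)

  Qnk-total : ∀ n k α → Qnk l n k α ≡ coeff (2 ℕ.+ length α) (total n (length α)) (k ∷ 0 ∷ α)
  Qnk-total n k α = ≡.trans (Qnk-∑< n k α) (≡.trans (ℤΣ.∑<-cong (suc n) (λ { j (s≤s j≤n) → Q-part n k j α j≤n }))
    (≡.sym (coeff-∑< (2 ℕ.+ length α) (suc n) _ (k ∷ 0 ∷ α))))

  opaque
    -- The part j = 0 is F_{n+1} = Σ_a [a] h_a F_{n+1-a}. Its a-th term is joined with the part j =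
    -- a, which turns [a] into 1 + [a], an interval of degree la - 1 instead of la. All terms then
    -- have degree l(n + 1) - 1.
    total-expands : ∀ n → Expands 0 (l * suc n ∸ 1) (total (suc n))
    total-expands n = expands-cong regroup
        (expands-∑< (suc n) (λ i N → K._*_ N (K._*_ N (interval N 0 (l * suc i ∸ 1)) (h N (suc i))) (F N (n ∸ i))) term)
      where
      term : ∀ i → i < suc n → Expands 0 (l * suc n ∸ 1)
        (λ N → K._*_ N (K._*_ N (interval N 0 (l * suc i ∸ 1)) (h N (suc i))) (F N (n ∸ i)))
      term i (s≤s i≤n) = ≡.subst (λ c → Expands 0 c (λ N → K._*_ N (K._*_ N (interval N 0 (l * suc i ∸ 1)) (h N (suc i))) (F N (n ∸ i)))) (ℕ.suc-injective (degrees n i i≤n))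
        (expands-* 0 (l * suc i ∸ 1) (suc i) (expands-weaken z≤n (F-expands (n ∸ i))))
      regroup : ∀ N → K._≈_ N (total (suc n) N)
        (FiniteSums.∑< (MPS (2 ℕ.+ N)) (suc n) (λ i → K._*_ N (K._*_ N (interval N 0 (l * suc i ∸ 1)) (h N (suc i))) (F N (n ∸ i))))
      regroup N = trans (∑<-suc (suc n) _) (trans
        (+-congʳ (trans (*-congʳ (C.H-zero N 1# N)) (trans (*-identityˡ _) (C.F-suc N n))))
        (trans (sym (∑<-+ (suc n) _ _)) (∑<-cong (suc n) (λ i _ → trans
          (solve 3 (λ b h f → (b :* h) :* f :+ h :* f := ((con (+ 1) :+ b) :* h) :* f) refl ([_]ₜ N (suc i)) (h N (suc i)) (F N (n ∸ i)))
          (*-congʳ (*-congʳ (sym (interval-0 N (suc i)))))))))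
        where
        open CommutativeRing (MPS (2 ℕ.+ N)) using (trans; sym; refl; +-congʳ; *-congʳ; *-identityˡ; 1#)
        open FiniteSums (MPS (2 ℕ.+ N))
        open IntegerSolver (MPS (2 ℕ.+ N)) using (solve; _:=_; _:+_; _:*_; con)

  Qnk-symUnimodal : ∀ n → 1 ≤ n → SymUnimodal (Qnk l n) (l * n ∸ 1) (l * n ∸ 1)
  Qnk-symUnimodal (suc n) _ = symUnimodal (l * suc n ∸ 1) vanishes
    where
    open Shape (Qnk l (suc n)) (l * suc n ∸ 1) (proj₁ (total-expands n)) (λ k α → ≡.trans (Qnk-total (suc n) k α) (≡.trans
      (coeff-cong (2 ℕ.+ length α) (proj₂ (proj₂ (total-expands n)) (length α)) (k ∷ 0 ∷ α))
      (C.coeff-eval-0 (length α) (l * suc n ∸ 1) (proj₁ (total-expands n)) k α ≡.refl)))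

  -- With a single variable, k = 0 and j = n, the only ornament consists of n copies of the
  -- 0-coloured singleton. The value is computed as the coefficient of h_n F_0.
  Q-singletons : ∀ n → Q l n 0 n (n ∷ []) ≡ + 1
  Q-singletons n = ≡.trans (Q-part n 0 n (n ∷ []) ℕ.≤-refl) (≡.trans (coeff-cong 3 simplify (0 ∷ 0 ∷ n ∷ []))
    (≡.trans (hom-suc 0 n n) (≡.cong₂ (λ b m → b ▸ᶻ hom 0 m) (≤ᵇ-true (ℕ.≤-refl {n})) (ℕ.n∸n≡0 n))))
    where
    simplify : K._≈_ 1 (part n n 1) (ι 1 (hom 1 n))
    simplify = K.trans 1 (K.*-cong 1 (C.h≈ι-hom 1 n) (K.trans 1 (K.reflexive 1 (≡.cong (F 1) (ℕ.n∸n≡0 n))) (C.F-zero 1))) (K.*-identityʳ 1 _)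

  -- The summands over j are counts, so nothing can cancel the contribution 1 of `Q-singletons` at j
  -- = n.
  Qnk-nonzero : ∀ n → NonzeroPoly (Qnk l n) (l * n ∸ 1)
  Qnk-nonzero n = 0 , z≤n , n ∷ [] , λ eq → positive (≡.trans (≡.sym split) eq)
    where
    rest : ℤ
    rest = ℤΣ.∑< n (λ j → Q l n 0 j (n ∷ []))
    natural : ∀ m (f : ℕ → ℕ) → ∃[ y ] ℤΣ.∑< m (λ j → + f j) ≡ + y
    natural zero    f = 0 , ℤΣ.∑<-empty _
    natural (suc m) f with natural m (f ∘ suc)
    ... | y , eq = f 0 ℕ.+ y , ≡.trans (ℤΣ.∑<-suc m _) (≡.cong (ℤ._+_ (+ f 0)) eq)
    split : Qnk l n 0 (n ∷ []) ≡ rest ℤ.+ + 1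
    split = ≡.trans (Qnk-∑< n 0 (n ∷ [])) (≡.trans (ℤΣ.∑<-last n _) (≡.cong (ℤ._+_ rest) (Q-singletons n)))
    positive : rest ℤ.+ + 1 ≢ + 0
    positive eq with natural n (λ j → Qcount l n 0 j (n ∷ []))
    ... | y , p with ≡.trans (≡.sym (ℤ.pos-+ y 1)) (≡.trans (≡.cong (ℤ._+ + 1) (≡.sym p)) eq)
    ...   | q = ℕ.m+1+n≢0 y (ℤ.+-injective q)

theorem4p8 : (l : ℕ) → 1 ≤ l →
    (∀ n k j → HPos (Q l n k j))
    × (∀ n j → 1 ≤ n → j ≤ n →
    NonzeroPoly (λ k → Q l n k j) (l * n ∸ 1) →
    SymUnimodal (λ k → Q l n k j) (l * n ∸ 1) (l * (n ∸ j)))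
    × (∀ n → 1 ≤ n →
    NonzeroPoly (Qnk l n) (l * n ∸ 1)
    × SymUnimodal (Qnk l n) (l * n ∸ 1) (l * n ∸ 1))
theorem4p8 (suc l′) _ = Main.h-positive l′
  , (λ n j 1≤n j≤n _ → Main.Q-symUnimodal l′ n j 1≤n j≤n)
  , (λ n 1≤n → Main.Qnk-nonzero l′ n , Main.Qnk-symUnimodal l′ n 1≤n)
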